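{- Let $p$ and $r$ be different primes with $p\equiv1\pmod4$, and let $c,k,m,q,t$ be integers with $m=4t$, $q=p^m$, $c=\frac{q-1}{4}$ and $k=\frac4r\Psi_r(q)$, where $\Psi_r(x)=x^{r-1}+\cdots+x+1$. If $q\equiv1\pmod r$ and $\gcd(4,r)=1$, then the weights of $\mathcal C(k,q^r)$ are $$w_{\ell_1,\ell_2,\ell_3,\ell_4}=\frac{p-1}{4p}\Big(hq+(\ell_1+\ell_2-\ell_3-\ell_4)\sqrt q+\big(2a(\ell_1-\ell_2)+4b(\ell_3-\ell_4)\big)p^t\Big)$$ for $0\le h\le r$ and non-negative integers $\ell_1,\dots,\ell_4$ with $\ell_1+\ell_2+\ell_3+\ell_4=h$, where $a,b$ are the unique integers satisfying $\sqrt q=a^2+4b^2$, $a\equiv1\pmod4$ and $\gcd(a,p)=1$, with frequencies $$A_{\ell_1,\ell_2,\ell_3,\ell_4}=\binom{r}{h}\binom{h}{\ell_1,\ell_2,\ell_3,\ell_4}c^h.$$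
   Context: For a prime $p$, a power $Q$ of $p$, $k\mid Q-1$ and $n=\frac{Q-1}{k}$, $\mathcal C(k,Q)=\{(\mathrm{Tr}_{Q/p}(\gamma\,\omega^{ki}))_{i=0}^{n-1}:\gamma\in\mathbb F_Q\}$ with $\omega$ a primitive element of $\mathbb F_Q$; this is a $p$-ary code. Weights are Hamming weights and frequencies are numbers of codewords of a given weight. $\binom{h}{\ell_1,\dots,\ell_4}$ is the multinomial coefficient.
   Formalization: The integers a, b are not unique as claimed, since (a,−b) also qualifies (25 = (−3)²+4·(±2)²); the formal statement instead asserts that such a, b exist and gives the weights and frequencies for every such pair, without asserting uniqueness. -}

module Defs where

import Data.Nat as N
open import Data.Nat using (ℕ; zero; suc; _!; _∸_)
open import Data.Nat.ListAction using (sum)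
open import Data.Nat.Combinatorics using (_C_)
open import Data.Nat.Properties using (_!≢0; m*n≢0)
import Data.Integer as Z
import Data.Integer.Divisibility as ZD
open import Data.Nat.GCD using (gcd)
open import Data.Integer using (ℤ; +_)
open import Data.List as List using (List; []; _∷_; map; filter; length; upTo; concatMap; foldr; deduplicate)
open import Data.List.Properties using (≡-dec)
open import Data.List.Membership.Propositional using (_∈_)
open import Data.List.Relation.Unary.Unique.Propositional using (Unique)
open import Data.Product using (_×_; _,_; Σ)
open import Data.Bool using (T)
open import Relation.Nullary using (¬_; ¬?; yes; no)
open import Relation.Nullary.Decidable using (⌊_⌋)
open import Relation.Binary.PropositionalEquality using (_≡_; _≢_)
open import Relation.Binary.Definitions using (DecidableEquality)
open import Algebra.Structures using (IsCommutativeRing)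

record FiniteField : Set₁ where
  field
    Carrier  : Set
    _+_ _*_  : Carrier → Carrier → Carrier
    -_       : Carrier → Carrier
    0# 1#    : Carrier
    isCommutativeRing : IsCommutativeRing _≡_ _+_ _*_ -_ 0# 1#
    0≢1      : 0# ≢ 1#
    inverse  : ∀ x → x ≢ 0# → Σ Carrier (λ y → x * y ≡ 1#)
    _≟_      : DecidableEquality Carrier
    elements : List Carrier
    unique   : Unique elements
    complete : ∀ x → x ∈ elements

  infixl 6 _+_
  infixl 7 _*_

  card : ℕ
  card = length elements

  pow : Carrier → ℕ → Carrier
  pow x zero    = 1#
  pow x (suc n) = x * pow x n

  IsPrimitive : Carrier → Set
  IsPrimitive ω = (pow ω (card ∸ 1) ≡ 1#)
                × (∀ j → 0 N.< j → j N.< card ∸ 1 → pow ω j ≢ 1#)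

  -- absolute trace Tr_{Q/p}(x) = Σ_{j=0}^{e-1} x^{p^j}, where Q = p^e
  trace : (p e : ℕ) → Carrier → Carrier
  trace p e x = foldr _+_ 0# (map (λ j → pow x (p N.^ j)) (upTo e))

  codeword : (p e k n : ℕ) → Carrier → Carrier → List Carrier
  codeword p e k n ω γ = map (λ i → trace p e (γ * pow ω (k N.* i))) (upTo n)

  weight : List Carrier → ℕ
  weight v = length (filter (λ x → ¬? (x ≟ 0#)) v)

  code : (p e k n : ℕ) → Carrier → List (List Carrier)
  code p e k n ω = deduplicate (≡-dec _≟_) (map (codeword p e k n ω) elements)

  frequency : (p e k n : ℕ) → Carrier → ℕ → ℕ
  frequency p e k n ω w = length (filter (λ v → weight v N.≟ w) (code p e k n ω))

Ψ : ℕ → ℕ → ℕ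
Ψ r x = sum (map (x N.^_) (upTo r))

multinomial : ℕ → ℕ → ℕ → ℕ → ℕ → ℕ
multinomial h l1 l2 l3 l4 = (h !) N./ (l1 ! N.* l2 ! N.* l3 ! N.* l4 !)
  where instance
    _ = l1 !≢0
    _ = l2 !≢0
    _ = l3 !≢0
    _ = l4 !≢0
    _ = m*n≢0 (l1 !) (l2 !)
    _ = m*n≢0 (l1 ! N.* l2 !) (l3 !)
    _ = m*n≢0 (l1 ! N.* l2 ! N.* l3 !) (l4 !)

Tuple : Set
Tuple = ℕ × ℕ × ℕ × ℕ

tuples : ℕ → List Tuple
tuples r = filter (λ { (a , b , c , d) → (a N.+ b N.+ c N.+ d) N.≤? r })
  (concatMap (λ a → concatMap (λ b → concatMap (λ c → map (λ d → (a , b , c , d))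
    (upTo (suc r))) (upTo (suc r))) (upTo (suc r))) (upTo (suc r)))

total : Tuple → ℕ
total (a , b , c , d) = a N.+ b N.+ c N.+ d

-- 4p · w_{l1,l2,l3,l4} / (p-1)
--   = h q + (l1+l2-l3-l4) √q + (2a(l1-l2) + 4b(l3-l4)) p^t,  with √q = p^{2t}
weightNumerator : (p t q : ℕ) (a b : ℤ) → Tuple → ℤ
weightNumerator p t q a b (l1 , l2 , l3 , l4) =
  (+ (total (l1 , l2 , l3 , l4) N.* q))
  Z.+ ((+ l1 Z.+ + l2 Z.- + l3 Z.- + l4) Z.* + (p N.^ (2 N.* t)))
  Z.+ ((+ 2 Z.* a Z.* (+ l1 Z.- + l2) Z.+ + 4 Z.* b Z.* (+ l3 Z.- + l4)) Z.* + (p N.^ t))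

A : (r c : ℕ) → Tuple → ℕ
A r c (l1 , l2 , l3 , l4) =
  let h = l1 N.+ l2 N.+ l3 N.+ l4 in
  (r C h) N.* multinomial h l1 l2 l3 l4 N.* (c N.^ h)

predictedFrequency : (p t q r c : ℕ) (a b : ℤ) → ℕ → ℕ
predictedFrequency p t q r c a b w =
  sum (map (A r c) (filter (λ l →
     + (4 N.* p N.* w) Z.≟ (+ (p ∸ 1)) Z.* weightNumerator p t q a b l) (tuples r)))

ABCond : (p t : ℕ) → ℤ → ℤ → Set
ABCond p t a b = (+ (p N.^ (2 N.* t)) ≡ a Z.* a Z.+ + 4 Z.* b Z.* b)
               × (+ 4 ZD.∣ (a Z.- + 1))
               × (gcd (Z.∣ a ∣) p ≡ 1)

{-# OPTIONS --safe #-}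

-- Put α = ω^k, of order r c, and β = α^r, a generator of the group of fourth powers of 𝔽_q^*.
-- As α^(q-1) is a primitive r-th root of unity, the relative traces Tr_{q^r/q}(γ α^j), j < r, are up to
-- the factors α^j the discrete Fourier transform of the conjugates of γ; hence they give a bijection
-- 𝔽_{q^r} → 𝔽_q^r.  The weight of the codeword of γ is the sum over j of the weights W(Tr(γ α^j)),
-- where W(δ) = #{x fourth power : Tr_{q/p}(δ x) ≠ 0} depends only on the quartic class of δ, and the
-- frequencies follow by counting the words over 𝔽_q with a given number of letters in each class.
--
-- The four values of W are quartic Gaussian periods.  They are integers, since 𝔽_p^* consists of fourth
-- powers of 𝔽_q.  With s = √q, the quadratic Gauss sum is −s, because the quadratic character of 𝔽_q is
-- trivial on 𝔽_s and −1 on the line x^s = −x.  The quartic Gauss sum G satisfies |G|² = q and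
-- G² = −s J with a Jacobi sum J ∈ ℤ[i].  The conjugate of J reduces modulo a prime above p to
-- ± C(3c, c), which is prime to p, so p does not divide J.  Therefore G = p^t (a + 2 b i) with
-- a² + 4 b² = s and p ∤ a, and integrality of the periods makes a odd.  Such a representation of
-- s = p^(2t) is unique up to the signs of a and b, and a change of sign only permutes the classes.

module Submission where

open import Defs
open import Data.Nat using (ℕ; zero; suc; pred; _+_; _*_; _^_; _∸_; _/_; _%_; _!; _≤_; _<_; _≤?_; z≤n; s≤s; NonZero; >-nonZero; nonTrivial⇒n>1)
import Data.Nat as ℕ
import Data.Nat.Properties as ℕₚ
open import Data.Nat.Properties using (_!≢0)
open import Data.Nat.Combinatorics using (_C_; nCn≡1; k![n∸k]!∣n!)
open import Data.Nat.Combinatorics.Specification using (nCk≡n!/k![n-k]!)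
open import Data.Nat.Coprimality using (Coprime; coprime-Bézout; coprime-/gcd; coprime-divisor; gcd≡1⇒coprime) renaming (sym to coprime-sym)
open import Data.Nat.Divisibility using (_∣_; divides; ∣⇒≤; ∣-refl; ∣-trans; ∣m+n∣m⇒∣n; ∣n⇒∣m*n; ∣m⇒∣m*n; m∣m*n; *-cancelˡ-∣; *-cancelʳ-∣; m%n≡0⇒n∣m)
open import Data.Nat.DivMod using (m/n*n≡m; m≡m%n+[m/n]*n; m%n<n)
open import Data.Nat.GCD using (gcd; gcd[m,n]∣m; gcd[m,n]∣n; gcd[m,n]≢0; gcd-greatest; module Bézout)
open import Data.Nat.ListAction using (sum)
open import Data.Nat.Primality using (Prime; euclidsLemma; prime⇒nonZero; prime⇒nonTrivial; prime⇒irreducible; prime[2])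
open import Data.Nat.Tactic.RingSolver using (solve-∀)
open import Data.Integer using (ℤ; -1ℤ; 0ℤ; 1ℤ) renaming (+_ to pos; _+_ to _+ᶻ_; _*_ to _*ᶻ_; -_ to ⁻_; _-_ to _-ᶻ_)
import Data.Integer as ℤ
import Data.Integer.Properties as ℤₚ
open import Data.Integer.DivMod using (a≡a%ℕn+[a/ℕn]*n; n%ℕd<d)
import Data.Integer.Divisibility.Signed as ℤ∣
open ℤ∣ using (∣ᵤ⇒∣; ∣⇒∣ᵤ) renaming (_∣_ to _∣ᶻ_; _∣?_ to _∣?ᶻ_; divides to dividesᶻ)
open import Data.Integer.Tactic.RingSolver using () renaming (solve-∀ to solveℤ)
open import Data.Fin using (Fin; toℕ)
import Data.Fin as Fin
open import Data.List using (List; []; _∷_; _++_; map; filter; foldr; length; upTo; applyUpTo; concatMap; deduplicate)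
open import Data.List.Properties using (length-upTo; length-map; length-++; filter-all; map-upTo; ∷-injective; ≡-dec)
open import Data.List.Membership.Propositional using (_∈_; lose)
open import Data.List.Membership.Propositional.Properties using (∈-∃++; ∈-++⁻; ∈-++⁺ˡ; ∈-++⁺ʳ; ∈-map⁺; ∈-map⁻; ∈-filter⁺; ∈-filter⁻; ∈-upTo⁺; ∈-upTo⁻; ∈-concatMap⁺)
open import Data.List.Membership.Propositional.Properties.WithK using (unique∧set⇒bag)
open import Data.List.Relation.Binary.BagAndSetEquality using (∼bag⇒↭)
import Data.List.Relation.Binary.Permutation.Propositional as Perm
open Perm using (_↭_; ↭-sym)
open import Data.List.Relation.Binary.Permutation.Propositional.Properties using (shift; ∈-resp-↭; ↭-length)
open import Data.List.Relation.Unary.All as All using (All)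
open import Data.List.Relation.Unary.AllPairs using ([]; _∷_)
open import Data.List.Relation.Unary.Any using (here; there)
open import Data.List.Relation.Unary.Unique.Propositional using (Unique)
import Data.List.Relation.Unary.Unique.Propositional.Properties as Uniqueₚ
open import Data.Product using (_×_; Σ; _,_; ∃; ∃₂; proj₁; proj₂)
open import Data.Sum using (_⊎_; inj₁; inj₂; reduce) renaming (map to map⊎)
open import Data.Empty using (⊥; ⊥-elim)
open import Function using (_∘_; mk⇔)
open import Level using (0ℓ)
open import Relation.Nullary using (Dec; yes; no; ¬_; ¬?)
open import Relation.Nullary.Decidable using (decidable-stable)
open import Relation.Binary.Definitions using (DecidableEquality)
open import Relation.Binary.PropositionalEquality using (_≡_; _≢_; refl; sym; trans; cong; cong₂; subst; subst₂; module ≡-Reasoning)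
open import Algebra.Bundles using (CommutativeRing; CommutativeSemiring)
open import Algebra.Structures using (IsCommutativeSemiring)
import Algebra.Properties.Ring
import Algebra.Properties.CommutativeSemiring.Binomial
import Algebra.Properties.Semiring.Exp
import Algebra.Properties.Semiring.Mult
import Algebra.Properties.Semiring.Sum

-- No complex numbers occur. A nontrivial additive character ψ of 𝔽_p is replaced by its sum over
-- the scalars a ∈ 𝔽_p^*, which takes only the values p - 1 and -1. Since the quartic character is
-- trivial on 𝔽_p^*, the resulting sums `ER`, `EI` are exactly p - 1 times the two parts of the
-- Gauss sum G, and this accounts for the powers of p - 1 throughout. Character values are likewise
-- split into integer parts `R`, `I`, so that |G|² = q and G² = -s J become three integer equations.
-- These equations give 2 ER² and 2 EI² as (p - 1)² s times an integer, and the factor p^t comes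
-- from extracting square roots in ℤ, with no factorisation in ℤ[i]. The prime above p is the map i
-- ↦ ι into 𝔽_q. Under this map J itself goes to 0, because (x(1 - x))^c has degree 2c < q - 1; this
-- is why its conjugate, belonging to the exponent 3c, is reduced instead. All smaller fields are
-- fixed sets of Frobenius powers inside the given field `F`.

module _ {A : Set} where

  unique-set⇒↭ : {xs ys : List A} → Unique xs → Unique ys →
                 (∀ {x} → x ∈ xs → x ∈ ys) → (∀ {x} → x ∈ ys → x ∈ xs) → xs ↭ ys
  unique-set⇒↭ u v f g = ∼bag⇒↭ (unique∧set⇒bag u v (mk⇔ f g))

  -- Pigeonhole. `xs` may a priori have repetitions; the length bound excludes them. Surjectivity of
  -- the powers of ω and of the coordinate map is obtained from this by counting.
  unique-⊆⇒↭ : {ys xs : List A} → Unique ys → (∀ {x} → x ∈ ys → x ∈ xs) → length xs ≤ length ys → ys ↭ xs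
  unique-⊆⇒↭ {[]} {[]} _ _ _ = Perm.refl
  unique-⊆⇒↭ {y ∷ ys} {xs} (y∉ ∷ u) sub len with ∈-∃++ (sub (here refl))
  ... | as , bs , refl =
    Perm.trans (Perm.prep y (unique-⊆⇒↭ u sub′ (ℕₚ.≤-pred (subst (_≤ suc (length ys)) lem len)))) (↭-sym (shift y as bs))
    where
    sub′ : ∀ {x} → x ∈ ys → x ∈ as ++ bs
    sub′ x∈ with ∈-++⁻ as (sub (there x∈))
    ... | inj₁ p = ∈-++⁺ˡ p
    ... | inj₂ (there p) = ∈-++⁺ʳ as p
    ... | inj₂ (here refl) = ⊥-elim (All.lookup y∉ x∈ refl)
    lem : length (as ++ y ∷ bs) ≡ suc (length (as ++ bs))
    lem = trans (length-++ as) (trans (ℕₚ.+-suc (length as) (length bs)) (cong suc (sym (length-++ as))))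

  deduplicate-unique : (_≟_ : DecidableEquality A) {xs : List A} → Unique xs → deduplicate _≟_ xs ≡ xs
  deduplicate-unique _≟_ [] = refl
  deduplicate-unique _≟_ {x ∷ xs} (x∉ ∷ u) rewrite deduplicate-unique _≟_ u =
    cong (x ∷_) (filter-all (¬? ∘ (x ≟_)) x∉)

  map-unique : {B : Set} (f : A → B) {xs : List A} →
               (∀ {x y} → x ∈ xs → y ∈ xs → f x ≡ f y → x ≡ y) → Unique xs → Unique (map f xs)
  map-unique f inj [] = []
  map-unique f {x ∷ xs} inj (x∉ ∷ u) =
    All.tabulate (λ z∈ eq → let (y , y∈ , e) = ∈-map⁻ f z∈ in
      All.lookup x∉ y∈ (inj (here refl) (there y∈) (trans eq e)))
    ∷ map-unique f (λ a b → inj (there a) (there b)) u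

-- Finite sums over lists with values in a commutative semiring.

module Sum {A : Set} {_⊕_ _⊗_ : A → A → A} {0# 1# : A}
           (isCS : IsCommutativeSemiring _≡_ _⊕_ _⊗_ 0# 1#) where

  open IsCommutativeSemiring isCS using (+-assoc; +-comm; +-identityˡ; +-identityʳ; *-comm; *-identityˡ; distribˡ; distribʳ; zeroˡ; zeroʳ)

  private variable
    X Y P : Set

  ∑ : List X → (X → A) → A
  ∑ []       f = 0#
  ∑ (x ∷ xs) f = f x ⊕ ∑ xs f

  𝟙 : Dec P → A
  𝟙 (yes _) = 1#
  𝟙 (no _)  = 0#

  nat : ℕ → A
  nat zero    = 0#
  nat (suc n) = 1# ⊕ nat n

  interchange : ∀ a b c d → (a ⊕ b) ⊕ (c ⊕ d) ≡ (a ⊕ c) ⊕ (b ⊕ d)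
  interchange a b c d = begin
    (a ⊕ b) ⊕ (c ⊕ d)  ≡⟨ +-assoc a b _ ⟩
    a ⊕ (b ⊕ (c ⊕ d))  ≡⟨ cong (a ⊕_) (+-assoc b c d) ⟨
    a ⊕ ((b ⊕ c) ⊕ d)  ≡⟨ cong (λ z → a ⊕ (z ⊕ d)) (+-comm b c) ⟩
    a ⊕ ((c ⊕ b) ⊕ d)  ≡⟨ cong (a ⊕_) (+-assoc c b d) ⟩
    a ⊕ (c ⊕ (b ⊕ d))  ≡⟨ +-assoc a c _ ⟨
    (a ⊕ c) ⊕ (b ⊕ d)  ∎
    where open ≡-Reasoning

  𝟙-yes : (d : Dec P) → P → 𝟙 d ≡ 1#
  𝟙-yes (yes _) _ = refl
  𝟙-yes (no ¬p) p = ⊥-elim (¬p p)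

  𝟙-no : (d : Dec P) → ¬ P → 𝟙 d ≡ 0#
  𝟙-no (yes p) ¬p = ⊥-elim (¬p p)
  𝟙-no (no _) _   = refl

  𝟙-cong : ∀ {Q : Set} (d : Dec P) (d′ : Dec Q) → (P → Q) → (Q → P) → 𝟙 d ≡ 𝟙 d′
  𝟙-cong (yes p) d′ f g = sym (𝟙-yes d′ (f p))
  𝟙-cong (no ¬p) d′ f g = sym (𝟙-no d′ (¬p ∘ g))

  ∑-cong : (xs : List X) {f g : X → A} → (∀ x → x ∈ xs → f x ≡ g x) → ∑ xs f ≡ ∑ xs g
  ∑-cong []       _ = refl
  ∑-cong (x ∷ xs) h = cong₂ _⊕_ (h x (here refl)) (∑-cong xs (λ y y∈ → h y (there y∈)))

  ∑-cong′ : (xs : List X) {f g : X → A} → (∀ x → f x ≡ g x) → ∑ xs f ≡ ∑ xs g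
  ∑-cong′ xs h = ∑-cong xs (λ x _ → h x)

  ∑-zero : (xs : List X) {f : X → A} → (∀ x → x ∈ xs → f x ≡ 0#) → ∑ xs f ≡ 0#
  ∑-zero []       _ = refl
  ∑-zero (x ∷ xs) h = trans (cong₂ _⊕_ (h x (here refl)) (∑-zero xs (λ y y∈ → h y (there y∈)))) (+-identityˡ 0#)

  ∑-⊕ : (xs : List X) (f g : X → A) → ∑ xs (λ x → f x ⊕ g x) ≡ ∑ xs f ⊕ ∑ xs g
  ∑-⊕ []       f g = sym (+-identityˡ 0#)
  ∑-⊕ (x ∷ xs) f g = trans (cong ((f x ⊕ g x) ⊕_) (∑-⊕ xs f g)) (interchange (f x) (g x) _ _)

  ∑-⊗ˡ : (xs : List X) (a : A) (f : X → A) → ∑ xs (λ x → a ⊗ f x) ≡ a ⊗ ∑ xs f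
  ∑-⊗ˡ []       a f = sym (zeroʳ a)
  ∑-⊗ˡ (x ∷ xs) a f = trans (cong ((a ⊗ f x) ⊕_) (∑-⊗ˡ xs a f)) (sym (distribˡ a (f x) _))

  ∑-⊗ʳ : (xs : List X) (a : A) (f : X → A) → ∑ xs (λ x → f x ⊗ a) ≡ ∑ xs f ⊗ a
  ∑-⊗ʳ xs a f = trans (∑-cong′ xs (λ x → *-comm (f x) a)) (trans (∑-⊗ˡ xs a f) (*-comm a _))

  ∑-const : (xs : List X) (a : A) → ∑ xs (λ _ → a) ≡ nat (length xs) ⊗ a
  ∑-const []       a = sym (zeroˡ a)
  ∑-const (x ∷ xs) a = trans (cong₂ _⊕_ (sym (*-identityˡ a)) (∑-const xs a)) (sym (distribʳ a 1# _))

  ∑-swap : (xs : List X) (ys : List Y) (f : X → Y → A) →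
           ∑ xs (λ x → ∑ ys (f x)) ≡ ∑ ys (λ y → ∑ xs (λ x → f x y))
  ∑-swap []       ys f = sym (∑-zero ys (λ _ _ → refl))
  ∑-swap (x ∷ xs) ys f = trans (cong (∑ ys (f x) ⊕_) (∑-swap xs ys f)) (sym (∑-⊕ ys (f x) _))

  ∑-product : (xs : List X) (ys : List Y) (f : X → A) (g : Y → A) →
              ∑ xs (λ x → ∑ ys (λ y → f x ⊗ g y)) ≡ ∑ xs f ⊗ ∑ ys g
  ∑-product xs ys f g = trans (∑-cong′ xs (λ x → ∑-⊗ˡ ys (f x) g)) (∑-⊗ʳ xs (∑ ys g) f)

  ∑-map : (h : X → Y) (xs : List X) (f : Y → A) → ∑ (map h xs) f ≡ ∑ xs (f ∘ h)
  ∑-map h []       f = refl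
  ∑-map h (x ∷ xs) f = cong (f (h x) ⊕_) (∑-map h xs f)

  ∑-++ : (xs ys : List X) (f : X → A) → ∑ (xs ++ ys) f ≡ ∑ xs f ⊕ ∑ ys f
  ∑-++ []       ys f = sym (+-identityˡ _)
  ∑-++ (x ∷ xs) ys f = trans (cong (f x ⊕_) (∑-++ xs ys f)) (sym (+-assoc (f x) _ _))

  ∑-concatMap : (h : X → List Y) (xs : List X) (f : Y → A) → ∑ (concatMap h xs) f ≡ ∑ xs (λ x → ∑ (h x) f)
  ∑-concatMap h []       f = refl
  ∑-concatMap h (x ∷ xs) f = trans (∑-++ (h x) _ f) (cong (∑ (h x) f ⊕_) (∑-concatMap h xs f))

  ∑-↭ : {xs ys : List X} → xs ↭ ys → (f : X → A) → ∑ xs f ≡ ∑ ys f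
  ∑-↭ Perm.refl   f = refl
  ∑-↭ (Perm.prep x p)  f = cong (f x ⊕_) (∑-↭ p f)
  ∑-↭ (Perm.swap {xs} {ys} x y p) f = begin
    f x ⊕ (f y ⊕ ∑ xs f)  ≡⟨ +-assoc (f x) (f y) _ ⟨
    (f x ⊕ f y) ⊕ ∑ xs f  ≡⟨ cong₂ _⊕_ (+-comm (f x) (f y)) (∑-↭ p f) ⟩
    (f y ⊕ f x) ⊕ ∑ ys f  ≡⟨ +-assoc (f y) (f x) _ ⟩
    f y ⊕ (f x ⊕ ∑ ys f)  ∎
    where open ≡-Reasoning
  ∑-↭ (Perm.trans p q) f = trans (∑-↭ p f) (∑-↭ q f)

  ∑-filter : {P : X → Set} (P? : ∀ x → Dec (P x)) (xs : List X) (f : X → A) →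
             ∑ (filter P? xs) f ≡ ∑ xs (λ x → 𝟙 (P? x) ⊗ f x)
  ∑-filter P? []       f = refl
  ∑-filter P? (x ∷ xs) f with P? x
  ... | yes _ = cong₂ _⊕_ (sym (*-identityˡ (f x))) (∑-filter P? xs f)
  ... | no  _ = trans (∑-filter P? xs f) (trans (sym (+-identityˡ _)) (cong₂ _⊕_ (sym (zeroˡ (f x))) refl))

  ∑-single : {xs : List X} → Unique xs → ∀ {a} → a ∈ xs → (f : X → A) →
             (∀ x → x ∈ xs → x ≢ a → f x ≡ 0#) → ∑ xs f ≡ f a
  ∑-single (x∉ ∷ u) (here refl) f h =
    trans (cong (f _ ⊕_) (∑-zero _ (λ y y∈ → h y (there y∈) (λ e → All.lookup x∉ y∈ (sym e))))) (+-identityʳ _)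
  ∑-single (x∉ ∷ u) (there a∈) f h =
    trans (cong₂ _⊕_ (h _ (here refl) (All.lookup x∉ a∈)) (∑-single u a∈ f (λ y y∈ → h y (there y∈)))) (+-identityˡ _)

  ∑-reindex : {xs : List X} → Unique xs → (h h⁻¹ : X → X) →
              (∀ x → x ∈ xs → h x ∈ xs) → (∀ x → x ∈ xs → h⁻¹ x ∈ xs) →
              (∀ x → x ∈ xs → h (h⁻¹ x) ≡ x) → (∀ x → x ∈ xs → h⁻¹ (h x) ≡ x) →
              (f : X → A) → ∑ xs f ≡ ∑ xs (f ∘ h)
  ∑-reindex {xs = xs} u h h⁻¹ cl cl⁻¹ inv inv′ f = trans (∑-↭ perm f) (∑-map h xs f)
    where
    inj : ∀ {x y} → x ∈ xs → y ∈ xs → h x ≡ h y → x ≡ y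
    inj x∈ y∈ e = trans (sym (inv′ _ x∈)) (trans (cong h⁻¹ e) (inv′ _ y∈))
    perm : xs ↭ map h xs
    perm = unique-set⇒↭ u (map-unique h inj u)
      (λ {x} x∈ → subst (_∈ map h xs) (inv x x∈) (∈-map⁺ h (cl⁻¹ x x∈)))
      (λ z∈ → let (y , y∈ , e) = ∈-map⁻ h z∈ in subst (_∈ xs) (sym e) (cl y y∈))

  ∑-upTo-suc : ∀ n (f : ℕ → A) → ∑ (upTo (suc n)) f ≡ f 0 ⊕ ∑ (upTo n) (f ∘ suc)
  ∑-upTo-suc n f = cong (f 0 ⊕_) (trans (cong (λ l → ∑ l f) (sym (map-upTo suc n))) (∑-map suc (upTo n) f))

  ∑-upTo-+ : ∀ m n (f : ℕ → A) → ∑ (upTo (m + n)) f ≡ ∑ (upTo m) f ⊕ ∑ (upTo n) (λ i → f (m + i))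
  ∑-upTo-+ zero    n f = sym (+-identityˡ _)
  ∑-upTo-+ (suc m) n f = begin
    ∑ (upTo (suc m + n)) f                                          ≡⟨ ∑-upTo-suc (m + n) f ⟩
    f 0 ⊕ ∑ (upTo (m + n)) (f ∘ suc)                                ≡⟨ cong (f 0 ⊕_) (∑-upTo-+ m n (f ∘ suc)) ⟩
    f 0 ⊕ (∑ (upTo m) (f ∘ suc) ⊕ ∑ (upTo n) (λ i → f (suc m + i))) ≡⟨ +-assoc (f 0) _ _ ⟨
    (f 0 ⊕ ∑ (upTo m) (f ∘ suc)) ⊕ ∑ (upTo n) (λ i → f (suc m + i)) ≡⟨ cong₂ _⊕_ (∑-upTo-suc m f) refl ⟨
    ∑ (upTo (suc m)) f ⊕ ∑ (upTo n) (λ i → f (suc m + i))           ∎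
    where open ≡-Reasoning

  ∑-upTo-* : ∀ m n (f : ℕ → A) → ∑ (upTo (m * n)) f ≡ ∑ (upTo m) (λ i → ∑ (upTo n) (λ j → f (i * n + j)))
  ∑-upTo-* zero    n f = refl
  ∑-upTo-* (suc m) n f = begin
    ∑ (upTo (n + m * n)) f                               ≡⟨ ∑-upTo-+ n (m * n) f ⟩
    ∑ (upTo n) f ⊕ ∑ (upTo (m * n)) (λ i → f (n + i))    ≡⟨ cong (∑ (upTo n) f ⊕_) (∑-upTo-* m n (λ i → f (n + i))) ⟩
    ∑ (upTo n) f ⊕ ∑ (upTo m) (λ i → ∑ (upTo n) (λ j → f (n + (i * n + j))))
      ≡⟨ cong (∑ (upTo n) f ⊕_) (∑-cong′ (upTo m) (λ i → ∑-cong′ (upTo n) (λ j → cong f (ℕₚ.+-assoc n (i * n) j)))) ⟨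
    ∑ (upTo n) f ⊕ ∑ (upTo m) (λ i → ∑ (upTo n) (λ j → f (suc i * n + j)))
      ≡⟨ ∑-upTo-suc m (λ i → ∑ (upTo n) (λ j → f (i * n + j))) ⟨
    ∑ (upTo (suc m)) (λ i → ∑ (upTo n) (λ j → f (i * n + j))) ∎
    where open ≡-Reasoning

  nat-+ : ∀ m n → nat (m + n) ≡ nat m ⊕ nat n
  nat-+ zero    n = sym (+-identityˡ _)
  nat-+ (suc m) n = trans (cong (1# ⊕_) (nat-+ m n)) (sym (+-assoc 1# _ _))

  nat-* : ∀ m n → nat (m * n) ≡ nat m ⊗ nat n
  nat-* zero    n = sym (zeroˡ _)
  nat-* (suc m) n = begin
    nat (n + m * n)             ≡⟨ nat-+ n (m * n) ⟩
    nat n ⊕ nat (m * n)         ≡⟨ cong₂ _⊕_ (sym (*-identityˡ _)) (nat-* m n) ⟩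
    (1# ⊗ nat n) ⊕ (nat m ⊗ nat n) ≡⟨ distribʳ _ _ _ ⟨
    (1# ⊕ nat m) ⊗ nat n        ∎
    where open ≡-Reasoning

-- Factorials and binomial coefficients modulo a prime.

nCk*k![n∸k]!≡n! : ∀ {n k} → k ≤ n → (n C k) * (k ! * (n ∸ k) !) ≡ n !
nCk*k![n∸k]!≡n! {n} {k} k≤n = trans (cong (_* (k ! * (n ∸ k) !)) (nCk≡n!/k![n-k]! k≤n)) (m/n*n≡m (k![n∸k]!∣n! k≤n))
  where instance _ = ℕₚ.m*n≢0 (k !) ((n ∸ k) !) {{k !≢0}} {{(n ∸ k) !≢0}}

^≡1mod4 : ∀ {p} d → p ≡ 4 * d + 1 → ∀ n → ∃ λ c → 4 * c + 1 ≡ p ^ n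
^≡1mod4 d p≡ zero = 0 , refl
^≡1mod4 {p} d p≡ (suc n) with ^≡1mod4 d p≡ n
... | c , e = p * c + d , trans (lem p c d) (trans (cong (4 * (p * c) +_) (sym p≡)) (trans (lem′ p c) (cong (p *_) e)))
  where
  lem : ∀ p c d → 4 * (p * c + d) + 1 ≡ 4 * (p * c) + (4 * d + 1)
  lem = solve-∀
  lem′ : ∀ p c → 4 * (p * c) + p ≡ p * (4 * c + 1)
  lem′ = solve-∀

module _ {p : ℕ} (pr : Prime p) where

  private instance
    p≢0 : NonZero p
    p≢0 = prime⇒nonZero pr

  prime>1 : 1 < p
  prime>1 = nonTrivial⇒n>1 p {{prime⇒nonTrivial pr}}

  ∤-< : ∀ {m} → 0 < m → m < p → ¬ p ∣ m
  ∤-< {suc m} _ m<p p∣m = ℕₚ.<⇒≱ m<p (∣⇒≤ p∣m)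

  ∤-* : ∀ {m n} → ¬ p ∣ m → ¬ p ∣ n → ¬ p ∣ m * n
  ∤-* {m} {n} a b d with euclidsLemma m n pr d
  ... | inj₁ x = a x
  ... | inj₂ x = b x

  prime∤! : ∀ {m} → m < p → ¬ p ∣ m !
  prime∤! {zero}  m<p = ∤-< (s≤s z≤n) prime>1
  prime∤! {suc m} m<p = ∤-* (∤-< (s≤s z≤n) m<p) (prime∤! (ℕₚ.<-trans (ℕₚ.n<1+n m) m<p))

  p∣p! : p ∣ p !
  p∣p! = subst (λ z → p ∣ z !) (ℕₚ.suc-pred p) (subst (_∣ suc (pred p) !) (ℕₚ.suc-pred p) (m∣m*n (pred p !)))

  prime∣C : ∀ {k} → 0 < k → k < p → p ∣ p C k
  prime∣C {k} 0<k k<p with euclidsLemma (p C k) (k ! * (p ∸ k) !) pr (subst (p ∣_) (sym (nCk*k![n∸k]!≡n! (ℕₚ.<⇒≤ k<p))) p∣p!)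
  ... | inj₁ d = d
  ... | inj₂ d = ⊥-elim (∤-* (prime∤! k<p) (prime∤! (ℕₚ.∸-monoʳ-< 0<k (ℕₚ.<⇒≤ k<p))) d)

  -- Among 1, ..., pk + d the multiples of p contribute p^k k!, and `u` is the product of the other
  -- factors.
  factorial-split : ∀ k d → d < p → ∃ λ u → (p * k + d) ! ≡ p ^ k * k ! * u × ¬ p ∣ u
  factorial-split zero zero _ = 1 , cong _! (trans (ℕₚ.+-identityʳ _) (ℕₚ.*-zeroʳ p)) , ∤-< (s≤s z≤n) prime>1
  -- A multiple of p is reached from the last position p - 1 of the preceding block, and it is the
  -- only kind of factor that feeds p^k k!.
  factorial-split (suc k) zero _ with factorial-split k (p ∸ 1) (ℕₚ.∸-monoʳ-< (s≤s z≤n) (ℕₚ.<⇒≤ prime>1))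
  ... | u , eq , p∤u = u , lem , p∤u
    where
    open ≡-Reasoning
    step : p * suc k + 0 ≡ suc (p * k + (p ∸ 1))
    step = begin
      p * suc k + 0            ≡⟨ ℕₚ.+-identityʳ _ ⟩
      p * suc k                ≡⟨ ℕₚ.*-suc p k ⟩
      p + p * k                ≡⟨ ℕₚ.+-comm p _ ⟩
      p * k + p                ≡⟨ cong (p * k +_) (ℕₚ.suc-pred p) ⟨
      p * k + suc (p ∸ 1)      ≡⟨ ℕₚ.+-suc _ _ ⟩
      suc (p * k + (p ∸ 1))    ∎
    shuffle : ∀ a b c d e → (a * b) * (c * d * e) ≡ (a * c) * (b * d) * e
    shuffle = solve-∀
    lem : (p * suc k + 0) ! ≡ p ^ suc k * (suc k) ! * u
    lem = begin
      (p * suc k + 0) !                                    ≡⟨ cong _! step ⟩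
      suc (p * k + (p ∸ 1)) * (p * k + (p ∸ 1)) !          ≡⟨ cong₂ _*_ (trans (sym step) (ℕₚ.+-identityʳ _)) eq ⟩
      (p * suc k) * (p ^ k * k ! * u)                      ≡⟨ shuffle p (suc k) (p ^ k) (k !) u ⟩
      p ^ suc k * (suc k) ! * u                            ∎
  factorial-split k (suc d) d<p with factorial-split k d (ℕₚ.<-trans (ℕₚ.n<1+n d) d<p)
  ... | u , eq , p∤u = (p * k + suc d) * u , lem , ∤-* (λ x → ∤-< (s≤s z≤n) d<p (∣m+n∣m⇒∣n x (m∣m*n k))) p∤u
    where
    open ≡-Reasoning
    shuffle : ∀ s a b c → s * (a * b * c) ≡ a * b * (s * c)
    shuffle = solve-∀
    lem : (p * k + suc d) ! ≡ p ^ k * k ! * ((p * k + suc d) * u)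
    lem = begin
      (p * k + suc d) !                      ≡⟨ cong _! (ℕₚ.+-suc (p * k) d) ⟩
      suc (p * k + d) * (p * k + d) !        ≡⟨ cong₂ _*_ (sym (ℕₚ.+-suc (p * k) d)) eq ⟩
      (p * k + suc d) * (p ^ k * k ! * u)    ≡⟨ shuffle (p * k + suc d) (p ^ k) (k !) u ⟩
      p ^ k * k ! * ((p * k + suc d) * u)    ∎

  private
    C3-factorial : ∀ c → ((3 * c) C c) * (c ! * (2 * c) !) ≡ (3 * c) !
    C3-factorial c = trans (cong (λ z → ((3 * c) C c) * (c ! * z !)) (sym (ℕₚ.m+n∸m≡n c (2 * c)))) (nCk*k![n∸k]!≡n! (ℕₚ.m≤m+n c (2 * c)))

  -- Adding a base-p digit d < p/3 to c creates no carry in c + 2c = 3c.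
  ∤C3-step : ∀ d c → 3 * d < p → ¬ p ∣ (3 * c) C c → ¬ p ∣ (3 * (p * c + d)) C (p * c + d)
  ∤C3-step d c 3d<p p∤C p∣C
    with factorial-split c d (ℕₚ.≤-<-trans (ℕₚ.m≤m+n d (2 * d)) 3d<p)
       | factorial-split (2 * c) (2 * d) (ℕₚ.≤-<-trans (ℕₚ.m≤n+m (2 * d) d) 3d<p)
       | factorial-split (3 * c) (3 * d) 3d<p
  ... | u₁ , eq₁ , _ | u₂ , eq₂ , _ | u₃ , eq₃ , p∤u₃ =
    ∤-* p∤C p∤u₃ (subst (p ∣_) key (∣m⇒∣m*n (u₁ * u₂) p∣C))
    where
    open ≡-Reasoning
    n = p * c + d
    c3 = (3 * c) C c
    n3 = (3 * n) C n
    M = p ^ (3 * c) * (c ! * (2 * c) !)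
    mul : ∀ a p c d → a * (p * c + d) ≡ p * (a * c) + a * d
    mul = solve-∀
    pow3 : p ^ c * p ^ (2 * c) ≡ p ^ (3 * c)
    pow3 = sym (ℕₚ.^-distribˡ-+-* p c (2 * c))
    instance
      M≢0 : NonZero M
      M≢0 = ℕₚ.m*n≢0 _ _ {{ℕₚ.m^n≢0 p (3 * c)}} {{ℕₚ.m*n≢0 (c !) ((2 * c) !) {{c !≢0}} {{(2 * c) !≢0}}}}
    shuffle : ∀ C x y f g u v → C * ((x * f * u) * (y * g * v)) ≡ (C * (u * v)) * ((x * y) * (f * g))
    shuffle = solve-∀
    shuffle′ : ∀ P C m u → P * (C * m) * u ≡ (C * u) * (P * m)
    shuffle′ = solve-∀
    key : n3 * (u₁ * u₂) ≡ c3 * u₃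
    key = ℕₚ.*-cancelʳ-≡ _ _ M (begin
      n3 * (u₁ * u₂) * M
        ≡⟨ cong (λ z → n3 * (u₁ * u₂) * (z * (c ! * (2 * c) !))) pow3 ⟨
      n3 * (u₁ * u₂) * (p ^ c * p ^ (2 * c) * (c ! * (2 * c) !))
        ≡⟨ shuffle n3 (p ^ c) (p ^ (2 * c)) (c !) ((2 * c) !) u₁ u₂ ⟨
      n3 * ((p ^ c * c ! * u₁) * (p ^ (2 * c) * (2 * c) ! * u₂))
        ≡⟨ cong (n3 *_) (cong₂ _*_ (sym eq₁) (trans (sym eq₂) (cong _! (sym (mul 2 p c d))))) ⟩
      n3 * (n ! * (2 * n) !)
        ≡⟨ C3-factorial n ⟩
      (3 * n) !
        ≡⟨ cong _! (mul 3 p c d) ⟩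
      (p * (3 * c) + 3 * d) !
        ≡⟨ eq₃ ⟩
      p ^ (3 * c) * (3 * c) ! * u₃
        ≡⟨ cong (λ z → p ^ (3 * c) * z * u₃) (C3-factorial c) ⟨
      p ^ (3 * c) * (c3 * (c ! * (2 * c) !)) * u₃
        ≡⟨ shuffle′ (p ^ (3 * c)) c3 (c ! * (2 * c) !) u₃ ⟩
      (c3 * u₃) * M ∎)

  -- Every base-p digit of (p^m - 1)/4 equals d = (p - 1)/4, and 3d < p. So the carry-free step
  -- applies to each digit, starting from C(0,0) = 1.
  ∤C3 : ∀ d → p ≡ 4 * d + 1 → ∀ m c → 4 * c + 1 ≡ p ^ m → ¬ p ∣ (3 * c) C c
  ∤C3 d p≡ zero zero _ = ∤-< (s≤s z≤n) prime>1
  ∤C3 d p≡ zero (suc c) eq = ⊥-elim (ℕₚ.m+1+n≢0 _ (ℕₚ.suc-injective eq))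
  ∤C3 d p≡ (suc m) c eq with ^≡1mod4 d p≡ m
  ... | c′ , e = subst (λ z → ¬ p ∣ (3 * z) C z) (sym c≡) (∤C3-step d c′ 3d<p (∤C3 d p≡ m c′ e))
    where
    open ≡-Reasoning
    lem : ∀ p c → p * (4 * c + 1) ≡ 4 * (p * c) + p
    lem = solve-∀
    lem′ : ∀ x d → 4 * x + (4 * d + 1) ≡ 4 * (x + d) + 1
    lem′ = solve-∀
    3d<p : 3 * d < p
    3d<p = subst (3 * d <_) (sym p≡) (subst (_≤ 4 * d + 1) (ℕₚ.+-comm (3 * d) 1) (ℕₚ.+-monoˡ-≤ 1 (ℕₚ.m≤n+m (3 * d) d)))
    c≡ : c ≡ p * c′ + d
    c≡ = ℕₚ.*-cancelˡ-≡ c _ 4 (ℕₚ.+-cancelʳ-≡ 1 (4 * c) _ (begin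
      4 * c + 1                  ≡⟨ eq ⟩
      p * p ^ m                  ≡⟨ cong (p *_) e ⟨
      p * (4 * c′ + 1)           ≡⟨ lem p c′ ⟩
      4 * (p * c′) + p           ≡⟨ cong (4 * (p * c′) +_) p≡ ⟩
      4 * (p * c′) + (4 * d + 1) ≡⟨ lem′ (p * c′) d ⟩
      4 * (p * c′ + d) + 1       ∎))

-- Divisibility in ℤ: squares, prime powers, parity.

m*m∣n*n⇒m∣n : ∀ a b .{{_ : NonZero a}} → a * a ∣ b * b → a ∣ b
m*m∣n*n⇒m∣n a b aa∣bb = subst (_∣ b) (sym a≡g) (gcd[m,n]∣n a b)
  where
  g = gcd a b
  instance
    g≢0 : NonZero g
    g≢0 = ℕ.≢-nonZero (gcd[m,n]≢0 a b (inj₁ (ℕ.≢-nonZero⁻¹ a)))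
    gg≢0 : NonZero (g * g)
    gg≢0 = ℕₚ.m*n≢0 g g
  a′ = a / g
  b′ = b / g
  a≡ : a′ * g ≡ a
  a≡ = m/n*n≡m (gcd[m,n]∣m a b)
  b≡ : b′ * g ≡ b
  b≡ = m/n*n≡m (gcd[m,n]∣n a b)
  shuffle : ∀ x g → (x * g) * (x * g) ≡ (x * x) * (g * g)
  shuffle = solve-∀
  a′a′∣b′b′ : a′ * a′ ∣ b′ * b′
  a′a′∣b′b′ = *-cancelʳ-∣ (g * g) (subst₂ _∣_ (trans (sym (cong₂ _*_ a≡ a≡)) (shuffle a′ g)) (trans (sym (cong₂ _*_ b≡ b≡)) (shuffle b′ g)) aa∣bb)
  -- The cofactors of the gcd are coprime, so a′ ∣ b′ leaves only a′ = 1.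
  a′∣b′ : a′ ∣ b′
  a′∣b′ = coprime-divisor (coprime-/gcd a b) (∣-trans (m∣m*n a′) a′a′∣b′b′)
  a≡g : a ≡ g
  a≡g = trans (sym a≡) (trans (cong (_* g) (coprime-/gcd a b (∣-refl , a′∣b′))) (ℕₚ.*-identityˡ g))

square-∣ᶻ : ∀ a b .{{_ : ℤ.NonZero a}} → a *ᶻ a ∣ᶻ b *ᶻ b → a ∣ᶻ b
square-∣ᶻ a b d = ∣ᵤ⇒∣ (m*m∣n*n⇒m∣n ℤ.∣ a ∣ ℤ.∣ b ∣ (subst₂ _∣_ (ℤₚ.abs-* a a) (ℤₚ.abs-* b b) (∣⇒∣ᵤ d)))

prime-∣ᶻ : ∀ {p} → Prime p → ∀ a b → pos p ∣ᶻ a *ᶻ b → pos p ∣ᶻ a ⊎ pos p ∣ᶻ b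
prime-∣ᶻ {p} pr a b d with euclidsLemma ℤ.∣ a ∣ ℤ.∣ b ∣ pr (subst (p ∣_) (ℤₚ.abs-* a b) (∣⇒∣ᵤ d))
... | inj₁ x = inj₁ (∣ᵤ⇒∣ x)
... | inj₂ x = inj₂ (∣ᵤ⇒∣ x)

prime-∣ᶻ-square : ∀ {p} → Prime p → ∀ a → pos p ∣ᶻ a *ᶻ a → pos p ∣ᶻ a
prime-∣ᶻ-square pr a d = reduce (prime-∣ᶻ pr a a d)

prime-power-∣ᶻ : ∀ {p} → Prime p → ∀ n x y → pos (p ^ n) ∣ᶻ x *ᶻ y → ¬ pos p ∣ᶻ x → pos (p ^ n) ∣ᶻ y
prime-power-∣ᶻ pr zero x y _ _ = dividesᶻ y (sym (ℤₚ.*-identityʳ y))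
prime-power-∣ᶻ {p} pr (suc n) x y (dividesᶻ k e) p∤x
  with prime-∣ᶻ pr x y (dividesᶻ (k *ᶻ pos (p ^ n)) (trans e (trans (cong (k *ᶻ_) (ℤₚ.pos-* p (p ^ n))) (lem k (pos p) (pos (p ^ n))))))
  where
  lem : ∀ k p P → k *ᶻ (p *ᶻ P) ≡ k *ᶻ P *ᶻ p
  lem = solveℤ
... | inj₁ p∣x = ⊥-elim (p∤x p∣x)
... | inj₂ (dividesᶻ y′ refl) with prime-power-∣ᶻ pr n x y′ (dividesᶻ k (ℤₚ.*-cancelʳ-≡ _ _ (pos p) {{p≢0}} (begin
      x *ᶻ y′ *ᶻ pos p         ≡⟨ lem x y′ (pos p) ⟩
      x *ᶻ (y′ *ᶻ pos p)       ≡⟨ e ⟩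
      k *ᶻ pos (p * p ^ n)     ≡⟨ cong (k *ᶻ_) (ℤₚ.pos-* p (p ^ n)) ⟩
      k *ᶻ (pos p *ᶻ pos (p ^ n)) ≡⟨ lem′ k (pos p) (pos (p ^ n)) ⟩
      k *ᶻ pos (p ^ n) *ᶻ pos p ∎))) p∤x
  where
  open ≡-Reasoning
  p≢0 = prime⇒nonZero pr
  lem : ∀ x y p → x *ᶻ y *ᶻ p ≡ x *ᶻ (y *ᶻ p)
  lem = solveℤ
  lem′ : ∀ k p P → k *ᶻ (p *ᶻ P) ≡ k *ᶻ P *ᶻ p
  lem′ = solveℤ
... | dividesᶻ z refl = dividesᶻ z (trans (lem z (pos (p ^ n)) (pos p)) (cong (z *ᶻ_) (sym (ℤₚ.pos-* p (p ^ n)))))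
  where
  lem : ∀ z P p → z *ᶻ P *ᶻ p ≡ z *ᶻ (p *ᶻ P)
  lem = solveℤ

parity : ∀ k → (∃ λ l → k ≡ pos 2 *ᶻ l) ⊎ (∃ λ l → k ≡ pos 2 *ᶻ l +ᶻ 1ℤ)
parity k with k ℤ.%ℕ 2 | k ℤ./ℕ 2 | a≡a%ℕn+[a/ℕn]*n k 2 | n%ℕd<d k 2
... | 0 | l | e | _ = inj₁ (l , trans e (lem l))
  where
  lem : ∀ l → 0ℤ +ᶻ l *ᶻ pos 2 ≡ pos 2 *ᶻ l
  lem = solveℤ
... | 1 | l | e | _ = inj₂ (l , trans e (lem l))
  where
  lem : ∀ l → 1ℤ +ᶻ l *ᶻ pos 2 ≡ pos 2 *ᶻ l +ᶻ 1ℤ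
  lem = solveℤ
... | suc (suc _) | _ | _ | s≤s (s≤s ())

odd≢even : ∀ {x y} → pos 2 *ᶻ x +ᶻ 1ℤ ≢ pos 2 *ᶻ y
odd≢even {x} {y} e = 2≢1 (ℕₚ.m*n≡1⇒m≡1 2 ℤ.∣ y -ᶻ x ∣ (sym (trans (cong ℤ.∣_∣ (trans (lem₁ x) (trans (cong (_-ᶻ pos 2 *ᶻ x) e) (lem₂ x y)))) (ℤₚ.abs-* (pos 2) (y -ᶻ x)))))
  where
  2≢1 : 2 ≢ 1
  2≢1 ()
  lem₁ : ∀ x → 1ℤ ≡ (pos 2 *ᶻ x +ᶻ 1ℤ) -ᶻ pos 2 *ᶻ x
  lem₁ = solveℤ
  lem₂ : ∀ x y → pos 2 *ᶻ y -ᶻ pos 2 *ᶻ x ≡ pos 2 *ᶻ (y -ᶻ x)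
  lem₂ = solveℤ

square-roots : ∀ a b → a *ᶻ a ≡ b *ᶻ b → a ≡ b ⊎ a ≡ ⁻ b
square-roots a b e with ℤₚ.i*j≡0⇒i≡0∨j≡0 (a -ᶻ b) {a +ᶻ b} (trans (lem a b) (trans (cong (_-ᶻ b *ᶻ b) e) (ℤₚ.+-inverseʳ (b *ᶻ b))))
  where
  lem : ∀ a b → (a -ᶻ b) *ᶻ (a +ᶻ b) ≡ a *ᶻ a -ᶻ b *ᶻ b
  lem = solveℤ
... | inj₁ z = inj₁ (trans (lem a b) (trans (cong (_+ᶻ b) z) (ℤₚ.+-identityˡ b)))
  where
  lem : ∀ a b → a ≡ (a -ᶻ b) +ᶻ b
  lem = solveℤ
... | inj₂ z = inj₂ (trans (lem a b) (trans (cong (_-ᶻ b) z) (ℤₚ.+-identityˡ (⁻ b))))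
  where
  lem : ∀ a b → a ≡ (a +ᶻ b) -ᶻ b
  lem = solveℤ

cancel-2 : ∀ {a b} → pos 2 *ᶻ a ≡ pos 2 *ᶻ b → a ≡ b
cancel-2 {a} {b} = ℤₚ.*-cancelˡ-≡ (pos 2) a b

-- Integer square roots behind the quartic Gauss sum, and uniqueness of s = a² + 4b².

private
  -- Half-angle formula cleared of denominators: X² is half of (X² + Y²) + (X² - Y²). As G² divides
  -- (2Z)², G divides 2Z; the cofactor u satisfies u² = 2(T² - J), so it is even and the factor 2
  -- cancels.
  half-root : ∀ (T G Z J : ℤ) .{{_ : ℤ.NonZero G}} →
    (pos 2 *ᶻ Z) *ᶻ (pos 2 *ᶻ Z) ≡ (pos 2 *ᶻ (T *ᶻ T -ᶻ J)) *ᶻ (G *ᶻ G) →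
    ∃ λ z → Z ≡ z *ᶻ G × pos 2 *ᶻ (z *ᶻ z) ≡ T *ᶻ T -ᶻ J
  half-root T G Z J e = from-G (square-∣ᶻ G (pos 2 *ᶻ Z) (dividesᶻ (pos 2 *ᶻ (T *ᶻ T -ᶻ J)) e))
    where
    lem : ∀ u g → u *ᶻ u *ᶻ (g *ᶻ g) ≡ (u *ᶻ g) *ᶻ (u *ᶻ g)
    lem = solveℤ
    lem′ : ∀ z g → pos 2 *ᶻ (pos 2 *ᶻ (z *ᶻ z)) *ᶻ (g *ᶻ g) ≡ (z *ᶻ pos 2 *ᶻ g) *ᶻ (z *ᶻ pos 2 *ᶻ g)
    lem′ = solveℤ
    shuffle : ∀ z g → z *ᶻ pos 2 *ᶻ g ≡ pos 2 *ᶻ (z *ᶻ g)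
    shuffle = solveℤ
    uu≡ : ∀ u → pos 2 *ᶻ Z ≡ u *ᶻ G → u *ᶻ u ≡ (T *ᶻ T -ᶻ J) *ᶻ pos 2
    uu≡ u eu = ℤₚ.*-cancelʳ-≡ (u *ᶻ u) ((T *ᶻ T -ᶻ J) *ᶻ pos 2) (G *ᶻ G) {{ℤₚ.i*j≢0 G G}}
      (trans (lem u G) (trans (cong₂ _*ᶻ_ (sym eu) (sym eu)) (trans e (cong (_*ᶻ (G *ᶻ G)) (ℤₚ.*-comm (pos 2) (T *ᶻ T -ᶻ J))))))
    from-2 : ∀ u → pos 2 *ᶻ Z ≡ u *ᶻ G → pos 2 ∣ᶻ u → ∃ λ z → Z ≡ z *ᶻ G × pos 2 *ᶻ (z *ᶻ z) ≡ T *ᶻ T -ᶻ J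
    from-2 _ eu (dividesᶻ z refl) = z , cancel-2 (trans eu (shuffle z G)) ,
      cancel-2 (ℤₚ.*-cancelʳ-≡ (pos 2 *ᶻ (pos 2 *ᶻ (z *ᶻ z))) (pos 2 *ᶻ (T *ᶻ T -ᶻ J)) (G *ᶻ G) {{ℤₚ.i*j≢0 G G}}
        (trans (lem′ z G) (trans (cong₂ _*ᶻ_ (sym eu) (sym eu)) e)))
    from-G : G ∣ᶻ pos 2 *ᶻ Z → ∃ λ z → Z ≡ z *ᶻ G × pos 2 *ᶻ (z *ᶻ z) ≡ T *ᶻ T -ᶻ J
    from-G (dividesᶻ u eu) = from-2 u eu (prime-∣ᶻ-square prime[2] u (dividesᶻ (T *ᶻ T -ᶻ J) (uu≡ u eu)))

-- X, Y are the real and imaginary parts of the quartic Gauss sum and JR, JI those of the Jacobi sum.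
gauss-extract : ∀ {p} → Prime p → (T P X Y JR JI : ℤ) .{{_ : ℤ.NonZero T}} .{{_ : ℤ.NonZero P}} → pos p ∣ᶻ T →
  X *ᶻ X +ᶻ Y *ᶻ Y ≡ (T *ᶻ T) *ᶻ (T *ᶻ T) *ᶻ (P *ᶻ P) →
  X *ᶻ X -ᶻ Y *ᶻ Y ≡ ⁻ ((T *ᶻ T) *ᶻ (P *ᶻ P) *ᶻ JR) →
  pos 2 *ᶻ (X *ᶻ Y) ≡ ⁻ ((T *ᶻ T) *ᶻ (P *ᶻ P) *ᶻ JI) →
  ¬ ((p ∣ ℤ.∣ JR ∣) × (p ∣ ℤ.∣ JI ∣)) →
  ∃₂ λ a b → X ≡ a *ᶻ (P *ᶻ T) × Y ≡ b *ᶻ (P *ᶻ T) × a *ᶻ a +ᶻ b *ᶻ b ≡ T *ᶻ T × ¬ pos p ∣ᶻ a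
gauss-extract {p} pr T P X Y JR JI p∣T norm real imag nondiv =
  combine (half-root T G X JR (trans (split-X X Y) (trans (cong₂ (λ m n → pos 2 *ᶻ (m +ᶻ n)) norm real) (factor-X T P JR))))
          (half-root T G Y (⁻ JR) (trans (split-Y X Y) (trans (cong₂ (λ m n → pos 2 *ᶻ (m -ᶻ n)) norm real) (factor-Y T P JR))))
  where
  open ≡-Reasoning
  G = P *ᶻ T
  instance
    G≢0 : ℤ.NonZero G
    G≢0 = ℤₚ.i*j≢0 P T
    GG≢0 : ℤ.NonZero (G *ᶻ G)
    GG≢0 = ℤₚ.i*j≢0 G G
  split-X : ∀ X Y → (pos 2 *ᶻ X) *ᶻ (pos 2 *ᶻ X) ≡ pos 2 *ᶻ ((X *ᶻ X +ᶻ Y *ᶻ Y) +ᶻ (X *ᶻ X -ᶻ Y *ᶻ Y))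
  split-X = solveℤ
  factor-X : ∀ T P J → pos 2 *ᶻ ((T *ᶻ T) *ᶻ (T *ᶻ T) *ᶻ (P *ᶻ P) +ᶻ ⁻ ((T *ᶻ T) *ᶻ (P *ᶻ P) *ᶻ J)) ≡ (pos 2 *ᶻ (T *ᶻ T -ᶻ J)) *ᶻ ((P *ᶻ T) *ᶻ (P *ᶻ T))
  factor-X = solveℤ
  split-Y : ∀ X Y → (pos 2 *ᶻ Y) *ᶻ (pos 2 *ᶻ Y) ≡ pos 2 *ᶻ ((X *ᶻ X +ᶻ Y *ᶻ Y) -ᶻ (X *ᶻ X -ᶻ Y *ᶻ Y))
  split-Y = solveℤ
  factor-Y : ∀ T P J → pos 2 *ᶻ ((T *ᶻ T) *ᶻ (T *ᶻ T) *ᶻ (P *ᶻ P) -ᶻ ⁻ ((T *ᶻ T) *ᶻ (P *ᶻ P) *ᶻ J)) ≡ (pos 2 *ᶻ (T *ᶻ T -ᶻ ⁻ J)) *ᶻ ((P *ᶻ T) *ᶻ (P *ᶻ T))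
  factor-Y = solveℤ

  combine : (∃ λ a → X ≡ a *ᶻ G × pos 2 *ᶻ (a *ᶻ a) ≡ T *ᶻ T -ᶻ JR) → (∃ λ b → Y ≡ b *ᶻ G × pos 2 *ᶻ (b *ᶻ b) ≡ T *ᶻ T -ᶻ ⁻ JR) →
    ∃₂ λ a b → X ≡ a *ᶻ G × Y ≡ b *ᶻ G × a *ᶻ a +ᶻ b *ᶻ b ≡ T *ᶻ T × ¬ pos p ∣ᶻ a
  combine (a , X≡ , 2aa) (b , Y≡ , 2bb) = a , b , X≡ , Y≡ , aa+bb , p∤a
    where
    aa+bb : a *ᶻ a +ᶻ b *ᶻ b ≡ T *ᶻ T
    aa+bb = cancel-2 (trans (l₁ a b) (trans (cong₂ _+ᶻ_ 2aa 2bb) (l₂ (T *ᶻ T) JR)))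
      where
      l₁ : ∀ a b → pos 2 *ᶻ (a *ᶻ a +ᶻ b *ᶻ b) ≡ pos 2 *ᶻ (a *ᶻ a) +ᶻ pos 2 *ᶻ (b *ᶻ b)
      l₁ = solveℤ
      l₂ : ∀ S J → (S -ᶻ J) +ᶻ (S -ᶻ ⁻ J) ≡ pos 2 *ᶻ S
      l₂ = solveℤ

    JR≡ : b *ᶻ b -ᶻ a *ᶻ a ≡ JR
    JR≡ = cancel-2 (trans (l₁ a b) (trans (cong₂ _-ᶻ_ 2bb 2aa) (l₂ (T *ᶻ T) JR)))
      where
      l₁ : ∀ a b → pos 2 *ᶻ (b *ᶻ b -ᶻ a *ᶻ a) ≡ pos 2 *ᶻ (b *ᶻ b) -ᶻ pos 2 *ᶻ (a *ᶻ a)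
      l₁ = solveℤ
      l₂ : ∀ S J → (S -ᶻ ⁻ J) -ᶻ (S -ᶻ J) ≡ pos 2 *ᶻ J
      l₂ = solveℤ

    JI≡ : ⁻ (pos 2 *ᶻ (a *ᶻ b)) ≡ JI
    JI≡ = ℤₚ.*-cancelʳ-≡ (⁻ (pos 2 *ᶻ (a *ᶻ b))) JI (G *ᶻ G) (begin
      ⁻ (pos 2 *ᶻ (a *ᶻ b)) *ᶻ (G *ᶻ G)        ≡⟨ l₁ a b G ⟩
      ⁻ (pos 2 *ᶻ ((a *ᶻ G) *ᶻ (b *ᶻ G)))      ≡⟨ cong₂ (λ x y → ⁻ (pos 2 *ᶻ (x *ᶻ y))) X≡ Y≡ ⟨
      ⁻ (pos 2 *ᶻ (X *ᶻ Y))                    ≡⟨ cong ⁻_ imag ⟩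
      ⁻ (⁻ ((T *ᶻ T) *ᶻ (P *ᶻ P) *ᶻ JI))       ≡⟨ l₂ T P JI ⟩
      JI *ᶻ (G *ᶻ G)                           ∎)
      where
      l₁ : ∀ a b g → ⁻ (pos 2 *ᶻ (a *ᶻ b)) *ᶻ (g *ᶻ g) ≡ ⁻ (pos 2 *ᶻ ((a *ᶻ g) *ᶻ (b *ᶻ g)))
      l₁ = solveℤ
      l₂ : ∀ T P J → ⁻ (⁻ ((T *ᶻ T) *ᶻ (P *ᶻ P) *ᶻ J)) ≡ J *ᶻ ((P *ᶻ T) *ᶻ (P *ᶻ T))
      l₂ = solveℤ

    -- The two preceding identities say that the Jacobi sum is -(a + b i)². If p divides a, it
    -- divides b through a² + b² = T², and then both parts of the Jacobi sum.
    p∤a : ¬ pos p ∣ᶻ a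
    p∤a p∣a = nondiv (∣⇒∣ᵤ (subst (pos p ∣ᶻ_) JR≡ (ℤ∣.∣m∣n⇒∣m-n (ℤ∣.∣n⇒∣m*n b p∣b) (ℤ∣.∣n⇒∣m*n a p∣a))) ,
                      ∣⇒∣ᵤ (subst (pos p ∣ᶻ_) JI≡ (ℤ∣.∣m⇒∣-m (ℤ∣.∣n⇒∣m*n (pos 2) (ℤ∣.∣m⇒∣m*n b p∣a)))))
      where
      p∣b : pos p ∣ᶻ b
      p∣b = prime-∣ᶻ-square pr b (ℤ∣.∣m+n∣m⇒∣n (subst (pos p ∣ᶻ_) (sym aa+bb) (ℤ∣.∣n⇒∣m*n T p∣T)) (ℤ∣.∣n⇒∣m*n a p∣a))

-- If s divides f = a B′ − a′ B then (a a′ + B B′)² + f² = s² forces f = 0 or a a′ = − B B′; parity excludes the latter.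
representation-unique : ∀ {p} → Prime p → ¬ p ∣ 2 → ∀ n → 0 < n → ∀ a b a′ b′ →
  a *ᶻ a +ᶻ (pos 2 *ᶻ b) *ᶻ (pos 2 *ᶻ b) ≡ pos (p ^ n) → a′ *ᶻ a′ +ᶻ (pos 2 *ᶻ b′) *ᶻ (pos 2 *ᶻ b′) ≡ pos (p ^ n) →
  ¬ pos p ∣ᶻ a → ¬ pos p ∣ᶻ a′ → (∃ λ k → a ≡ pos 2 *ᶻ k +ᶻ 1ℤ) → (∃ λ k → a′ ≡ pos 2 *ᶻ k +ᶻ 1ℤ) → a *ᶻ a ≡ a′ *ᶻ a′
representation-unique {p} pr p∤2 n 0<n a b a′ b′ e e′ p∤a p∤a′ (k , ak) (k′ , ak′) = conclude p∤-one
  where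
  open ≡-Reasoning
  s = pos (p ^ n)
  instance
    p≢0 = prime⇒nonZero pr
    s≢0 : ℤ.NonZero s
    s≢0 = ℕₚ.m^n≢0 p n
  B = pos 2 *ᶻ b
  B′ = pos 2 *ᶻ b′

  p∣s : pos p ∣ᶻ s
  p∣s = ∣ᵤ⇒∣ (subst (λ z → p ∣ p ^ z) (ℕₚ.suc-pred n {{>-nonZero 0<n}}) (m∣m*n (p ^ ℕ.pred n)))

  p∤B′ : ¬ pos p ∣ᶻ B′
  p∤B′ d = p∤a′ (prime-∣ᶻ-square pr a′ (ℤ∣.∣m+n∣m⇒∣n (subst (pos p ∣ᶻ_) (trans (sym e′) (ℤₚ.+-comm (a′ *ᶻ a′) (B′ *ᶻ B′))) p∣s) (ℤ∣.∣n⇒∣m*n B′ d)))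

  f : ℤ → ℤ
  f D = a *ᶻ B′ -ᶻ a′ *ᶻ D

  -- f(B) + f(-B) = 2aB′ is prime to p, so p misses one of the two factors. Their product is
  -- divisible by s = p^n, so all of s divides the other one.
  p∤-one : ¬ pos p ∣ᶻ f B ⊎ ¬ pos p ∣ᶻ f (⁻ B)
  p∤-one with pos p ∣?ᶻ f B
  ... | no p∤ = inj₁ p∤
  ... | yes p∣ = inj₂ λ p∣′ → absurd (subst (pos p ∣ᶻ_) (lem a B′ a′ B) (ℤ∣.∣m∣n⇒∣m+n p∣ p∣′))
    where
    lem : ∀ a B′ a′ B → (a *ᶻ B′ -ᶻ a′ *ᶻ B) +ᶻ (a *ᶻ B′ -ᶻ a′ *ᶻ ⁻ B) ≡ pos 2 *ᶻ (a *ᶻ B′)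
    lem = solveℤ
    absurd : ¬ pos p ∣ᶻ pos 2 *ᶻ (a *ᶻ B′)
    absurd d with prime-∣ᶻ pr (pos 2) (a *ᶻ B′) d
    ... | inj₁ x = p∤2 (∣⇒∣ᵤ x)
    ... | inj₂ y with prime-∣ᶻ pr a B′ y
    ...   | inj₁ z = p∤a z
    ...   | inj₂ z = p∤B′ z

  product : f B *ᶻ f (⁻ B) ≡ (a *ᶻ a -ᶻ a′ *ᶻ a′) *ᶻ s
  product = begin
    f B *ᶻ f (⁻ B)                                           ≡⟨ lem a B a′ B′ ⟩
    a *ᶻ a *ᶻ ((a′ *ᶻ a′ +ᶻ B′ *ᶻ B′)) -ᶻ a′ *ᶻ a′ *ᶻ (a *ᶻ a +ᶻ B *ᶻ B) ≡⟨ cong₂ (λ x y → a *ᶻ a *ᶻ x -ᶻ a′ *ᶻ a′ *ᶻ y) e′ e ⟩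
    a *ᶻ a *ᶻ s -ᶻ a′ *ᶻ a′ *ᶻ s                             ≡⟨ lem′ a a′ s ⟩
    (a *ᶻ a -ᶻ a′ *ᶻ a′) *ᶻ s                                ∎
    where
    lem : ∀ a B a′ B′ → (a *ᶻ B′ -ᶻ a′ *ᶻ B) *ᶻ (a *ᶻ B′ -ᶻ a′ *ᶻ ⁻ B) ≡ a *ᶻ a *ᶻ ((a′ *ᶻ a′ +ᶻ B′ *ᶻ B′)) -ᶻ a′ *ᶻ a′ *ᶻ (a *ᶻ a +ᶻ B *ᶻ B)
    lem = solveℤ
    lem′ : ∀ a a′ s → a *ᶻ a *ᶻ s -ᶻ a′ *ᶻ a′ *ᶻ s ≡ (a *ᶻ a -ᶻ a′ *ᶻ a′) *ᶻ s
    lem′ = solveℤ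

  zero-factor : f B *ᶻ f (⁻ B) ≡ 0ℤ → a *ᶻ a ≡ a′ *ᶻ a′
  zero-factor z = ℤₚ.i-j≡0⇒i≡j _ _ (ℤₚ.*-cancelʳ-≡ _ 0ℤ s (trans (sym product) z))

  w≢0 : ∀ c → a *ᶻ a′ +ᶻ (pos 2 *ᶻ c) *ᶻ (pos 2 *ᶻ b′) ≢ 0ℤ
  w≢0 c z = odd≢even {pos 2 *ᶻ (k *ᶻ k′) +ᶻ k +ᶻ k′ +ᶻ pos 2 *ᶻ (c *ᶻ b′)} {0ℤ} (trans (lem k k′ c b′) (trans (cong₂ (λ x y → x *ᶻ y +ᶻ (pos 2 *ᶻ c) *ᶻ (pos 2 *ᶻ b′)) (sym ak) (sym ak′)) z))
    where
    lem : ∀ k k′ c b → pos 2 *ᶻ (pos 2 *ᶻ (k *ᶻ k′) +ᶻ k +ᶻ k′ +ᶻ pos 2 *ᶻ (c *ᶻ b)) +ᶻ 1ℤ ≡ (pos 2 *ᶻ k +ᶻ 1ℤ) *ᶻ (pos 2 *ᶻ k′ +ᶻ 1ℤ) +ᶻ (pos 2 *ᶻ c) *ᶻ (pos 2 *ᶻ b)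
    lem = solveℤ

  f≡0 : ∀ c → a *ᶻ a +ᶻ (pos 2 *ᶻ c) *ᶻ (pos 2 *ᶻ c) ≡ s → s ∣ᶻ f (pos 2 *ᶻ c) → f (pos 2 *ᶻ c) ≡ 0ℤ
  f≡0 c ec (dividesᶻ l el) = trans el (trans (cong (_*ᶻ s) (l≡0 ℤ.∣ l ∣ refl)) (ℤₚ.*-zeroˡ s))
    where
    D = pos 2 *ᶻ c
    w = a *ᶻ a′ +ᶻ D *ᶻ B′
    N = p ^ n
    identity : w *ᶻ w +ᶻ (l *ᶻ s) *ᶻ (l *ᶻ s) ≡ s *ᶻ s
    identity = begin
      w *ᶻ w +ᶻ (l *ᶻ s) *ᶻ (l *ᶻ s)                           ≡⟨ cong (λ x → w *ᶻ w +ᶻ x *ᶻ x) el ⟨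
      w *ᶻ w +ᶻ f D *ᶻ f D                                     ≡⟨ lem a a′ D B′ ⟩
      (a *ᶻ a +ᶻ D *ᶻ D) *ᶻ (a′ *ᶻ a′ +ᶻ B′ *ᶻ B′)             ≡⟨ cong₂ _*ᶻ_ ec e′ ⟩
      s *ᶻ s                                                   ∎
      where
      lem : ∀ a a′ D B′ → (a *ᶻ a′ +ᶻ D *ᶻ B′) *ᶻ (a *ᶻ a′ +ᶻ D *ᶻ B′) +ᶻ (a *ᶻ B′ -ᶻ a′ *ᶻ D) *ᶻ (a *ᶻ B′ -ᶻ a′ *ᶻ D) ≡ (a *ᶻ a +ᶻ D *ᶻ D) *ᶻ (a′ *ᶻ a′ +ᶻ B′ *ᶻ B′)
      lem = solveℤ
    sq : ∀ x → x *ᶻ x ≡ pos (ℤ.∣ x ∣ * ℤ.∣ x ∣)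
    sq (ℤ.+ x)      = sym (ℤₚ.pos-* x x)
    sq (ℤ.-[1+ x ]) = refl
    identityℕ : ℤ.∣ w ∣ * ℤ.∣ w ∣ + ℤ.∣ l *ᶻ s ∣ * ℤ.∣ l *ᶻ s ∣ ≡ N * N
    identityℕ = ℤₚ.+-injective (trans (cong₂ _+ᶻ_ (sym (sq w)) (sym (sq (l *ᶻ s)))) (trans identity (sym (ℤₚ.pos-* N N))))
    l≡0 : ∀ k → ℤ.∣ l ∣ ≡ k → l ≡ 0ℤ
    l≡0 zero     eq = ℤₚ.∣i∣≡0⇒i≡0 eq
    l≡0 (suc l₁) eq = ⊥-elim (w≢0 c (ℤₚ.∣i∣≡0⇒i≡0 (reduce (ℕₚ.m*n≡0⇒m≡0∨n≡0 ℤ.∣ w ∣ ww≡0))))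
      where
      big : N ≤ ℤ.∣ l *ᶻ s ∣
      big = subst (N ≤_) (sym (trans (ℤₚ.abs-* l s) (cong (_* N) eq))) (ℕₚ.m≤m+n N (l₁ * N))
      ww≡0 : ℤ.∣ w ∣ * ℤ.∣ w ∣ ≡ 0
      ww≡0 = ℕₚ.n≤0⇒n≡0 (ℕₚ.+-cancelʳ-≤ (N * N) _ 0 (ℕₚ.≤-trans (ℕₚ.+-monoʳ-≤ _ (ℕₚ.*-mono-≤ big big)) (ℕₚ.≤-reflexive identityℕ)))

  conclude : ¬ pos p ∣ᶻ f B ⊎ ¬ pos p ∣ᶻ f (⁻ B) → a *ᶻ a ≡ a′ *ᶻ a′
  conclude (inj₁ p∤) = zero-factor (trans (cong (f B *ᶻ_) f⁻≡0) (ℤₚ.*-zeroʳ (f B)))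
    where
    ⁻B : pos 2 *ᶻ ⁻ b ≡ ⁻ B
    ⁻B = lem b
      where
      lem : ∀ b → pos 2 *ᶻ ⁻ b ≡ ⁻ (pos 2 *ᶻ b)
      lem = solveℤ
    f⁻≡0 : f (⁻ B) ≡ 0ℤ
    f⁻≡0 = subst (λ D → f D ≡ 0ℤ) ⁻B (f≡0 (⁻ b) (trans (lem a b) e)
      (subst (λ D → s ∣ᶻ f D) (sym ⁻B) (prime-power-∣ᶻ pr n (f B) (f (⁻ B)) (dividesᶻ (a *ᶻ a -ᶻ a′ *ᶻ a′) product) p∤)))
      where
      lem : ∀ a b → a *ᶻ a +ᶻ (pos 2 *ᶻ ⁻ b) *ᶻ (pos 2 *ᶻ ⁻ b) ≡ a *ᶻ a +ᶻ (pos 2 *ᶻ b) *ᶻ (pos 2 *ᶻ b)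
      lem = solveℤ
  conclude (inj₂ p∤) = zero-factor (trans (cong (_*ᶻ f (⁻ B)) (f≡0 b e
      (prime-power-∣ᶻ pr n (f (⁻ B)) (f B) (dividesᶻ (a *ᶻ a -ᶻ a′ *ᶻ a′) (trans (ℤₚ.*-comm (f (⁻ B)) (f B)) product)) p∤))) (ℤₚ.*-zeroˡ (f (⁻ B))))

-- Arithmetic of a finite field.

module FieldBasics (F : FiniteField) where

  open FiniteField F public renaming (_+_ to _⊕_; _*_ to _⊗_; -_ to ⊖_; 0≢1 to 0#≢1#)

  commutativeRing : CommutativeRing 0ℓ 0ℓ
  commutativeRing = record { isCommutativeRing = isCommutativeRing }

  open CommutativeRing commutativeRing public using (+-assoc; +-comm; +-identityˡ; +-identityʳ; *-assoc; *-comm; *-identityˡ; *-identityʳ; distribˡ; distribʳ; zeroˡ; zeroʳ; -‿inverseˡ; -‿inverseʳ; isCommutativeSemiring; commutativeSemiring; ring)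
  open Algebra.Properties.Ring ring public using (-‿distribˡ-*; -‿distribʳ-*; -‿involutive; -0#≈0#; -‿+-comm; +-cancelˡ; +-cancelʳ) renaming (x∙y⁻¹≈ε⇒x≈y to x-y≡0⇒x≡y; -‿injective to ⊖-injective)

  module S = Sum isCommutativeSemiring
  open S public using (nat; nat-+; nat-*) renaming (∑ to ∑ᶠ)

  1≢0 : 1# ≢ 0#
  1≢0 e = 0#≢1# (sym e)

  zero-product : ∀ {x y} → x ⊗ y ≡ 0# → x ≡ 0# ⊎ y ≡ 0#
  zero-product {x} {y} xy with x ≟ 0#
  ... | yes e = inj₁ e
  ... | no x≢0 = inj₂ (begin
      y                 ≡⟨ *-identityˡ y ⟨
      1# ⊗ y            ≡⟨ cong (_⊗ y) (trans (*-comm x⁻¹ x) x⊗x⁻¹) ⟨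
      x⁻¹ ⊗ x ⊗ y       ≡⟨ *-assoc x⁻¹ x y ⟩
      x⁻¹ ⊗ (x ⊗ y)     ≡⟨ cong (x⁻¹ ⊗_) xy ⟩
      x⁻¹ ⊗ 0#          ≡⟨ zeroʳ x⁻¹ ⟩
      0#                ∎)
    where
    open ≡-Reasoning
    x⁻¹ = proj₁ (inverse x x≢0)
    x⊗x⁻¹ = proj₂ (inverse x x≢0)

  ⊗≢0 : ∀ {x y} → x ≢ 0# → y ≢ 0# → x ⊗ y ≢ 0#
  ⊗≢0 a b e with zero-product e
  ... | inj₁ z = a z
  ... | inj₂ z = b z

  ⊗-cancelˡ : ∀ {x y z} → x ≢ 0# → x ⊗ y ≡ x ⊗ z → y ≡ z
  ⊗-cancelˡ {x} {y} {z} x≢0 e with zero-product {x} {y ⊕ ⊖ z} (begin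
      x ⊗ (y ⊕ ⊖ z)          ≡⟨ distribˡ x y (⊖ z) ⟩
      x ⊗ y ⊕ x ⊗ ⊖ z        ≡⟨ cong₂ _⊕_ e (sym (-‿distribʳ-* x z)) ⟩
      x ⊗ z ⊕ ⊖ (x ⊗ z)      ≡⟨ -‿inverseʳ _ ⟩
      0#                     ∎)
    where open ≡-Reasoning
  ... | inj₁ x≡0 = ⊥-elim (x≢0 x≡0)
  ... | inj₂ d = x-y≡0⇒x≡y y z d

  ⊗-interchange : ∀ a b c d → (a ⊗ b) ⊗ (c ⊗ d) ≡ (a ⊗ c) ⊗ (b ⊗ d)
  ⊗-interchange a b c d = begin
    (a ⊗ b) ⊗ (c ⊗ d)  ≡⟨ *-assoc a b _ ⟩
    a ⊗ (b ⊗ (c ⊗ d))  ≡⟨ cong (a ⊗_) (*-assoc b c d) ⟨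
    a ⊗ ((b ⊗ c) ⊗ d)  ≡⟨ cong (λ z → a ⊗ (z ⊗ d)) (*-comm b c) ⟩
    a ⊗ ((c ⊗ b) ⊗ d)  ≡⟨ cong (a ⊗_) (*-assoc c b d) ⟩
    a ⊗ (c ⊗ (b ⊗ d))  ≡⟨ *-assoc a c _ ⟨
    (a ⊗ c) ⊗ (b ⊗ d)  ∎
    where open ≡-Reasoning

  pow-1 : ∀ x → pow x 1 ≡ x
  pow-1 = *-identityʳ

  pow-+ : ∀ x m n → pow x (m + n) ≡ pow x m ⊗ pow x n
  pow-+ x zero    n = sym (*-identityˡ _)
  pow-+ x (suc m) n = trans (cong (x ⊗_) (pow-+ x m n)) (sym (*-assoc x _ _))

  pow-⊗ : ∀ x y n → pow (x ⊗ y) n ≡ pow x n ⊗ pow y n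
  pow-⊗ x y zero    = sym (*-identityˡ 1#)
  pow-⊗ x y (suc n) = trans (cong (x ⊗ y ⊗_) (pow-⊗ x y n)) (⊗-interchange x y _ _)

  pow-1# : ∀ n → pow 1# n ≡ 1#
  pow-1# zero    = refl
  pow-1# (suc n) = trans (*-identityˡ _) (pow-1# n)

  pow-* : ∀ x m n → pow x (m * n) ≡ pow (pow x m) n
  pow-* x zero    n = sym (pow-1# n)
  pow-* x (suc m) n = begin
    pow x (n + m * n)          ≡⟨ pow-+ x n (m * n) ⟩
    pow x n ⊗ pow x (m * n)    ≡⟨ cong (pow x n ⊗_) (pow-* x m n) ⟩
    pow x n ⊗ pow (pow x m) n  ≡⟨ pow-⊗ x (pow x m) n ⟨
    pow (x ⊗ pow x m) n        ∎
    where open ≡-Reasoning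

  pow-comm : ∀ x m n → pow (pow x m) n ≡ pow (pow x n) m
  pow-comm x m n = trans (sym (pow-* x m n)) (trans (cong (pow x) (ℕₚ.*-comm m n)) (pow-* x n m))

  pow-0# : ∀ n → 0 < n → pow 0# n ≡ 0#
  pow-0# (suc n) _ = zeroˡ _

  pow≢0 : ∀ {x} n → x ≢ 0# → pow x n ≢ 0#
  pow≢0 zero    _   = 1≢0
  pow≢0 (suc n) x≢0 = ⊗≢0 x≢0 (pow≢0 n x≢0)

  nat-^ : ∀ m n → nat (m ^ n) ≡ pow (nat m) n
  nat-^ m zero    = +-identityʳ 1#
  nat-^ m (suc n) = trans (nat-* m (m ^ n)) (cong (nat m ⊗_) (nat-^ m n))

  ∑-shift : ∀ a → ∑ᶠ elements (λ x → x) ≡ ∑ᶠ elements (λ x → x ⊕ a)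
  ∑-shift a = S.∑-reindex unique (_⊕ a) (_⊕ ⊖ a) (λ x _ → complete _) (λ x _ → complete _)
    (λ x _ → trans (+-assoc x (⊖ a) a) (trans (cong (x ⊕_) (-‿inverseˡ a)) (+-identityʳ x)))
    (λ x _ → trans (+-assoc x a (⊖ a)) (trans (cong (x ⊕_) (-‿inverseʳ a)) (+-identityʳ x))) (λ x → x)

  -- Translation by 1 permutes the field, so the sum of all elements equals itself plus card · 1.
  nat-card : nat card ≡ 0#
  nat-card = +-cancelˡ (∑ᶠ elements (λ x → x)) _ _ (begin
    ∑ᶠ elements (λ x → x) ⊕ nat card         ≡⟨ cong (∑ᶠ elements (λ x → x) ⊕_) (*-identityʳ (nat card)) ⟨
    ∑ᶠ elements (λ x → x) ⊕ nat card ⊗ 1#    ≡⟨ cong (∑ᶠ elements (λ x → x) ⊕_) (S.∑-const elements 1#) ⟨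
    ∑ᶠ elements (λ x → x) ⊕ ∑ᶠ elements (λ _ → 1#) ≡⟨ S.∑-⊕ elements (λ x → x) (λ _ → 1#) ⟨
    ∑ᶠ elements (λ x → x ⊕ 1#)               ≡⟨ ∑-shift 1# ⟨
    ∑ᶠ elements (λ x → x)                    ≡⟨ +-identityʳ _ ⟨
    ∑ᶠ elements (λ x → x) ⊕ 0#               ∎)
    where open ≡-Reasoning

  private
    module B = Algebra.Properties.CommutativeSemiring.Binomial commutativeSemiring
    module E = Algebra.Properties.Semiring.Exp (CommutativeSemiring.semiring commutativeSemiring)
    module M = Algebra.Properties.Semiring.Mult (CommutativeSemiring.semiring commutativeSemiring)
    module Σᶠ = Algebra.Properties.Semiring.Sum (CommutativeSemiring.semiring commutativeSemiring)

    pow≡^ : ∀ x n → x E.^ n ≡ pow x n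
    pow≡^ x zero    = refl
    pow≡^ x (suc n) = cong (x ⊗_) (pow≡^ x n)

    ×≡nat : ∀ n x → n M.× x ≡ nat n ⊗ x
    ×≡nat zero    x = sym (zeroˡ x)
    ×≡nat (suc n) x = trans (cong₂ _⊕_ (sym (*-identityˡ x)) (×≡nat n x)) (sym (distribʳ x 1# (nat n)))

    sum≡∑ : ∀ n (f : ℕ → Carrier) (t : Fin n → Carrier) → (∀ i → t i ≡ f (toℕ i)) → Σᶠ.sum t ≡ ∑ᶠ (upTo n) f
    sum≡∑ zero    f t h = refl
    sum≡∑ (suc n) f t h = trans (cong₂ _⊕_ (h Fin.zero) (sum≡∑ n (f ∘ suc) (t ∘ Fin.suc) (h ∘ Fin.suc))) (sym (S.∑-upTo-suc n f))

  binomial : ∀ n x y → pow (x ⊕ y) n ≡ ∑ᶠ (upTo (suc n)) (λ i → nat (n C i) ⊗ (pow x i ⊗ pow y (n ∸ i)))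
  binomial n x y = trans (sym (pow≡^ (x ⊕ y) n)) (trans (B.theorem n x y) (sum≡∑ (suc n) _ _ λ i →
    trans (×≡nat (n C toℕ i) _) (cong (nat (n C toℕ i) ⊗_) (cong₂ _⊗_ (pow≡^ x (toℕ i)) (pow≡^ y (n ∸ toℕ i))))))

  pow-⊖1-even : ∀ n → pow (⊖ 1#) (2 * n) ≡ 1#
  pow-⊖1-even n = trans (pow-* (⊖ 1#) 2 n) (trans (cong (λ z → pow z n) sq) (pow-1# n))
    where
    sq : pow (⊖ 1#) 2 ≡ 1#
    sq = trans (cong (⊖ 1# ⊗_) (*-identityʳ _)) (trans (sym (-‿distribˡ-* 1# (⊖ 1#))) (trans (cong ⊖_ (*-identityˡ _)) (-‿involutive 1#)))

  ⊖≡⊖1⊗ : ∀ x → ⊖ x ≡ ⊖ 1# ⊗ x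
  ⊖≡⊖1⊗ x = trans (cong ⊖_ (sym (*-identityˡ x))) (-‿distribˡ-* 1# x)

  geometric : ∀ z n → z ⊗ ∑ᶠ (upTo n) (pow z) ⊕ 1# ≡ ∑ᶠ (upTo n) (pow z) ⊕ pow z n
  geometric z n = begin
    z ⊗ ∑ᶠ (upTo n) (pow z) ⊕ 1#           ≡⟨ +-comm _ 1# ⟩
    1# ⊕ z ⊗ ∑ᶠ (upTo n) (pow z)           ≡⟨ cong (1# ⊕_) (S.∑-⊗ˡ (upTo n) z (pow z)) ⟨
    1# ⊕ ∑ᶠ (upTo n) (pow z ∘ suc)         ≡⟨ S.∑-upTo-suc n (pow z) ⟨
    ∑ᶠ (upTo (suc n)) (pow z)              ≡⟨ cong (λ m → ∑ᶠ (upTo m) (pow z)) (ℕₚ.+-comm 1 n) ⟩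
    ∑ᶠ (upTo (n + 1)) (pow z)              ≡⟨ S.∑-upTo-+ n 1 (pow z) ⟩
    ∑ᶠ (upTo n) (pow z) ⊕ (pow z (n + 0) ⊕ 0#) ≡⟨ cong (∑ᶠ (upTo n) (pow z) ⊕_) (trans (+-identityʳ _) (cong (pow z) (ℕₚ.+-identityʳ n))) ⟩
    ∑ᶠ (upTo n) (pow z) ⊕ pow z n          ∎
    where open ≡-Reasoning

  geometric-zero : ∀ z n → pow z n ≡ 1# → z ≢ 1# → ∑ᶠ (upTo n) (pow z) ≡ 0#
  geometric-zero z n zⁿ≡1 z≢1 with ∑ᶠ (upTo n) (pow z) ≟ 0#
  ... | yes e = e
  ... | no s≢0 = ⊥-elim (z≢1 (⊗-cancelˡ s≢0 (begin
      s ⊗ z    ≡⟨ *-comm s z ⟩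
      z ⊗ s    ≡⟨ +-cancelʳ 1# (z ⊗ s) s (trans (geometric z n) (cong (s ⊕_) zⁿ≡1)) ⟩
      s        ≡⟨ *-identityʳ s ⟨
      s ⊗ 1#   ∎)))
    where
    open ≡-Reasoning
    s = ∑ᶠ (upTo n) (pow z)

  geometric-one : ∀ z n → z ≡ 1# → ∑ᶠ (upTo n) (pow z) ≡ nat n
  geometric-one z n z≡1 = begin
    ∑ᶠ (upTo n) (pow z)        ≡⟨ S.∑-cong′ (upTo n) (λ i → trans (cong (λ w → pow w i) z≡1) (pow-1# i)) ⟩
    ∑ᶠ (upTo n) (λ _ → 1#)     ≡⟨ S.∑-const (upTo n) 1# ⟩
    nat (length (upTo n)) ⊗ 1# ≡⟨ *-identityʳ _ ⟩
    nat (length (upTo n))      ≡⟨ cong nat (length-upTo n) ⟩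
    nat n                      ∎
    where open ≡-Reasoning

-- Characteristic p and Frobenius.

module Characteristic (F : FiniteField) {p E : ℕ} (pr : Prime p) (card≡ : FiniteField.card F ≡ p ^ E) where

  open FieldBasics F

  private instance
    p≢0 : NonZero p
    p≢0 = prime⇒nonZero pr

  -- (p · 1)^E = card · 1 = 0, and a field has no nonzero nilpotent elements.
  nat-p : nat p ≡ 0#
  nat-p with nat p ≟ 0#
  ... | yes e = e
  ... | no ne = ⊥-elim (pow≢0 E ne (trans (sym (nat-^ p E)) (trans (cong nat (sym card≡)) nat-card)))

  nat-∣ : ∀ {n} → p ∣ n → nat n ≡ 0#
  nat-∣ (divides k refl) = trans (nat-* k p) (trans (cong (nat k ⊗_) nat-p) (zeroʳ _))

  frobenius-+ : ∀ x y → pow (x ⊕ y) p ≡ pow x p ⊕ pow y p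
  frobenius-+ x y = begin
    pow (x ⊕ y) p                                       ≡⟨ binomial p x y ⟩
    ∑ᶠ (upTo (suc p)) term                              ≡⟨ S.∑-upTo-suc p term ⟩
    term 0 ⊕ ∑ᶠ (upTo p) (term ∘ suc)                   ≡⟨ cong (λ n → term 0 ⊕ ∑ᶠ (upTo n) (term ∘ suc)) (trans (sym (ℕₚ.suc-pred p)) (ℕₚ.+-comm 1 (pred p))) ⟩
    term 0 ⊕ ∑ᶠ (upTo (pred p + 1)) (term ∘ suc)        ≡⟨ cong (term 0 ⊕_) (S.∑-upTo-+ (pred p) 1 (term ∘ suc)) ⟩
    term 0 ⊕ (∑ᶠ (upTo (pred p)) (term ∘ suc) ⊕ (term (suc (pred p + 0)) ⊕ 0#))
      ≡⟨ cong₂ (λ a b → term 0 ⊕ (a ⊕ b)) (S.∑-zero (upTo (pred p)) middle) (trans (+-identityʳ _) (cong term last-index)) ⟩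
    term 0 ⊕ (0# ⊕ term p)                              ≡⟨ cong (term 0 ⊕_) (+-identityˡ _) ⟩
    term 0 ⊕ term p                                     ≡⟨ cong₂ _⊕_ term-0 term-p ⟩
    pow y p ⊕ pow x p                                   ≡⟨ +-comm _ _ ⟩
    pow x p ⊕ pow y p                                   ∎
    where
    open ≡-Reasoning
    term : ℕ → Carrier
    term i = nat (p C i) ⊗ (pow x i ⊗ pow y (p ∸ i))
    last-index : suc (pred p + 0) ≡ p
    last-index = trans (cong suc (ℕₚ.+-identityʳ (pred p))) (ℕₚ.suc-pred p)
    middle : ∀ i → i ∈ upTo (pred p) → term (suc i) ≡ 0#
    middle i i∈ = trans (cong (_⊗ (pow x (suc i) ⊗ pow y (p ∸ suc i))) (nat-∣ (prime∣C pr (s≤s z≤n) (subst (suc (suc i) ≤_) (ℕₚ.suc-pred p) (s≤s (∈-upTo⁻ i∈)))))) (zeroˡ _)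
    term-0 : term 0 ≡ pow y p
    term-0 = trans (cong (_⊗ (1# ⊗ pow y p)) (+-identityʳ 1#)) (trans (*-identityˡ _) (*-identityˡ _))
    term-p : term p ≡ pow x p
    term-p = begin
      nat (p C p) ⊗ (pow x p ⊗ pow y (p ∸ p))  ≡⟨ cong₂ (λ a b → nat a ⊗ (pow x p ⊗ pow y b)) (nCn≡1 p) (ℕₚ.n∸n≡0 p) ⟩
      nat 1 ⊗ (pow x p ⊗ 1#)                   ≡⟨ cong₂ _⊗_ (+-identityʳ 1#) (*-identityʳ _) ⟩
      1# ⊗ pow x p                             ≡⟨ *-identityˡ _ ⟩
      pow x p                                  ∎

  frobenius^-+ : ∀ j x y → pow (x ⊕ y) (p ^ j) ≡ pow x (p ^ j) ⊕ pow y (p ^ j)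
  frobenius^-+ zero x y = trans (pow-1 _) (sym (cong₂ _⊕_ (pow-1 x) (pow-1 y)))
  frobenius^-+ (suc j) x y = begin
    pow (x ⊕ y) (p * p ^ j)                              ≡⟨ pow-* _ p (p ^ j) ⟩
    pow (pow (x ⊕ y) p) (p ^ j)                          ≡⟨ cong (λ z → pow z (p ^ j)) (frobenius-+ x y) ⟩
    pow (pow x p ⊕ pow y p) (p ^ j)                      ≡⟨ frobenius^-+ j _ _ ⟩
    pow (pow x p) (p ^ j) ⊕ pow (pow y p) (p ^ j)        ≡⟨ cong₂ _⊕_ (pow-* x p (p ^ j)) (pow-* y p (p ^ j)) ⟨
    pow x (p * p ^ j) ⊕ pow y (p * p ^ j)                ∎
    where open ≡-Reasoning

  frobenius^-0 : ∀ j → pow 0# (p ^ j) ≡ 0#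
  frobenius^-0 j = pow-0# (p ^ j) (ℕₚ.m^n>0 p j)

  frobenius^-⊖ : ∀ j x → pow (⊖ x) (p ^ j) ≡ ⊖ pow x (p ^ j)
  frobenius^-⊖ j x = +-cancelˡ (pow x (p ^ j)) _ _ (begin
    pow x (p ^ j) ⊕ pow (⊖ x) (p ^ j)  ≡⟨ frobenius^-+ j x (⊖ x) ⟨
    pow (x ⊕ ⊖ x) (p ^ j)              ≡⟨ cong (λ z → pow z (p ^ j)) (-‿inverseʳ x) ⟩
    pow 0# (p ^ j)                     ≡⟨ frobenius^-0 j ⟩
    0#                                 ≡⟨ -‿inverseʳ _ ⟨
    pow x (p ^ j) ⊕ ⊖ pow x (p ^ j)    ∎)
    where open ≡-Reasoning

  frobenius^-∑ : ∀ {X : Set} j (xs : List X) (f : X → Carrier) → pow (∑ᶠ xs f) (p ^ j) ≡ ∑ᶠ xs (λ x → pow (f x) (p ^ j))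
  frobenius^-∑ j []       f = frobenius^-0 j
  frobenius^-∑ j (x ∷ xs) f = trans (frobenius^-+ j (f x) _) (cong (pow (f x) (p ^ j) ⊕_) (frobenius^-∑ j xs f))

  nat-∤ : ∀ {n} → ¬ p ∣ n → nat n ≢ 0#
  nat-∤ {n} p∤n n≡0 with coprime-Bézout (prime⇒coprime′ p∤n)
    where
    prime⇒coprime′ : ∀ {n} → ¬ p ∣ n → Coprime p n
    prime⇒coprime′ p∤n (d∣p , d∣n) with prime⇒irreducible pr d∣p
    ... | inj₁ d≡1 = d≡1
    ... | inj₂ refl = ⊥-elim (p∤n d∣n)
  ... | r = ⊥-elim (from r)
    where
    times : ∀ a b → nat b ≡ 0# → nat (a * b) ≡ 0#
    times a b e = trans (nat-* a b) (trans (cong (nat a ⊗_) e) (zeroʳ _))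
    absurd : ∀ u v → nat u ≡ 0# → nat v ≡ 0# → 1 + u ≡ v → ⊥
    absurd u v a b e = 1≢0 (trans (sym (trans (cong (1# ⊕_) a) (+-identityʳ 1#))) (trans (cong nat e) b))
    from : Bézout.Identity 1 p n → ⊥
    from (Bézout.+- x y e) = absurd (y * n) (x * p) (times y n n≡0) (times x p nat-p) e
    from (Bézout.-+ x y e) = absurd (x * p) (y * n) (times x p nat-p) (times y n n≡0) e

-- Integer and natural sums, and the geometric sum Ψ.

module ℤ∑ = Sum ℤₚ.+-*-isCommutativeSemiring
module ℕ∑ = Sum ℕₚ.+-*-isCommutativeSemiring
open ℤ∑ using () renaming (∑ to ∑ᶻ; 𝟙 to 𝟙ᶻ)
open ℕ∑ using () renaming (∑ to ∑ⁿ; 𝟙 to 𝟙ⁿ)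

sum-map≡∑ : ∀ {X : Set} (f : X → ℕ) xs → sum (map f xs) ≡ ∑ⁿ xs f
sum-map≡∑ f []       = refl
sum-map≡∑ f (x ∷ xs) = cong (f x +_) (sum-map≡∑ f xs)

ℤnat : ∀ n → ℤ∑.nat n ≡ pos n
ℤnat zero    = refl
ℤnat (suc n) = cong (1ℤ +ᶻ_) (ℤnat n)

ℕnat : ∀ n → ℕ∑.nat n ≡ n
ℕnat zero    = refl
ℕnat (suc n) = cong suc (ℕnat n)

Ψ-suc : ∀ d x → Ψ (suc d) x ≡ 1 + x * Ψ d x
Ψ-suc d x = begin
  Ψ (suc d) x                             ≡⟨ sum-map≡∑ (x ^_) (upTo (suc d)) ⟩
  ∑ⁿ (upTo (suc d)) (x ^_)                ≡⟨ ℕ∑.∑-upTo-suc d (x ^_) ⟩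
  1 + ∑ⁿ (upTo d) (λ i → x * x ^ i)       ≡⟨ cong (1 +_) (ℕ∑.∑-⊗ˡ (upTo d) x (x ^_)) ⟩
  1 + x * ∑ⁿ (upTo d) (x ^_)              ≡⟨ cong (λ z → 1 + x * z) (sum-map≡∑ (x ^_) (upTo d)) ⟨
  1 + x * Ψ d x                           ∎
  where open ≡-Reasoning

Ψ-geometric : ∀ d y → Ψ d (suc y) * y + 1 ≡ suc y ^ d
Ψ-geometric zero    y = refl
Ψ-geometric (suc d) y = begin
  Ψ (suc d) (suc y) * y + 1            ≡⟨ cong (λ z → z * y + 1) (Ψ-suc d (suc y)) ⟩
  (1 + suc y * Ψ d (suc y)) * y + 1    ≡⟨ lem y (Ψ d (suc y)) ⟩
  suc y * (Ψ d (suc y) * y + 1)        ≡⟨ cong (suc y *_) (Ψ-geometric d y) ⟩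
  suc y * suc y ^ d                    ∎
  where
  open ≡-Reasoning
  lem : ∀ y z → (1 + (1 + y) * z) * y + 1 ≡ (1 + y) * (z * y + 1)
  lem = solve-∀

Ψ-geometric-∸ : ∀ d x → 0 < x → Ψ d x * (x ∸ 1) ≡ x ^ d ∸ 1
Ψ-geometric-∸ d (suc y) _ = trans (sym (ℕₚ.m+n∸n≡m _ 1)) (cong (_∸ 1) (Ψ-geometric d y))

unique-⊆⇒≤ : {A : Set} {ys xs : List A} → Unique ys → (∀ {x} → x ∈ ys → x ∈ xs) → length ys ≤ length xs
unique-⊆⇒≤ {ys = ys} {xs} u sub with ℕₚ.≤-total (length ys) (length xs)
... | inj₁ le = le
... | inj₂ ge = ℕₚ.≤-reflexive (↭-length (unique-⊆⇒↭ u sub ge))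

-- The cyclic group generated by ω.

module Cyclic (F : FiniteField) (ω : FiniteField.Carrier F) (ω-prim : FiniteField.IsPrimitive F ω) where

  open FieldBasics F

  M : ℕ
  M = card ∸ 1

  1<card : 1 < card
  1<card = unique-⊆⇒≤ {ys = 0# ∷ 1# ∷ []} ((0#≢1# All.∷ All.[]) ∷ (All.[] ∷ [])) (λ _ → complete _)

  0<M : 0 < M
  0<M = ℕₚ.m<n⇒0<n∸m 1<card

  private instance
    M≢0 : NonZero M
    M≢0 = >-nonZero 0<M

  pow-mod : ∀ {h N} .{{_ : NonZero N}} → pow h N ≡ 1# → ∀ j → pow h j ≡ pow h (j % N)
  pow-mod {h} {N} hᴺ≡1 j = begin
    pow h j                  ≡⟨ cong (pow h) (m≡m%n+[m/n]*n j N) ⟩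
    pow h (a + b * N)        ≡⟨ pow-+ h a (b * N) ⟩
    pow h a ⊗ pow h (b * N)  ≡⟨ cong (pow h a ⊗_) (trans (cong (pow h) (ℕₚ.*-comm b N)) (pow-* h N b)) ⟩
    pow h a ⊗ pow (pow h N) b ≡⟨ cong (λ z → pow h a ⊗ pow z b) hᴺ≡1 ⟩
    pow h a ⊗ pow 1# b       ≡⟨ cong (pow h a ⊗_) (pow-1# b) ⟩
    pow h a ⊗ 1#             ≡⟨ *-identityʳ _ ⟩
    pow h a                  ∎
    where
    open ≡-Reasoning
    a = j % N
    b = j / N

  -- Divisibility replaces the minimality in `IsPrimitive`: in this form the order of a power h^L is
  -- read off by cancelling L.
  IsOrder : Carrier → ℕ → Set
  IsOrder h N = pow h N ≡ 1# × (∀ j → pow h j ≡ 1# → N ∣ j)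

  order-ω : IsOrder ω M
  order-ω = proj₁ ω-prim , go
    where
    go : ∀ j → pow ω j ≡ 1# → M ∣ j
    go j e with j % M ℕₚ.≟ 0
    ... | yes z = m%n≡0⇒n∣m j M z
    ... | no nz = ⊥-elim (proj₂ ω-prim (j % M) (ℕₚ.n≢0⇒n>0 nz) (m%n<n j M) (trans (sym (pow-mod (proj₁ ω-prim) j)) e))

  order≢0 : ∀ {h N} → 0 < N → IsOrder h N → h ≢ 0#
  order≢0 {N = N} 0<N (e , _) refl = 0#≢1# (trans (sym (pow-0# N 0<N)) e)

  ω≢0 : ω ≢ 0#
  ω≢0 = order≢0 0<M order-ω

  order-pow : ∀ {h} L N → 0 < L → IsOrder h (L * N) → IsOrder (pow h L) N
  order-pow {h} L N 0<L (e , o) = trans (sym (pow-* h L N)) e ,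
    λ j ej → *-cancelˡ-∣ L {{>-nonZero 0<L}} (o (L * j) (trans (pow-* h L j) ej))

  private
    order-injective-≤ : ∀ {h N} → 0 < N → IsOrder h N → ∀ {i j} → i ≤ j → j < N → pow h i ≡ pow h j → i ≡ j
    order-injective-≤ {h} {N} 0<N ho {i} {j} i≤j j<N e with j ∸ i in eq
    ... | zero = ℕₚ.≤-antisym i≤j (ℕₚ.m∸n≡0⇒m≤n eq)
    ... | suc k = ⊥-elim (ℕₚ.<⇒≱ (ℕₚ.≤-<-trans (ℕₚ.m∸n≤m j i) j<N) (subst (N ≤_) (sym eq) (∣⇒≤ (proj₂ ho (suc k) (subst (λ z → pow h z ≡ 1#) eq hʲ⁻ⁱ≡1)))))
      where
      open ≡-Reasoning
      hʲ⁻ⁱ≡1 : pow h (j ∸ i) ≡ 1#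
      hʲ⁻ⁱ≡1 = ⊗-cancelˡ (pow≢0 i (order≢0 0<N ho)) (begin
        pow h i ⊗ pow h (j ∸ i)  ≡⟨ pow-+ h i (j ∸ i) ⟨
        pow h (i + (j ∸ i))      ≡⟨ cong (pow h) (ℕₚ.m+[n∸m]≡n i≤j) ⟩
        pow h j                  ≡⟨ e ⟨
        pow h i                  ≡⟨ *-identityʳ _ ⟨
        pow h i ⊗ 1#             ∎)

  order-injective : ∀ {h N} → 0 < N → IsOrder h N → ∀ {i j} → i < N → j < N → pow h i ≡ pow h j → i ≡ j
  order-injective {h} {N} 0<N ho {i} {j} i<N j<N e with ℕₚ.≤-total i j
  ... | inj₁ i≤j = order-injective-≤ 0<N ho i≤j j<N e
  ... | inj₂ j≤i = sym (order-injective-≤ 0<N ho j≤i i<N (sym e))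

  powers-unique : ∀ {h N} → 0 < N → IsOrder h N → Unique (map (pow h) (upTo N))
  powers-unique 0<N ho = map-unique (pow _) (λ i∈ j∈ → order-injective 0<N ho (∈-upTo⁻ i∈) (∈-upTo⁻ j∈)) (Uniqueₚ.upTo⁺ _)

  -- 0 and the M distinct powers of ω are `card` many elements, so they exhaust the field.
  log : ∀ {x} → x ≢ 0# → ∃ λ j → x ≡ pow ω j
  log {x} x≢0 with ∈-resp-↭ (↭-sym all) (complete x)
    where
    all : (0# ∷ map (pow ω) (upTo M)) ↭ elements
    all = unique-⊆⇒↭
      (All.tabulate (λ z∈ e → let (i , _ , eq) = ∈-map⁻ (pow ω) z∈ in pow≢0 i ω≢0 (sym (trans e eq))) ∷ powers-unique 0<M order-ω)
      (λ _ → complete _)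
      (ℕₚ.≤-reflexive (sym (trans (cong suc (trans (length-map (pow ω) (upTo M)) (length-upTo M))) (ℕₚ.m+[n∸m]≡n (ℕₚ.<⇒≤ 1<card)))))
  ... | here x≡0 = ⊥-elim (x≢0 x≡0)
  ... | there x∈ = let (i , _ , eq) = ∈-map⁻ (pow ω) x∈ in i , eq

  -- For x = ω^j the equation x^N = 1 forces L N ∣ j N, hence L ∣ j.
  roots-of-unity : ∀ L N → 0 < N → L * N ≡ M → ∀ {x} → pow x N ≡ 1# → x ∈ map (pow (pow ω L)) (upTo N)
  roots-of-unity L N 0<N LN≡M {x} xᴺ≡1 with log {x} (λ { refl → 0#≢1# (trans (sym (pow-0# N 0<N)) xᴺ≡1) })
  ... | j , refl with *-cancelˡ-∣ N {{>-nonZero 0<N}} (subst₂′ (proj₂ order-ω (j * N) (trans (pow-* ω j N) xᴺ≡1)))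
    where
    subst₂′ : M ∣ j * N → N * L ∣ N * j
    subst₂′ d = subst (_∣ N * j) (trans (sym LN≡M) (ℕₚ.*-comm L N)) (subst (M ∣_) (ℕₚ.*-comm j N) d)
  ... | divides i refl = subst (_∈ map (pow g) (upTo N)) (sym lem) (∈-map⁺ (pow g) (∈-upTo⁺ (m%n<n i N)))
    where
    instance _ = >-nonZero 0<N
    g = pow ω L
    gᴺ≡1 : pow g N ≡ 1#
    gᴺ≡1 = trans (sym (pow-* ω L N)) (trans (cong (pow ω) LN≡M) (proj₁ order-ω))
    lem : pow ω (i * L) ≡ pow g (i % N)
    lem = trans (cong (pow ω) (ℕₚ.*-comm i L)) (trans (pow-* ω L i) (pow-mod gᴺ≡1 i))

-- Subfields of F and their unit groups.

module Trace (F : FiniteField) {p E : ℕ} (pr : Prime p) (card≡ : FiniteField.card F ≡ p ^ E)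
             (ω : FiniteField.Carrier F) (ω-prim : FiniteField.IsPrimitive F ω) where

  open FieldBasics F public
  open Characteristic F {p} {E} pr card≡ public
  open Cyclic F ω ω-prim public

  private instance
    p≢0 : NonZero p
    p≢0 = prime⇒nonZero pr

  0<p^ : ∀ e → 0 < p ^ e
  0<p^ e = ℕₚ.m^n>0 p e

  -- Total, with the junk value 0 at 0, so that scaling by an inverse is a plain function; the laws
  -- below assume a nonzero argument.
  inv : Carrier → Carrier
  inv x with x ≟ 0#
  ... | yes _ = 0#
  ... | no x≢0 = proj₁ (inverse x x≢0)

  inv-r : ∀ {x} → x ≢ 0# → x ⊗ inv x ≡ 1#
  inv-r {x} x≢0 with x ≟ 0#
  ... | yes e = ⊥-elim (x≢0 e)
  ... | no ne = proj₂ (inverse x ne)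

  inv-l : ∀ {x} → x ≢ 0# → inv x ⊗ x ≡ 1#
  inv-l x≢0 = trans (*-comm _ _) (inv-r x≢0)

  inv-cancelˡ : ∀ {a} x → a ≢ 0# → a ⊗ (inv a ⊗ x) ≡ x
  inv-cancelˡ {a} x a≢0 = trans (sym (*-assoc a _ x)) (trans (cong (_⊗ x) (inv-r a≢0)) (*-identityˡ x))

  inv-cancelˡ′ : ∀ {a} x → a ≢ 0# → inv a ⊗ (a ⊗ x) ≡ x
  inv-cancelˡ′ {a} x a≢0 = trans (sym (*-assoc _ a x)) (trans (cong (_⊗ x) (inv-l a≢0)) (*-identityˡ x))

  -- For e ∣ E this is the subfield 𝔽_{p^e}, realised as the fixed points of x ↦ x^(p^e). Thus 𝔽_p,
  -- 𝔽_s and 𝔽_q are handled without embeddings.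
  Sub : ℕ → Carrier → Set
  Sub e x = pow x (p ^ e) ≡ x

  sub : ℕ → List Carrier
  sub e = filter (λ x → pow x (p ^ e) ≟ x) elements

  ∈sub⁺ : ∀ {e x} → Sub e x → x ∈ sub e
  ∈sub⁺ {e} s = ∈-filter⁺ (λ x → pow x (p ^ e) ≟ x) (complete _) s

  ∈sub⁻ : ∀ {e x} → x ∈ sub e → Sub e x
  ∈sub⁻ {e} x∈ = proj₂ (∈-filter⁻ (λ x → pow x (p ^ e) ≟ x) {xs = elements} x∈)

  sub-unique : ∀ e → Unique (sub e)
  sub-unique e = Uniqueₚ.filter⁺ (λ x → pow x (p ^ e) ≟ x) unique

  Sub-0 : ∀ e → Sub e 0#
  Sub-0 = frobenius^-0

  Sub-1 : ∀ e → Sub e 1#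
  Sub-1 e = pow-1# (p ^ e)

  Sub-⊕ : ∀ e {x y} → Sub e x → Sub e y → Sub e (x ⊕ y)
  Sub-⊕ e a b = trans (frobenius^-+ e _ _) (cong₂ _⊕_ a b)

  Sub-⊗ : ∀ e {x y} → Sub e x → Sub e y → Sub e (x ⊗ y)
  Sub-⊗ e a b = trans (pow-⊗ _ _ (p ^ e)) (cong₂ _⊗_ a b)

  Sub-⊖ : ∀ e {x} → Sub e x → Sub e (⊖ x)
  Sub-⊖ e a = trans (frobenius^-⊖ e _) (cong ⊖_ a)

  Sub-pow : ∀ e {x} n → Sub e x → Sub e (pow x n)
  Sub-pow e zero    s = Sub-1 e
  Sub-pow e (suc n) s = Sub-⊗ e s (Sub-pow e n s)

  Sub-inv : ∀ e {x} → x ≢ 0# → Sub e x → Sub e (inv x)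
  Sub-inv e {x} x≢0 s = ⊗-cancelˡ x≢0 (begin
    x ⊗ pow (inv x) (p ^ e)              ≡⟨ cong (_⊗ pow (inv x) (p ^ e)) s ⟨
    pow x (p ^ e) ⊗ pow (inv x) (p ^ e)  ≡⟨ pow-⊗ x (inv x) (p ^ e) ⟨
    pow (x ⊗ inv x) (p ^ e)              ≡⟨ cong (λ z → pow z (p ^ e)) (inv-r x≢0) ⟩
    pow 1# (p ^ e)                       ≡⟨ pow-1# (p ^ e) ⟩
    1#                                   ≡⟨ inv-r x≢0 ⟨
    x ⊗ inv x                            ∎)
    where open ≡-Reasoning

  Sub-mono : ∀ e d {x} → Sub e x → Sub (d * e) x
  Sub-mono e zero    s = pow-1 _
  Sub-mono e (suc d) {x} s = begin
    pow x (p ^ (e + d * e))            ≡⟨ cong (pow x) (ℕₚ.^-distribˡ-+-* p e (d * e)) ⟩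
    pow x (p ^ e * p ^ (d * e))        ≡⟨ pow-* x (p ^ e) (p ^ (d * e)) ⟩
    pow (pow x (p ^ e)) (p ^ (d * e))  ≡⟨ cong (λ z → pow z (p ^ (d * e))) s ⟩
    pow x (p ^ (d * e))                ≡⟨ Sub-mono e d s ⟩
    x                                  ∎
    where open ≡-Reasoning

  Sub₁⇒Sub : ∀ e {x} → Sub 1 x → Sub e x
  Sub₁⇒Sub e s = subst (λ n → Sub n _) (ℕₚ.*-identityʳ e) (Sub-mono 1 e s)

  ∑-translate : ∀ e {a} → Sub e a → (f : Carrier → ℤ) → ∑ᶻ (sub e) f ≡ ∑ᶻ (sub e) (λ x → f (x ⊕ a))
  ∑-translate e {a} sa f = ℤ∑.∑-reindex (sub-unique e) (_⊕ a) (_⊕ ⊖ a)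
    (λ x x∈ → ∈sub⁺ {e} (Sub-⊕ e (∈sub⁻ {e} x∈) sa)) (λ x x∈ → ∈sub⁺ {e} (Sub-⊕ e (∈sub⁻ {e} x∈) (Sub-⊖ e sa)))
    (λ x _ → trans (+-assoc x (⊖ a) a) (trans (cong (x ⊕_) (-‿inverseˡ a)) (+-identityʳ x)))
    (λ x _ → trans (+-assoc x a (⊖ a)) (trans (cong (x ⊕_) (-‿inverseʳ a)) (+-identityʳ x))) f

  ∑-scale : ∀ e {a} → a ≢ 0# → Sub e a → (f : Carrier → ℤ) → ∑ᶻ (sub e) f ≡ ∑ᶻ (sub e) (λ x → f (a ⊗ x))
  ∑-scale e {a} a≢0 sa f = ℤ∑.∑-reindex (sub-unique e) (a ⊗_) (inv a ⊗_)
    (λ x x∈ → ∈sub⁺ {e} (Sub-⊗ e sa (∈sub⁻ {e} x∈))) (λ x x∈ → ∈sub⁺ {e} (Sub-⊗ e (Sub-inv e a≢0 sa) (∈sub⁻ {e} x∈)))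
    (λ x _ → inv-cancelˡ x a≢0) (λ x _ → inv-cancelˡ′ x a≢0) f

  module Units (e d : ℕ) (0<e : 0 < e) (d*e≡E : d * e ≡ E) where

    N : ℕ
    N = p ^ e ∸ 1

    suc-N : suc N ≡ p ^ e
    suc-N = ℕₚ.m+[n∸m]≡n (0<p^ e)

    0<N : 0 < N
    0<N = ℕₚ.m<n⇒0<n∸m (ℕₚ.≤-trans (prime>1 pr) (subst (_≤ p ^ e) (ℕₚ.*-identityʳ p) (ℕₚ.^-monoʳ-≤ p 0<e)))

    p∤N : ¬ p ∣ N
    p∤N p∣N = ∤-< pr (s≤s z≤n) (prime>1 pr) (∣m+n∣m⇒∣n (subst (p ∣_) (trans (sym suc-N) (ℕₚ.+-comm 1 N)) p∣p^e) p∣N)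
      where
      p∣p^e : p ∣ p ^ e
      p∣p^e = subst (λ z → p ∣ p ^ z) (ℕₚ.suc-pred e {{>-nonZero 0<e}}) (m∣m*n (p ^ pred e))

    -- L = 1 + p^e + ... + p^(e(d-1)) is the index of 𝔽_{p^e}^* in F^*, so ω^L generates the smaller
    -- unit group.
    L : ℕ
    L = Ψ d (p ^ e)

    L*N≡M : L * N ≡ M
    L*N≡M = begin
      Ψ d (p ^ e) * (p ^ e ∸ 1)   ≡⟨ Ψ-geometric-∸ d (p ^ e) (0<p^ e) ⟩
      (p ^ e) ^ d ∸ 1             ≡⟨ cong (_∸ 1) (ℕₚ.^-*-assoc p e d) ⟩
      p ^ (e * d) ∸ 1             ≡⟨ cong (λ z → p ^ z ∸ 1) (trans (ℕₚ.*-comm e d) d*e≡E) ⟩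
      p ^ E ∸ 1                   ≡⟨ cong (_∸ 1) card≡ ⟨
      M                           ∎
      where open ≡-Reasoning

    0<L : 0 < L
    0<L = ℕₚ.n≢0⇒n>0 (λ z → ℕₚ.<⇒≢ 0<M (trans (cong (_* N) (sym z)) L*N≡M))

    gen : Carrier
    gen = pow ω L

    order-gen : IsOrder gen N
    order-gen = order-pow L N 0<L (subst (IsOrder ω) (sym L*N≡M) order-ω)

    gen≢0 : gen ≢ 0#
    gen≢0 = order≢0 0<N order-gen

    units : List Carrier
    units = map (pow gen) (upTo N)

    Sub⇒powN : ∀ {x} → x ≢ 0# → Sub e x → pow x N ≡ 1#
    Sub⇒powN {x} x≢0 s = ⊗-cancelˡ x≢0 (trans (cong (pow x) suc-N) (trans s (sym (*-identityʳ x))))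

    powN⇒Sub : ∀ {x} → pow x N ≡ 1# → Sub e x
    powN⇒Sub {x} h = trans (cong (pow x) (sym suc-N)) (trans (cong (x ⊗_) h) (*-identityʳ x))

    gen-Sub : Sub e gen
    gen-Sub = powN⇒Sub (proj₁ order-gen)

    units-Sub : ∀ {x} → x ∈ units → Sub e x
    units-Sub x∈ with ∈-map⁻ (pow gen) x∈
    ... | i , _ , refl = Sub-pow e i gen-Sub

    units≢0 : ∀ {x} → x ∈ units → x ≢ 0#
    units≢0 x∈ with ∈-map⁻ (pow gen) x∈
    ... | i , _ , refl = pow≢0 i gen≢0

    -- A nonzero fixed point of x ↦ x^(p^e) is a root of x^N = 1, and those roots are the powers of
    -- `gen`. This yields the order of the subfield and lets sums over it be split at 0.
    sub-↭ : sub e ↭ 0# ∷ units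
    sub-↭ = unique-set⇒↭ (sub-unique e)
      (All.tabulate (λ z∈ e → units≢0 z∈ (sym e)) ∷ powers-unique 0<N order-gen) to from
      where
      to : ∀ {x} → x ∈ sub e → x ∈ 0# ∷ units
      to {x} x∈ with x ≟ 0#
      ... | yes x≡0 = here x≡0
      ... | no x≢0 = there (roots-of-unity L N 0<N L*N≡M (Sub⇒powN x≢0 (∈sub⁻ {e} x∈)))
      from : ∀ {x} → x ∈ 0# ∷ units → x ∈ sub e
      from (here refl) = ∈sub⁺ {e} (Sub-0 e)
      from (there x∈) = ∈sub⁺ {e} (units-Sub x∈)

    length-sub : length (sub e) ≡ p ^ e
    length-sub = trans (↭-length sub-↭) (trans (cong suc (trans (length-map (pow gen) (upTo N)) (length-upTo N))) suc-N)

    ∑-const-sub : ∀ a → ∑ᶻ (sub e) (λ _ → a) ≡ pos (p ^ e) *ᶻ a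
    ∑-const-sub a = trans (ℤ∑.∑-const (sub e) a) (cong (_*ᶻ a) (trans (ℤnat _) (cong pos length-sub)))

    ∑-const-units : ∀ a → ∑ᶻ units (λ _ → a) ≡ pos N *ᶻ a
    ∑-const-units a = trans (ℤ∑.∑-const units a) (cong (_*ᶻ a) (trans (ℤnat _) (cong pos (trans (length-map (pow gen) (upTo N)) (length-upTo N)))))

  -- Absolute and relative traces.

  tr : ℕ → Carrier → Carrier
  tr e x = ∑ᶠ (upTo e) (λ j → pow x (p ^ j))

  tr-⊕ : ∀ e x y → tr e (x ⊕ y) ≡ tr e x ⊕ tr e y
  tr-⊕ e x y = trans (S.∑-cong′ (upTo e) (λ j → frobenius^-+ j x y)) (S.∑-⊕ (upTo e) _ _)

  tr-scale : ∀ e {a} x → Sub 1 a → tr e (a ⊗ x) ≡ a ⊗ tr e x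
  tr-scale e {a} x s = trans (S.∑-cong′ (upTo e) (λ j → trans (pow-⊗ a x (p ^ j)) (cong (_⊗ pow x (p ^ j)) (Sub₁⇒Sub j s)))) (S.∑-⊗ˡ (upTo e) a _)

  tr-0 : ∀ e → tr e 0# ≡ 0#
  tr-0 e = S.∑-zero (upTo e) (λ j _ → frobenius^-0 j)

  -- A formal sum of Frobenius powers, defined on all of F. On 𝔽_{p^(de)} it is the trace down to
  -- 𝔽_{p^e}.
  relTr : ℕ → ℕ → Carrier → Carrier
  relTr d e x = ∑ᶠ (upTo d) (λ i → pow x (p ^ (i * e)))

  relTr-Sub : ∀ d e {x} → Sub (d * e) x → Sub e (relTr d e x)
  relTr-Sub d e {x} s = +-cancelˡ (f 0) _ _ (begin
    f 0 ⊕ pow (relTr d e x) (p ^ e)                   ≡⟨ cong (f 0 ⊕_) (frobenius^-∑ e (upTo d) f) ⟩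
    f 0 ⊕ ∑ᶠ (upTo d) (λ i → pow (f i) (p ^ e))       ≡⟨ cong (f 0 ⊕_) (S.∑-cong′ (upTo d) step) ⟩
    f 0 ⊕ ∑ᶠ (upTo d) (f ∘ suc)                       ≡⟨ S.∑-upTo-suc d f ⟨
    ∑ᶠ (upTo (suc d)) f                               ≡⟨ cong (λ n → ∑ᶠ (upTo n) f) (ℕₚ.+-comm 1 d) ⟩
    ∑ᶠ (upTo (d + 1)) f                               ≡⟨ S.∑-upTo-+ d 1 f ⟩
    relTr d e x ⊕ (f (d + 0) ⊕ 0#)                    ≡⟨ cong (relTr d e x ⊕_) (trans (+-identityʳ _) (trans (cong f (ℕₚ.+-identityʳ d)) (trans s (sym (pow-1 x))))) ⟩
    relTr d e x ⊕ f 0                                 ≡⟨ +-comm _ _ ⟩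
    f 0 ⊕ relTr d e x                                 ∎)
    where
    open ≡-Reasoning
    f : ℕ → Carrier
    f i = pow x (p ^ (i * e))
    step : ∀ i → pow (f i) (p ^ e) ≡ f (suc i)
    step i = trans (sym (pow-* x (p ^ (i * e)) (p ^ e))) (cong (pow x) (trans (ℕₚ.*-comm (p ^ (i * e)) (p ^ e)) (sym (ℕₚ.^-distribˡ-+-* p e (i * e)))))

  relTr-⊕ : ∀ d e x y → relTr d e (x ⊕ y) ≡ relTr d e x ⊕ relTr d e y
  relTr-⊕ d e x y = trans (S.∑-cong′ (upTo d) (λ i → frobenius^-+ (i * e) x y)) (S.∑-⊕ (upTo d) _ _)

  relTr-scale : ∀ d e {a} x → Sub e a → relTr d e (a ⊗ x) ≡ a ⊗ relTr d e x
  relTr-scale d e {a} x s = trans (S.∑-cong′ (upTo d) (λ i → trans (pow-⊗ a x (p ^ (i * e))) (cong (_⊗ pow x (p ^ (i * e))) (Sub-mono e i s)))) (S.∑-⊗ˡ (upTo d) a _)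

  tr≡relTr : ∀ e x → tr e x ≡ relTr e 1 x
  tr≡relTr e x = S.∑-cong′ (upTo e) (λ j → cong (λ k → pow x (p ^ k)) (sym (ℕₚ.*-identityʳ j)))

  tr-Sub₁ : ∀ e {x} → Sub e x → Sub 1 (tr e x)
  tr-Sub₁ e {x} s = subst (Sub 1) (sym (tr≡relTr e x)) (relTr-Sub e 1 (subst (λ k → Sub k x) (sym (ℕₚ.*-identityʳ e)) s))

  tr-tower : ∀ d e x → tr (d * e) x ≡ tr e (relTr d e x)
  tr-tower d e x = begin
    tr (d * e) x
      ≡⟨ S.∑-upTo-* d e (λ j → pow x (p ^ j)) ⟩
    ∑ᶠ (upTo d) (λ i → ∑ᶠ (upTo e) (λ j → pow x (p ^ (i * e + j))))
      ≡⟨ S.∑-swap (upTo d) (upTo e) _ ⟩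
    ∑ᶠ (upTo e) (λ j → ∑ᶠ (upTo d) (λ i → pow x (p ^ (i * e + j))))
      ≡⟨ S.∑-cong′ (upTo e) (λ j → S.∑-cong′ (upTo d) (λ i → trans (cong (pow x) (ℕₚ.^-distribˡ-+-* p (i * e) j)) (pow-* x (p ^ (i * e)) (p ^ j)))) ⟩
    ∑ᶠ (upTo e) (λ j → ∑ᶠ (upTo d) (λ i → pow (pow x (p ^ (i * e))) (p ^ j)))
      ≡⟨ S.∑-cong′ (upTo e) (λ j → frobenius^-∑ j (upTo d) _) ⟨
    tr e (relTr d e x) ∎
    where open ≡-Reasoning

  -- Σ_s β^{-s} relTr(δ β^s) = N δ, because the conjugates of β are distinct.
  relTr-nondegenerate : ∀ d e → 0 < d → ∀ {β} N → β ≢ 0# → ¬ p ∣ N →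
    (∀ j → pow (pow β (p ^ (j * e) ∸ 1)) N ≡ 1#) →
    (∀ j → 0 < j → j < d → pow β (p ^ (j * e) ∸ 1) ≢ 1#) →
    ∀ δ → (∀ s → s < N → relTr d e (δ ⊗ pow β s) ≡ 0#) → δ ≡ 0#
  relTr-nondegenerate d e 0<d {β} N β≢0 p∤N roots distinct δ h with zero-product δN≡0
    where
    open ≡-Reasoning
    Q : ℕ → ℕ
    Q j = p ^ (j * e)
    -- The quotient of the j-th conjugate of β by β itself. It is 1 for j = 0 and, for 0 < j < d, an
    -- N-th root of unity other than 1, so its geometric sum vanishes.
    z : ℕ → Carrier
    z j = inv β ⊗ pow β (Q j)
    z≡ : ∀ j → z j ≡ pow β (Q j ∸ 1)
    z≡ j = begin
      inv β ⊗ pow β (Q j)              ≡⟨ cong (λ k → inv β ⊗ pow β k) (ℕₚ.m+[n∸m]≡n (0<p^ (j * e))) ⟨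
      inv β ⊗ (β ⊗ pow β (Q j ∸ 1))    ≡⟨ inv-cancelˡ′ _ β≢0 ⟩
      pow β (Q j ∸ 1)                  ∎
    term : ∀ s j → pow (inv β) s ⊗ pow (δ ⊗ pow β s) (Q j) ≡ pow δ (Q j) ⊗ pow (z j) s
    term s j = begin
      pow (inv β) s ⊗ pow (δ ⊗ pow β s) (Q j)             ≡⟨ cong (pow (inv β) s ⊗_) (pow-⊗ δ (pow β s) (Q j)) ⟩
      pow (inv β) s ⊗ (pow δ (Q j) ⊗ pow (pow β s) (Q j)) ≡⟨ *-assoc _ _ _ ⟨
      pow (inv β) s ⊗ pow δ (Q j) ⊗ pow (pow β s) (Q j)   ≡⟨ cong₂ _⊗_ (*-comm _ _) (pow-comm β s (Q j)) ⟩
      pow δ (Q j) ⊗ pow (inv β) s ⊗ pow (pow β (Q j)) s   ≡⟨ *-assoc _ _ _ ⟩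
      pow δ (Q j) ⊗ (pow (inv β) s ⊗ pow (pow β (Q j)) s) ≡⟨ cong (pow δ (Q j) ⊗_) (pow-⊗ (inv β) _ s) ⟨
      pow δ (Q j) ⊗ pow (z j) s                           ∎
    G : ℕ → Carrier
    G j = pow δ (Q j) ⊗ ∑ᶠ (upTo N) (pow (z j))
    G-zero : ∀ j → j ∈ upTo d → j ≢ 0 → G j ≡ 0#
    G-zero j j∈ j≢0 = trans (cong (pow δ (Q j) ⊗_) (geometric-zero (z j) N (trans (cong (λ w → pow w N) (z≡ j)) (roots j)) (λ q → distinct j (ℕₚ.n≢0⇒n>0 j≢0) (∈-upTo⁻ j∈) (trans (sym (z≡ j)) q)))) (zeroʳ _)
    δN≡0 : δ ⊗ nat N ≡ 0#
    δN≡0 = begin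
      δ ⊗ nat N
        ≡⟨ cong₂ _⊗_ (pow-1 δ) (geometric-one (z 0) N (z≡ 0)) ⟨
      G 0
        ≡⟨ S.∑-single (Uniqueₚ.upTo⁺ d) (∈-upTo⁺ 0<d) G G-zero ⟨
      ∑ᶠ (upTo d) G
        ≡⟨ S.∑-cong′ (upTo d) (λ j → S.∑-⊗ˡ (upTo N) (pow δ (Q j)) (pow (z j))) ⟨
      ∑ᶠ (upTo d) (λ j → ∑ᶠ (upTo N) (λ s → pow δ (Q j) ⊗ pow (z j) s))
        ≡⟨ S.∑-swap (upTo N) (upTo d) _ ⟨
      ∑ᶠ (upTo N) (λ s → ∑ᶠ (upTo d) (λ j → pow δ (Q j) ⊗ pow (z j) s))
        ≡⟨ S.∑-cong (upTo N) (λ s s∈ → trans (sym (S.∑-cong′ (upTo d) (term s))) (trans (S.∑-⊗ˡ (upTo d) (pow (inv β) s) _) (trans (cong (pow (inv β) s ⊗_) (h s (∈-upTo⁻ s∈))) (zeroʳ _)))) ⟩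
      ∑ᶠ (upTo N) (λ _ → 0#)
        ≡⟨ S.∑-zero (upTo N) (λ _ _ → refl) ⟩
      0# ∎
  ... | inj₁ δ≡0 = δ≡0
  ... | inj₂ N≡0 = ⊥-elim (nat-∤ p∤N N≡0)

  tr-nondegenerate : ∀ e → 0 < e → ∀ {β} N → β ≢ 0# → pow β N ≡ 1# → ¬ p ∣ N →
    (∀ j → 0 < j → j < e → pow β (p ^ j ∸ 1) ≢ 1#) →
    ∀ δ → (∀ s → s < N → tr e (δ ⊗ pow β s) ≡ 0#) → δ ≡ 0#
  tr-nondegenerate e 0<e {β} N β≢0 βᴺ≡1 p∤N distinct δ h = relTr-nondegenerate e 1 0<e N β≢0 p∤N
    (λ j → trans (pow-comm β (p ^ (j * 1) ∸ 1) N) (trans (cong (λ w → pow w (p ^ (j * 1) ∸ 1)) βᴺ≡1) (pow-1# (p ^ (j * 1) ∸ 1))))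
    (λ j 0<j j<e q → distinct j 0<j j<e (trans (cong (λ k → pow β (p ^ k ∸ 1)) (sym (ℕₚ.*-identityʳ j))) q))
    δ (λ s s<N → trans (sym (tr≡relTr e (δ ⊗ pow β s))) (h s s<N))

  -- Nondegeneracy with δ = 1 and β the generator of the unit group: a trace vanishing on all units
  -- would give 1 = 0.
  tr≢0 : ∀ e d → 0 < e → d * e ≡ E → ∃ λ x → Sub e x × tr e x ≢ 0#
  tr≢0 e d 0<e de with ℕₚ.anyUpTo? (λ s → ¬? (tr e (1# ⊗ pow U.gen s) ≟ 0#)) U.N
    where module U = Units e d 0<e de
  ... | yes (s , _ , ne) = 1# ⊗ pow U.gen s , Sub-⊗ e (Sub-1 e) (Sub-pow e s U.gen-Sub) , ne
    where module U = Units e d 0<e de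
  ... | no none = ⊥-elim (1≢0 (tr-nondegenerate e 0<e U.N U.gen≢0 (proj₁ U.order-gen) U.p∤N distinct 1#
          (λ s s<N → decidable-stable (_ ≟ _) (λ ne → none (s , s<N , ne)))))
    where
    module U = Units e d 0<e de
    distinct : ∀ j → 0 < j → j < e → pow U.gen (p ^ j ∸ 1) ≢ 1#
    distinct j 0<j j<e q with p ^ j ∸ 1 in eq | proj₂ U.order-gen (p ^ j ∸ 1) q
    ... | zero | _ = ℕₚ.<⇒≱ (ℕₚ.^-monoʳ-< p (prime>1 pr) 0<j) (ℕₚ.m∸n≡0⇒m≤n eq)
    ... | suc k | N∣ = ℕₚ.<⇒≱ (ℕₚ.∸-monoˡ-< (ℕₚ.^-monoʳ-< p (prime>1 pr) j<e) (0<p^ j)) (subst (U.N ≤_) (sym eq) (∣⇒≤ N∣))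

  -- ε u = Σ ψ(a u) over a ∈ 𝔽_p^*, for any nontrivial additive character ψ of 𝔽_p.
  ε : Carrier → ℤ
  ε u = pos p *ᶻ 𝟙ᶻ (u ≟ 0#) +ᶻ -1ℤ

  private
    p≡p^1 : p ^ 1 ≡ p
    p≡p^1 = ℕₚ.*-identityʳ p
    module Fp = Units 1 E (s≤s z≤n) (ℕₚ.*-identityʳ E)

  ε-0 : ε 0# ≡ pos p +ᶻ -1ℤ
  ε-0 = cong (λ z → z +ᶻ -1ℤ) (trans (cong (pos p *ᶻ_) (ℤ∑.𝟙-yes (0# ≟ 0#) refl)) (ℤₚ.*-identityʳ (pos p)))

  ε-≢0 : ∀ {u} → u ≢ 0# → ε u ≡ -1ℤ
  ε-≢0 {u} u≢0 = cong (λ z → z +ᶻ -1ℤ) (trans (cong (pos p *ᶻ_) (ℤ∑.𝟙-no (u ≟ 0#) u≢0)) (ℤₚ.*-zeroʳ (pos p)))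

  -- a ↦ u + a v runs exactly once through 𝔽_p, where ε takes the value p - 1 once and -1 otherwise.
  ∑-ε-line : ∀ {u v} → Sub 1 u → Sub 1 v → v ≢ 0# → ∑ᶻ (sub 1) (λ a → ε (u ⊕ a ⊗ v)) ≡ 0ℤ
  ∑-ε-line {u} {v} su sv v≢0 = begin
    ∑ᶻ (sub 1) (λ a → ε (u ⊕ a ⊗ v))
      ≡⟨ ℤ∑.∑-⊕ (sub 1) _ _ ⟩
    ∑ᶻ (sub 1) (λ a → pos p *ᶻ 𝟙ᶻ ((u ⊕ a ⊗ v) ≟ 0#)) +ᶻ ∑ᶻ (sub 1) (λ _ → -1ℤ)
      ≡⟨ cong₂ _+ᶻ_ (trans (ℤ∑.∑-⊗ˡ (sub 1) (pos p) _) (cong (pos p *ᶻ_) one)) (Fp.∑-const-sub -1ℤ) ⟩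
    pos p *ᶻ 1ℤ +ᶻ pos (p ^ 1) *ᶻ -1ℤ
      ≡⟨ cong (λ z → pos p *ᶻ 1ℤ +ᶻ pos z *ᶻ -1ℤ) p≡p^1 ⟩
    pos p *ᶻ 1ℤ +ᶻ pos p *ᶻ -1ℤ
      ≡⟨ cancel (pos p) ⟩
    0ℤ ∎
    where
    open ≡-Reasoning
    cancel : ∀ a → a *ᶻ 1ℤ +ᶻ a *ᶻ -1ℤ ≡ 0ℤ
    cancel = solveℤ
    a₀ = ⊖ u ⊗ inv v
    a₀v : a₀ ⊗ v ≡ ⊖ u
    a₀v = trans (*-assoc _ _ _) (trans (cong (⊖ u ⊗_) (inv-l v≢0)) (*-identityʳ _))
    one : ∑ᶻ (sub 1) (λ a → 𝟙ᶻ ((u ⊕ a ⊗ v) ≟ 0#)) ≡ 1ℤ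
    one = trans (ℤ∑.∑-single (sub-unique 1) (∈sub⁺ {1} (Sub-⊗ 1 (Sub-⊖ 1 su) (Sub-inv 1 v≢0 sv))) (λ a → 𝟙ᶻ ((u ⊕ a ⊗ v) ≟ 0#))
        (λ a _ a≢ → ℤ∑.𝟙-no ((u ⊕ a ⊗ v) ≟ 0#) (λ q → a≢ (⊗-cancelˡ v≢0 (trans (*-comm v a) (trans (+-cancelˡ u _ _ (trans q (trans (sym (-‿inverseʳ u)) (cong (u ⊕_) (sym a₀v))))) (*-comm a₀ v)))))))
      (ℤ∑.𝟙-yes ((u ⊕ a₀ ⊗ v) ≟ 0#) (trans (cong (u ⊕_) a₀v) (-‿inverseʳ u)))

  -- Plays the role of ψ(u + v) = ψ(u) ψ(v) after averaging over the scalars.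
  ∑-ε-units : ∀ {u v} → Sub 1 u → Sub 1 v → ∑ᶻ Fp.units (λ a → ε (u ⊕ a ⊗ v)) ≡ ε u *ᶻ ε v
  ∑-ε-units {u} {v} su sv = by-cases (v ≟ 0#)
    where
    open ≡-Reasoning
    S₁ = ∑ᶻ Fp.units (λ a → ε (u ⊕ a ⊗ v))
    lem : ∀ x s → s ≡ (x +ᶻ s) +ᶻ x *ᶻ -1ℤ
    lem = solveℤ
    shift-pos : ∀ n → pos n ≡ pos (suc n) +ᶻ -1ℤ
    shift-pos n = refl
    by-cases : Dec (v ≡ 0#) → S₁ ≡ ε u *ᶻ ε v
    by-cases (yes refl) = begin
      ∑ᶻ Fp.units (λ a → ε (u ⊕ a ⊗ 0#))  ≡⟨ ℤ∑.∑-cong′ Fp.units (λ a → cong ε (trans (cong (u ⊕_) (zeroʳ a)) (+-identityʳ u))) ⟩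
      ∑ᶻ Fp.units (λ a → ε u)             ≡⟨ Fp.∑-const-units (ε u) ⟩
      pos Fp.N *ᶻ ε u                     ≡⟨ cong (_*ᶻ ε u) (shift-pos Fp.N) ⟩
      (pos (suc Fp.N) +ᶻ -1ℤ) *ᶻ ε u      ≡⟨ cong (λ z → (pos z +ᶻ -1ℤ) *ᶻ ε u) (trans Fp.suc-N p≡p^1) ⟩
      (pos p +ᶻ -1ℤ) *ᶻ ε u               ≡⟨ cong (_*ᶻ ε u) ε-0 ⟨
      ε 0# *ᶻ ε u                         ≡⟨ ℤₚ.*-comm (ε 0#) (ε u) ⟩
      ε u *ᶻ ε 0#                         ∎
    by-cases (no v≢0) = begin
      S₁                                   ≡⟨ lem (ε u) S₁ ⟩
      (ε u +ᶻ S₁) +ᶻ ε u *ᶻ -1ℤ            ≡⟨ cong (λ z → (z +ᶻ S₁) +ᶻ ε u *ᶻ -1ℤ) (cong ε (trans (cong (u ⊕_) (zeroˡ v)) (+-identityʳ u))) ⟨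
      (ε (u ⊕ 0# ⊗ v) +ᶻ S₁) +ᶻ ε u *ᶻ -1ℤ ≡⟨ cong (_+ᶻ ε u *ᶻ -1ℤ) (ℤ∑.∑-↭ Fp.sub-↭ (λ a → ε (u ⊕ a ⊗ v))) ⟨
      ∑ᶻ (sub 1) (λ a → ε (u ⊕ a ⊗ v)) +ᶻ ε u *ᶻ -1ℤ ≡⟨ cong (_+ᶻ ε u *ᶻ -1ℤ) (∑-ε-line su sv v≢0) ⟩
      0ℤ +ᶻ ε u *ᶻ -1ℤ                     ≡⟨ ℤₚ.+-identityˡ _ ⟩
      ε u *ᶻ -1ℤ                           ≡⟨ cong (ε u *ᶻ_) (ε-≢0 v≢0) ⟨
      ε u *ᶻ ε v                           ∎

  -- Orthogonality for a nonzero 𝔽_p-linear form. Some x₁ has φ x₁ = 1; translating the sum by a x₁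
  -- for every a ∈ 𝔽_p gives p copies of it, and these add up to sums of ε over full lines.
  balanced : ∀ e d → 0 < e → d * e ≡ E → (φ : Carrier → Carrier) →
    (∀ x y → φ (x ⊕ y) ≡ φ x ⊕ φ y) → (∀ {a} x → Sub 1 a → φ (a ⊗ x) ≡ a ⊗ φ x) →
    (∀ {x} → Sub e x → Sub 1 (φ x)) → ∀ {x₀} → Sub e x₀ → φ x₀ ≢ 0# → ∑ᶻ (sub e) (λ x → ε (φ x)) ≡ 0ℤ
  balanced e d 0<e de φ φ-⊕ φ-scale φ-Sub {x₀} sx₀ φx₀≢0 = ℤₚ.*-cancelˡ-≡ (pos p) _ _ {{ℤ-nz}} (begin
    pos p *ᶻ T                                           ≡⟨ cong (λ z → pos z *ᶻ T) p≡p^1 ⟨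
    pos (p ^ 1) *ᶻ T                                     ≡⟨ Fp.∑-const-sub T ⟨
    ∑ᶻ (sub 1) (λ _ → T)                                 ≡⟨ ℤ∑.∑-cong (sub 1) shifted ⟩
    ∑ᶻ (sub 1) (λ a → ∑ᶻ (sub e) (λ x → ε (φ x ⊕ a ⊗ 1#))) ≡⟨ ℤ∑.∑-swap (sub 1) (sub e) _ ⟩
    ∑ᶻ (sub e) (λ x → ∑ᶻ (sub 1) (λ a → ε (φ x ⊕ a ⊗ 1#))) ≡⟨ ℤ∑.∑-zero (sub e) (λ x x∈ → ∑-ε-line (φ-Sub (∈sub⁻ {e} x∈)) (Sub-1 1) 1≢0) ⟩
    0ℤ                                                   ≡⟨ ℤₚ.*-zeroʳ (pos p) ⟨
    pos p *ᶻ 0ℤ                                          ∎)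
    where
    open ≡-Reasoning
    ℤ-nz = p≢0
    T = ∑ᶻ (sub e) (λ x → ε (φ x))
    sφ = φ-Sub sx₀
    x₁ = inv (φ x₀) ⊗ x₀
    φx₁ : φ x₁ ≡ 1#
    φx₁ = trans (φ-scale x₀ (Sub-inv 1 φx₀≢0 sφ)) (inv-l φx₀≢0)
    sx₁ : Sub e x₁
    sx₁ = Sub-⊗ e (Sub₁⇒Sub e (Sub-inv 1 φx₀≢0 sφ)) sx₀
    shifted : ∀ a → a ∈ sub 1 → T ≡ ∑ᶻ (sub e) (λ x → ε (φ x ⊕ a ⊗ 1#))
    shifted a a∈ = trans (∑-translate e (Sub-⊗ e (Sub₁⇒Sub e sa) sx₁) (λ x → ε (φ x)))
        (ℤ∑.∑-cong′ (sub e) (λ x → cong ε (trans (φ-⊕ x (a ⊗ x₁)) (cong (φ x ⊕_) (trans (φ-scale x₁ sa) (cong (a ⊗_) φx₁))))))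
      where sa = ∈sub⁻ {1} a∈

  ∑-ε-tr : ∀ e d → 0 < e → d * e ≡ E → ∀ {v} → Sub e v → v ≢ 0# → ∑ᶻ (sub e) (λ x → ε (tr e (x ⊗ v))) ≡ 0ℤ
  ∑-ε-tr e d 0<e de {v} sv v≢0 with tr≢0 e d 0<e de
  ... | x₀ , sx₀ , ne = balanced e d 0<e de (λ x → tr e (x ⊗ v))
      (λ x y → trans (cong (tr e) (distribʳ v x y)) (tr-⊕ e _ _))
      (λ {a} x sa → trans (cong (tr e) (*-assoc a x v)) (tr-scale e (x ⊗ v) sa))
      (λ sx → tr-Sub₁ e (Sub-⊗ e sx sv))
      (Sub-⊗ e sx₀ (Sub-inv e v≢0 sv))
      (λ q → ne (trans (cong (tr e) (sym (trans (*-assoc x₀ (inv v) v) (trans (cong (x₀ ⊗_) (inv-l v≢0)) (*-identityʳ x₀))))) q))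

  -- For f invariant under 𝔽_p^* this is p - 1 times the sum of f(x) ψ(tr x): expand ε over the
  -- scalars and substitute x/a for x.
  E[_] : (e : ℕ) → (Carrier → ℤ) → ℤ
  E[ e ] f = ∑ᶻ (sub e) (λ x → f x *ᶻ ε (tr e x))

  -- Replacing y by a y, with a ∈ 𝔽_p^*, keeps f y and turns tr x + tr y into tr x + a tr y. Summing
  -- over the p - 1 scalars separates the variables by `∑-ε-units`.
  E-product : ∀ e (h f : Carrier → ℤ) → (∀ {a} x → a ≢ 0# → Sub 1 a → f (a ⊗ x) ≡ f x) →
    pos (p ∸ 1) *ᶻ ∑ᶻ (sub e) (λ x → ∑ᶻ (sub e) (λ y → (h x *ᶻ f y) *ᶻ ε (tr e (x ⊕ y)))) ≡ E[ e ] h *ᶻ E[ e ] f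
  E-product e h f f-inv = begin
    pos (p ∸ 1) *ᶻ D
      ≡⟨ cong (λ z → pos (z ∸ 1) *ᶻ D) p≡p^1 ⟨
    pos Fp.N *ᶻ D
      ≡⟨ Fp.∑-const-units D ⟨
    ∑ᶻ Fp.units (λ _ → D)
      ≡⟨ ℤ∑.∑-cong Fp.units (λ a a∈ → ℤ∑.∑-cong′ (sub e) (λ x → scaled a a∈ x)) ⟩
    ∑ᶻ Fp.units (λ a → ∑ᶻ (sub e) (λ x → ∑ᶻ (sub e) (λ y → (h x *ᶻ f y) *ᶻ ε (tr e x ⊕ a ⊗ tr e y))))
      ≡⟨ ℤ∑.∑-swap Fp.units (sub e) _ ⟩
    ∑ᶻ (sub e) (λ x → ∑ᶻ Fp.units (λ a → ∑ᶻ (sub e) (λ y → (h x *ᶻ f y) *ᶻ ε (tr e x ⊕ a ⊗ tr e y))))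
      ≡⟨ ℤ∑.∑-cong′ (sub e) (λ x → ℤ∑.∑-swap Fp.units (sub e) _) ⟩
    ∑ᶻ (sub e) (λ x → ∑ᶻ (sub e) (λ y → ∑ᶻ Fp.units (λ a → (h x *ᶻ f y) *ᶻ ε (tr e x ⊕ a ⊗ tr e y))))
      ≡⟨ ℤ∑.∑-cong (sub e) (λ x x∈ → ℤ∑.∑-cong (sub e) (λ y y∈ → trans (ℤ∑.∑-⊗ˡ Fp.units (h x *ᶻ f y) _)
           (trans (cong ((h x *ᶻ f y) *ᶻ_) (∑-ε-units (tr-Sub₁ e (∈sub⁻ {e} x∈)) (tr-Sub₁ e (∈sub⁻ {e} y∈))))
                  (interchange (h x) (f y) (ε (tr e x)) (ε (tr e y)))))) ⟩
    ∑ᶻ (sub e) (λ x → ∑ᶻ (sub e) (λ y → (h x *ᶻ ε (tr e x)) *ᶻ (f y *ᶻ ε (tr e y))))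
      ≡⟨ ℤ∑.∑-product (sub e) (sub e) _ _ ⟩
    E[ e ] h *ᶻ E[ e ] f ∎
    where
    open ≡-Reasoning
    D = ∑ᶻ (sub e) (λ x → ∑ᶻ (sub e) (λ y → (h x *ᶻ f y) *ᶻ ε (tr e (x ⊕ y))))
    interchange : ∀ a b c d → (a *ᶻ b) *ᶻ (c *ᶻ d) ≡ (a *ᶻ c) *ᶻ (b *ᶻ d)
    interchange = solveℤ
    scaled : ∀ a → a ∈ Fp.units → ∀ x → ∑ᶻ (sub e) (λ y → (h x *ᶻ f y) *ᶻ ε (tr e (x ⊕ y)))
                                        ≡ ∑ᶻ (sub e) (λ y → (h x *ᶻ f y) *ᶻ ε (tr e x ⊕ a ⊗ tr e y))
    scaled a a∈ x = trans (∑-scale e (Fp.units≢0 a∈) (Sub₁⇒Sub e sa) _)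
        (ℤ∑.∑-cong′ (sub e) (λ y → cong₂ (λ u v → (h x *ᶻ u) *ᶻ ε v) (f-inv y (Fp.units≢0 a∈) sa)
            (trans (tr-⊕ e x (a ⊗ y)) (cong (tr e x ⊕_) (tr-scale e y sa)))))
      where sa = Fp.units-Sub a∈

  convolution : ∀ e (H : Carrier → Carrier → ℤ) →
    ∑ᶻ (sub e) (λ x → ∑ᶻ (sub e) (λ y → H x y *ᶻ ε (tr e (x ⊕ y))))
      ≡ E[ e ] (λ z → ∑ᶻ (sub e) (λ x → H x (z ⊕ ⊖ x)))
  convolution e H = begin
    ∑ᶻ (sub e) (λ x → ∑ᶻ (sub e) (λ y → H x y *ᶻ ε (tr e (x ⊕ y))))
      ≡⟨ ℤ∑.∑-cong (sub e) (λ x x∈ → trans (∑-translate e (Sub-⊖ e (∈sub⁻ {e} x∈)) _)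
           (ℤ∑.∑-cong′ (sub e) (λ z → cong (λ w → H x (z ⊕ ⊖ x) *ᶻ ε (tr e w)) (x+[z-x] x z)))) ⟩
    ∑ᶻ (sub e) (λ x → ∑ᶻ (sub e) (λ z → H x (z ⊕ ⊖ x) *ᶻ ε (tr e z)))
      ≡⟨ ℤ∑.∑-swap (sub e) (sub e) _ ⟩
    ∑ᶻ (sub e) (λ z → ∑ᶻ (sub e) (λ x → H x (z ⊕ ⊖ x) *ᶻ ε (tr e z)))
      ≡⟨ ℤ∑.∑-cong′ (sub e) (λ z → ℤ∑.∑-⊗ʳ (sub e) (ε (tr e z)) _) ⟩
    E[ e ] (λ z → ∑ᶻ (sub e) (λ x → H x (z ⊕ ⊖ x))) ∎
    where
    open ≡-Reasoning
    x+[z-x] : ∀ x z → x ⊕ (z ⊕ ⊖ x) ≡ z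
    x+[z-x] x z = trans (+-comm x _) (trans (+-assoc z (⊖ x) x) (trans (cong (z ⊕_) (-‿inverseˡ x)) (+-identityʳ z)))

-- Divisibility of c by p - 1.

neg-self : ∀ {a} → a ≡ ⁻ a → a ≡ 0ℤ
neg-self {ℤ.+ zero}     _ = refl
neg-self {ℤ.+ suc n}    ()
neg-self {ℤ.-[1+ n ]}   ()

b-a≡⁻[a-b] : ∀ a b → b -ᶻ a ≡ ⁻ (a -ᶻ b)
b-a≡⁻[a-b] = solveℤ

-- Four consecutive powers of a number that is 1 modulo 4 add up to a multiple of 4; the sum is
-- consumed in such blocks.
4∣Ψ : ∀ d t → ∃ λ k → Ψ (4 * t) (4 * d + 1) ≡ 4 * k
4∣Ψ d zero = 0 , refl
4∣Ψ d (suc t) with 4∣Ψ d t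
... | k , e = s + p * (p * (p * (p * k))) , (begin
    Ψ (4 * suc t) p                                  ≡⟨ cong (λ n → Ψ n p) (ℕₚ.*-suc 4 t) ⟩
    Ψ (4 + 4 * t) p                                  ≡⟨ expand (4 * t) ⟩
    1 + p * (1 + p * (1 + p * (1 + p * Ψ (4 * t) p))) ≡⟨ cong (λ z → 1 + p * (1 + p * (1 + p * (1 + p * z)))) e ⟩
    1 + p * (1 + p * (1 + p * (1 + p * (4 * k))))    ≡⟨ lem d k ⟩
    4 * (s + p * (p * (p * (p * k))))                ∎)
  where
  open ≡-Reasoning
  p = 4 * d + 1
  -- A quarter of 1 + p + p² + p³ = (1 + p)(1 + p²) at p = 4d + 1.
  s = (2 * d + 1) * (1 + 4 * d + 8 * (d * d))
  expand : ∀ n → Ψ (4 + n) p ≡ 1 + p * (1 + p * (1 + p * (1 + p * Ψ n p)))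
  expand n = trans (Ψ-suc (3 + n) p) (cong (λ z → 1 + p * z) (trans (Ψ-suc (2 + n) p) (cong (λ z → 1 + p * z) (trans (Ψ-suc (1 + n) p) (cong (λ z → 1 + p * z) (Ψ-suc n p))))))
  lem : ∀ d k → 1 + (4 * d + 1) * (1 + (4 * d + 1) * (1 + (4 * d + 1) * (1 + (4 * d + 1) * (4 * k)))) ≡ 4 * ((2 * d + 1) * (1 + 4 * d + 8 * (d * d)) + (4 * d + 1) * ((4 * d + 1) * ((4 * d + 1) * ((4 * d + 1) * k))))
  lem = solve-∀

-- c = (q - 1)/4 is (p - 1) times a quarter of Ψ. As a consequence a^c = 1 for a ∈ 𝔽_p^*: the
-- scalars are fourth powers in 𝔽_q.
[p∸1]∣c : ∀ {p} d t c → p ≡ 4 * d + 1 → 4 * c + 1 ≡ p ^ (4 * t) → ∃ λ c′ → c ≡ c′ * (p ∸ 1)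
[p∸1]∣c {p} d t c refl c-eq with 4∣Ψ d t
... | k , e = k , ℕₚ.*-cancelˡ-≡ c _ 4 (begin
    4 * c                        ≡⟨ ℕₚ.m+n∸n≡m (4 * c) 1 ⟨
    4 * c + 1 ∸ 1                ≡⟨ cong (_∸ 1) c-eq ⟩
    p ^ (4 * t) ∸ 1              ≡⟨ Ψ-geometric-∸ (4 * t) p (subst (0 <_) (ℕₚ.+-comm 1 (4 * d)) (s≤s z≤n)) ⟨
    Ψ (4 * t) p * (p ∸ 1)        ≡⟨ cong (_* (p ∸ 1)) e ⟩
    4 * k * (p ∸ 1)              ≡⟨ ℕₚ.*-assoc 4 k (p ∸ 1) ⟩
    4 * (k * (p ∸ 1))            ∎)
  where open ≡-Reasoning

-- The quartic residue symbol x ↦ x^c on 𝔽_q.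

module Quartic (F : FiniteField) {p E : ℕ} (pr : Prime p) (card≡ : FiniteField.card F ≡ p ^ E)
               (ω : FiniteField.Carrier F) (ω-prim : FiniteField.IsPrimitive F ω)
               (t c d r : ℕ) (0<t : 0 < t) (p-eq : p ≡ 4 * d + 1)
               (c-eq : 4 * c + 1 ≡ p ^ (4 * t)) (E-eq : r * (4 * t) ≡ E) where

  open Trace F {p} {E} pr card≡ ω ω-prim public

  m : ℕ
  m = 4 * t

  K : List Carrier
  K = sub m

  0<m : 0 < m
  0<m = ℕₚ.≤-trans 0<t (ℕₚ.m≤m+n t (3 * t))

  module U = Units m r 0<m E-eq
  open U using (gen; gen≢0; gen-Sub)

  4c≡N : U.N ≡ 4 * c
  4c≡N = trans (cong (_∸ 1) (sym c-eq)) (ℕₚ.m+n∸n≡m (4 * c) 1)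

  0<c : 0 < c
  0<c = ℕₚ.n≢0⇒n>0 (λ { refl → ℕₚ.<⇒≢ U.0<N (sym 4c≡N) })

  0<kc : ∀ k → 0 < k → 0 < k * c
  0<kc (suc k) _ = ℕₚ.≤-trans 0<c (ℕₚ.m≤m+n c (k * c))

  order-gen : IsOrder gen (4 * c)
  order-gen = subst (IsOrder gen) 4c≡N U.order-gen

  c′ : ℕ
  c′ = proj₁ ([p∸1]∣c d t c p-eq c-eq)

  c≡c′[p∸1] : c ≡ c′ * (p ∸ 1)
  c≡c′[p∸1] = proj₂ ([p∸1]∣c d t c p-eq c-eq)

  p∸1≡4d : p ∸ 1 ≡ 4 * d
  p∸1≡4d = trans (cong (_∸ 1) p-eq) (ℕₚ.m+n∸n≡m (4 * d) 1)

  ⊖1^c : pow (⊖ 1#) c ≡ 1#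
  ⊖1^c = trans (cong (pow (⊖ 1#)) (trans c≡c′[p∸1] (trans (cong (c′ *_) p∸1≡4d) (lem c′ d)))) (pow-⊖1-even (2 * (c′ * d)))
    where
    lem : ∀ a b → a * (4 * b) ≡ 2 * (2 * (a * b))
    lem = solve-∀

  Fp-pow-c : ∀ {a} → a ≢ 0# → Sub 1 a → pow a c ≡ 1#
  Fp-pow-c {a} a≢0 s = begin
    pow a c                     ≡⟨ cong (pow a) (trans c≡c′[p∸1] (ℕₚ.*-comm c′ (p ∸ 1))) ⟩
    pow a ((p ∸ 1) * c′)        ≡⟨ pow-* a (p ∸ 1) c′ ⟩
    pow (pow a (p ∸ 1)) c′      ≡⟨ cong (λ z → pow z c′) (trans (cong (λ k → pow a (k ∸ 1)) (sym (ℕₚ.*-identityʳ p))) (Units.Sub⇒powN 1 E (s≤s z≤n) (ℕₚ.*-identityʳ E) a≢0 s)) ⟩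
    pow 1# c′                   ≡⟨ pow-1# c′ ⟩
    1#                          ∎
    where open ≡-Reasoning

  square-root : ∀ {x y} → x ⊗ x ≡ y ⊗ y → x ≡ y ⊎ x ≡ ⊖ y
  square-root {x} {y} e with zero-product {x ⊕ ⊖ y} {x ⊕ y} (begin
      (x ⊕ ⊖ y) ⊗ (x ⊕ y)                  ≡⟨ distribʳ (x ⊕ y) x (⊖ y) ⟩
      x ⊗ (x ⊕ y) ⊕ ⊖ y ⊗ (x ⊕ y)          ≡⟨ cong₂ _⊕_ (distribˡ x x y) (trans (sym (-‿distribˡ-* y (x ⊕ y))) (cong ⊖_ (distribˡ y x y))) ⟩
      (x ⊗ x ⊕ x ⊗ y) ⊕ ⊖ (y ⊗ x ⊕ y ⊗ y)  ≡⟨ cong₂ (λ a b → (a ⊕ x ⊗ y) ⊕ ⊖ (b ⊕ y ⊗ y)) e (*-comm y x) ⟩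
      (y ⊗ y ⊕ x ⊗ y) ⊕ ⊖ (x ⊗ y ⊕ y ⊗ y)  ≡⟨ cong (λ z → z ⊕ ⊖ (x ⊗ y ⊕ y ⊗ y)) (+-comm (y ⊗ y) (x ⊗ y)) ⟩
      (x ⊗ y ⊕ y ⊗ y) ⊕ ⊖ (x ⊗ y ⊕ y ⊗ y)  ≡⟨ -‿inverseʳ _ ⟩
      0#                                   ∎)
    where open ≡-Reasoning
  ... | inj₁ z = inj₁ (x-y≡0⇒x≡y x y z)
  ... | inj₂ z = inj₂ (x-y≡0⇒x≡y x (⊖ y) (trans (cong (x ⊕_) (-‿involutive y)) z))

  ⊖1⊗⊖1 : ⊖ 1# ⊗ ⊖ 1# ≡ 1#
  ⊖1⊗⊖1 = trans (sym (⊖≡⊖1⊗ (⊖ 1#))) (-‿involutive 1#)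

  gen^2c : pow gen (2 * c) ≡ ⊖ 1#
  gen^2c with square-root {pow gen (2 * c)} {1#} (trans (sym (pow-+ gen (2 * c) (2 * c))) (trans (cong (pow gen) (lem c)) (trans (proj₁ order-gen) (sym (*-identityˡ 1#)))))
    where
    lem : ∀ c → 2 * c + 2 * c ≡ 4 * c
    lem = solve-∀
  ... | inj₂ e = e
  ... | inj₁ e = ⊥-elim (ℕₚ.<⇒≱ (ℕₚ.*-monoˡ-< c {{>-nonZero 0<c}} {2} {4} (s≤s (s≤s (s≤s z≤n)))) (∣⇒≤ {{>-nonZero (0<kc 2 (s≤s z≤n))}} (proj₂ order-gen (2 * c) e)))

  1≢⊖1 : 1# ≢ ⊖ 1#
  1≢⊖1 e = ℕₚ.<⇒≱ (ℕₚ.*-monoˡ-< c {{>-nonZero 0<c}} {2} {4} (s≤s (s≤s (s≤s z≤n)))) (∣⇒≤ {{>-nonZero (0<kc 2 (s≤s z≤n))}} (proj₂ order-gen (2 * c) (trans gen^2c (sym e))))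

  -- A square root of -1 in 𝔽_q. The symbol x^c takes the values 0 and the powers of ι; sending ι to
  -- i makes it a complex character.
  ι : Carrier
  ι = pow gen c

  ι⊗ι : ι ⊗ ι ≡ ⊖ 1#
  ι⊗ι = trans (sym (pow-+ gen c c)) (trans (cong (λ k → pow gen (c + k)) (sym (ℕₚ.+-identityʳ c))) gen^2c)

  ⊖≢0 : ∀ {x} → x ≢ 0# → ⊖ x ≢ 0#
  ⊖≢0 {x} h e = h (trans (sym (-‿involutive x)) (trans (cong ⊖_ e) -0#≈0#))

  ι≢0 : ι ≢ 0#
  ι≢0 = pow≢0 c gen≢0

  ι⊗⊖ι : ι ⊗ ⊖ ι ≡ 1#
  ι⊗⊖ι = trans (sym (-‿distribʳ-* ι ι)) (trans (cong ⊖_ ι⊗ι) (-‿involutive 1#))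

  ι≢1 : ι ≢ 1#
  ι≢1 e = 1≢⊖1 (trans (sym (*-identityˡ 1#)) (trans (cong₂ _⊗_ (sym e) (sym e)) ι⊗ι))

  ι≢⊖1 : ι ≢ ⊖ 1#
  ι≢⊖1 e = 1≢⊖1 (trans (sym ⊖1⊗⊖1) (trans (cong₂ _⊗_ (sym e) (sym e)) ι⊗ι))

  ι≢⊖ι : ι ≢ ⊖ ι
  ι≢⊖ι e = 1≢⊖1 (trans (sym ι⊗⊖ι) (trans (cong (ι ⊗_) (sym e)) ι⊗ι))

  data Quart : Carrier → Set where
    q0  : Quart 0#
    q1  : Quart 1#
    qι  : Quart ι
    q-1 : Quart (⊖ 1#)
    q-ι : Quart (⊖ ι)

  quart : ∀ {x} → Sub m x → Quart (pow x c)
  quart {x} sx with x ≟ 0#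
  ... | yes refl = subst Quart (sym (pow-0# c 0<c)) q0
  ... | no x≢0 = from (square-root {z ⊗ z} {1#} (trans z⁴ (sym (*-identityˡ 1#))))
    where
    z = pow x c
    z⁴ : (z ⊗ z) ⊗ (z ⊗ z) ≡ 1#
    z⁴ = trans (cong₂ _⊗_ (sym (pow-+ x c c)) (sym (pow-+ x c c))) (trans (sym (pow-+ x (c + c) (c + c)))
           (trans (cong (pow x) (trans (lem c) (sym 4c≡N))) (U.Sub⇒powN x≢0 sx)))
      where
      lem : ∀ c → (c + c) + (c + c) ≡ 4 * c
      lem = solve-∀
    from : z ⊗ z ≡ 1# ⊎ z ⊗ z ≡ ⊖ 1# → Quart z
    from (inj₁ e) with square-root {z} {1#} (trans e (sym (*-identityˡ 1#)))
    ... | inj₁ e′ = subst Quart (sym e′) q1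
    ... | inj₂ e′ = subst Quart (sym e′) q-1
    from (inj₂ e) with square-root {z} {ι} (trans e (sym ι⊗ι))
    ... | inj₁ e′ = subst Quart (sym e′) qι
    ... | inj₂ e′ = subst Quart (sym e′) q-ι

  -- Gaussian-integer values as pairs of integers.

  R I nz : Carrier → ℤ
  R z = 𝟙ᶻ (z ≟ 1#) -ᶻ 𝟙ᶻ (z ≟ (⊖ 1#))
  I z = 𝟙ᶻ (z ≟ ι) -ᶻ 𝟙ᶻ (z ≟ (⊖ ι))
  nz z = 1ℤ -ᶻ 𝟙ᶻ (z ≟ 0#)

  private
    yes! : ∀ {x y} → x ≡ y → 𝟙ᶻ (x ≟ y) ≡ 1ℤ
    yes! {x} {y} = ℤ∑.𝟙-yes (x ≟ y)
    no! : ∀ {x y} → x ≢ y → 𝟙ᶻ (x ≟ y) ≡ 0ℤ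
    no! {x} {y} = ℤ∑.𝟙-no (x ≟ y)
    no˘ : ∀ {x y} → y ≢ x → 𝟙ᶻ (x ≟ y) ≡ 0ℤ
    no˘ h = no! (h ∘ sym)

  nz-0 : nz 0# ≡ 0ℤ
  nz-0 = cong (1ℤ -ᶻ_) (yes! refl)

  nz-≢0 : ∀ {z} → z ≢ 0# → nz z ≡ 1ℤ
  nz-≢0 h = cong (1ℤ -ᶻ_) (no! h)

  R-0 : R 0# ≡ 0ℤ
  R-0 = cong₂ _-ᶻ_ (no˘ 1≢0) (no˘ (⊖≢0 1≢0))
  I-0 : I 0# ≡ 0ℤ
  I-0 = cong₂ _-ᶻ_ (no˘ ι≢0) (no˘ (⊖≢0 ι≢0))
  R-1 : R 1# ≡ 1ℤ
  R-1 = cong₂ _-ᶻ_ (yes! refl) (no! 1≢⊖1)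
  I-1 : I 1# ≡ 0ℤ
  I-1 = cong₂ _-ᶻ_ (no˘ ι≢1) (no! (λ e → ι≢⊖1 (trans (sym (-‿involutive ι)) (cong ⊖_ (sym e)))))

  R-⊖ : ∀ z → R (⊖ z) ≡ ⁻ R z
  R-⊖ z = trans (cong₂ _-ᶻ_
      (ℤ∑.𝟙-cong ((⊖ z) ≟ 1#) (z ≟ (⊖ 1#)) (λ e → trans (sym (-‿involutive z)) (cong ⊖_ e)) (λ e → trans (cong ⊖_ e) (-‿involutive 1#)))
      (ℤ∑.𝟙-cong ((⊖ z) ≟ (⊖ 1#)) (z ≟ 1#) (⊖-injective) (cong ⊖_)))
    (b-a≡⁻[a-b] (𝟙ᶻ (z ≟ 1#)) (𝟙ᶻ (z ≟ (⊖ 1#))))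

  I-⊖ : ∀ z → I (⊖ z) ≡ ⁻ I z
  I-⊖ z = trans (cong₂ _-ᶻ_
      (ℤ∑.𝟙-cong ((⊖ z) ≟ ι) (z ≟ (⊖ ι)) (λ e → trans (sym (-‿involutive z)) (cong ⊖_ e)) (λ e → trans (cong ⊖_ e) (-‿involutive ι)))
      (ℤ∑.𝟙-cong ((⊖ z) ≟ (⊖ ι)) (z ≟ ι) (⊖-injective) (cong ⊖_)))
    (b-a≡⁻[a-b] (𝟙ᶻ (z ≟ ι)) (𝟙ᶻ (z ≟ (⊖ ι))))

  R-ι⊗ : ∀ z → R (ι ⊗ z) ≡ ⁻ I z
  R-ι⊗ z = trans (cong₂ _-ᶻ_
      (ℤ∑.𝟙-cong ((ι ⊗ z) ≟ 1#) (z ≟ (⊖ ι)) (λ e → ⊗-cancelˡ ι≢0 (trans e (sym ι⊗⊖ι))) (λ e → trans (cong (ι ⊗_) e) ι⊗⊖ι))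
      (ℤ∑.𝟙-cong ((ι ⊗ z) ≟ (⊖ 1#)) (z ≟ ι) (λ e → ⊗-cancelˡ ι≢0 (trans e (sym ι⊗ι))) (λ e → trans (cong (ι ⊗_) e) ι⊗ι)))
    (b-a≡⁻[a-b] (𝟙ᶻ (z ≟ ι)) (𝟙ᶻ (z ≟ (⊖ ι))))

  I-ι⊗ : ∀ z → I (ι ⊗ z) ≡ R z
  I-ι⊗ z = cong₂ _-ᶻ_
      (ℤ∑.𝟙-cong ((ι ⊗ z) ≟ ι) (z ≟ 1#) (λ e → ⊗-cancelˡ ι≢0 (trans e (sym (*-identityʳ ι)))) (λ e → trans (cong (ι ⊗_) e) (*-identityʳ ι)))
      (ℤ∑.𝟙-cong ((ι ⊗ z) ≟ (⊖ ι)) (z ≟ (⊖ 1#)) (λ e → ⊗-cancelˡ ι≢0 (trans e (sym ι⊖1))) (λ e → trans (cong (ι ⊗_) e) ι⊖1))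
    where
    ι⊖1 : ι ⊗ ⊖ 1# ≡ ⊖ ι
    ι⊖1 = trans (*-comm ι (⊖ 1#)) (sym (⊖≡⊖1⊗ ι))

  R-ι : R ι ≡ 0ℤ
  R-ι = trans (cong R (sym (*-identityʳ ι))) (trans (R-ι⊗ 1#) (cong ⁻_ I-1))
  I-ι : I ι ≡ 1ℤ
  I-ι = trans (cong I (sym (*-identityʳ ι))) (trans (I-ι⊗ 1#) R-1)
  R-⊖1 : R (⊖ 1#) ≡ -1ℤ
  R-⊖1 = trans (R-⊖ 1#) (cong ⁻_ R-1)
  I-⊖1 : I (⊖ 1#) ≡ 0ℤ
  I-⊖1 = trans (I-⊖ 1#) (cong ⁻_ I-1)
  R-⊖ι : R (⊖ ι) ≡ 0ℤ
  R-⊖ι = trans (R-⊖ ι) (cong ⁻_ R-ι)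
  I-⊖ι : I (⊖ ι) ≡ -1ℤ
  I-⊖ι = trans (I-⊖ ι) (cong ⁻_ I-ι)

  -- z ↦ R z + I z · i is the monoid homomorphism ι ↦ i, split into real and imaginary parts.
  module _ (z : Carrier) where
    private
      Rz = R z
      Iz = I z
      ⊖1⊗z : ⊖ 1# ⊗ z ≡ ⊖ z
      ⊖1⊗z = sym (⊖≡⊖1⊗ z)
      ⊖ι⊗z : ⊖ ι ⊗ z ≡ ⊖ (ι ⊗ z)
      ⊖ι⊗z = sym (-‿distribˡ-* ι z)
      c0 : ∀ a b → 0ℤ ≡ 0ℤ *ᶻ a -ᶻ 0ℤ *ᶻ b
      c0 = solveℤ
      c0′ : ∀ a b → 0ℤ ≡ 0ℤ *ᶻ a +ᶻ 0ℤ *ᶻ b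
      c0′ = solveℤ
      c1 : ∀ a b → a ≡ 1ℤ *ᶻ a -ᶻ 0ℤ *ᶻ b
      c1 = solveℤ
      c1′ : ∀ a b → a ≡ 1ℤ *ᶻ a +ᶻ 0ℤ *ᶻ b
      c1′ = solveℤ
      c2 : ∀ a b → ⁻ b ≡ 0ℤ *ᶻ a -ᶻ 1ℤ *ᶻ b
      c2 = solveℤ
      c2′ : ∀ a b → b ≡ 0ℤ *ᶻ a +ᶻ 1ℤ *ᶻ b
      c2′ = solveℤ
      c3 : ∀ a b → ⁻ a ≡ -1ℤ *ᶻ a -ᶻ 0ℤ *ᶻ b
      c3 = solveℤ
      c3′ : ∀ a b → ⁻ a ≡ -1ℤ *ᶻ a +ᶻ 0ℤ *ᶻ b
      c3′ = solveℤ
      c4 : ∀ a b → ⁻ (⁻ b) ≡ 0ℤ *ᶻ a -ᶻ -1ℤ *ᶻ b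
      c4 = solveℤ
      c4′ : ∀ a b → ⁻ b ≡ 0ℤ *ᶻ a +ᶻ -1ℤ *ᶻ b
      c4′ = solveℤ

    R-⊗ : ∀ {u} → Quart u → R (u ⊗ z) ≡ R u *ᶻ R z -ᶻ I u *ᶻ I z
    R-⊗ q0  = trans (cong R (zeroˡ z)) (trans R-0 (trans (c0 Rz Iz) (cong₂ (λ a b → a *ᶻ Rz -ᶻ b *ᶻ Iz) (sym R-0) (sym I-0))))
    R-⊗ q1  = trans (cong R (*-identityˡ z)) (trans (c1 Rz Iz) (cong₂ (λ a b → a *ᶻ Rz -ᶻ b *ᶻ Iz) (sym R-1) (sym I-1)))
    R-⊗ qι  = trans (R-ι⊗ z) (trans (c2 Rz Iz) (cong₂ (λ a b → a *ᶻ Rz -ᶻ b *ᶻ Iz) (sym R-ι) (sym I-ι)))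
    R-⊗ q-1 = trans (cong R ⊖1⊗z) (trans (R-⊖ z) (trans (c3 Rz Iz) (cong₂ (λ a b → a *ᶻ Rz -ᶻ b *ᶻ Iz) (sym R-⊖1) (sym I-⊖1))))
    R-⊗ q-ι = trans (cong R ⊖ι⊗z) (trans (R-⊖ (ι ⊗ z)) (trans (cong ⁻_ (R-ι⊗ z)) (trans (c4 Rz Iz) (cong₂ (λ a b → a *ᶻ Rz -ᶻ b *ᶻ Iz) (sym R-⊖ι) (sym I-⊖ι)))))

    I-⊗ : ∀ {u} → Quart u → I (u ⊗ z) ≡ R u *ᶻ I z +ᶻ I u *ᶻ R z
    I-⊗ q0  = trans (cong I (zeroˡ z)) (trans I-0 (trans (c0′ Iz Rz) (cong₂ (λ a b → a *ᶻ Iz +ᶻ b *ᶻ Rz) (sym R-0) (sym I-0))))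
    I-⊗ q1  = trans (cong I (*-identityˡ z)) (trans (c1′ Iz Rz) (cong₂ (λ a b → a *ᶻ Iz +ᶻ b *ᶻ Rz) (sym R-1) (sym I-1)))
    I-⊗ qι  = trans (I-ι⊗ z) (trans (c2′ Iz Rz) (cong₂ (λ a b → a *ᶻ Iz +ᶻ b *ᶻ Rz) (sym R-ι) (sym I-ι)))
    I-⊗ q-1 = trans (cong I ⊖1⊗z) (trans (I-⊖ z) (trans (c3′ Iz Rz) (cong₂ (λ a b → a *ᶻ Iz +ᶻ b *ᶻ Rz) (sym R-⊖1) (sym I-⊖1))))
    I-⊗ q-ι = trans (cong I ⊖ι⊗z) (trans (I-⊖ (ι ⊗ z)) (trans (cong ⁻_ (I-ι⊗ z)) (trans (c4′ Iz Rz) (cong₂ (λ a b → a *ᶻ Iz +ᶻ b *ᶻ Rz) (sym R-⊖ι) (sym I-⊖ι)))))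

  -- χR + χI i is a quartic character of 𝔽_q extended by 0, and ρ is its square, the quadratic
  -- character; on 𝔽_q its argument x^(2c) is 0 or ±1, so `R` alone describes it.
  χR χI ρ : Carrier → ℤ
  χR x = R (pow x c)
  χI x = I (pow x c)
  ρ x = R (pow x (2 * c))

  pow-2c : ∀ x → pow x (2 * c) ≡ pow x c ⊗ pow x c
  pow-2c x = trans (cong (λ k → pow x (c + k)) (ℕₚ.+-identityʳ c)) (pow-+ x c c)

  I-square : ∀ {z} → Quart z → I (z ⊗ z) ≡ 0ℤ
  I-square {z} q = trans (I-⊗ z q) (lem q)
    where
    two : ∀ a b → b ≡ 0ℤ ⊎ a ≡ 0ℤ → a *ᶻ b +ᶻ b *ᶻ a ≡ 0ℤ
    two a _ (inj₁ refl) = z₁ a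
      where
      z₁ : ∀ a → a *ᶻ 0ℤ +ᶻ 0ℤ *ᶻ a ≡ 0ℤ
      z₁ = solveℤ
    two _ b (inj₂ refl) = z₂ b
      where
      z₂ : ∀ b → 0ℤ *ᶻ b +ᶻ b *ᶻ 0ℤ ≡ 0ℤ
      z₂ = solveℤ
    lem : ∀ {z} → Quart z → R z *ᶻ I z +ᶻ I z *ᶻ R z ≡ 0ℤ
    lem q0  = two (R 0#) (I 0#) (inj₁ I-0)
    lem q1  = two (R 1#) (I 1#) (inj₁ I-1)
    lem qι  = two (R ι) (I ι) (inj₂ R-ι)
    lem q-1 = two (R (⊖ 1#)) (I (⊖ 1#)) (inj₁ I-⊖1)
    lem q-ι = two (R (⊖ ι)) (I (⊖ ι)) (inj₂ R-⊖ι)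

  R²+I² : ∀ {z} → Quart z → R z *ᶻ R z +ᶻ I z *ᶻ I z ≡ nz z
  R²+I² q0  = trans (cong₂ (λ a b → a *ᶻ a +ᶻ b *ᶻ b) R-0 I-0) (sym nz-0)
  R²+I² q1  = trans (cong₂ (λ a b → a *ᶻ a +ᶻ b *ᶻ b) R-1 I-1) (sym (nz-≢0 1≢0))
  R²+I² qι  = trans (cong₂ (λ a b → a *ᶻ a +ᶻ b *ᶻ b) R-ι I-ι) (sym (nz-≢0 ι≢0))
  R²+I² q-1 = trans (cong₂ (λ a b → a *ᶻ a +ᶻ b *ᶻ b) R-⊖1 I-⊖1) (sym (nz-≢0 (⊖≢0 1≢0)))
  R²+I² q-ι = trans (cong₂ (λ a b → a *ᶻ a +ᶻ b *ᶻ b) R-⊖ι I-⊖ι) (sym (nz-≢0 (⊖≢0 ι≢0)))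

  -- Substituting gen · x multiplies the character by i. Comparing imaginary parts gives this
  -- equality, comparing real parts gives the opposite sign in `∑χR≡0`, and so both sums vanish.
  ∑χI≡∑χR : ∑ᶻ K χI ≡ ∑ᶻ K χR
  ∑χI≡∑χR = trans (∑-scale m gen≢0 gen-Sub χI) (ℤ∑.∑-cong′ K (λ x → trans (cong I (pow-⊗ gen x c)) (I-ι⊗ (pow x c))))

  ∑-⁻ : (f : Carrier → ℤ) → ∑ᶻ K (λ x → ⁻ f x) ≡ ⁻ ∑ᶻ K f
  ∑-⁻ f = trans (ℤ∑.∑-cong′ K (λ x → sym (ℤₚ.-1*i≡-i (f x)))) (trans (ℤ∑.∑-⊗ˡ K -1ℤ f) (ℤₚ.-1*i≡-i _))

  ∑χR≡0 : ∑ᶻ K χR ≡ 0ℤ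
  ∑χR≡0 = neg-self (trans (∑-scale m gen≢0 gen-Sub χR)
    (trans (ℤ∑.∑-cong′ K (λ x → trans (cong R (pow-⊗ gen x c)) (R-ι⊗ (pow x c)))) (trans (∑-⁻ χI) (cong ⁻_ ∑χI≡∑χR))))

  ∑χI≡0 : ∑ᶻ K χI ≡ 0ℤ
  ∑χI≡0 = trans ∑χI≡∑χR ∑χR≡0

  ∑ρ≡0 : ∑ᶻ K ρ ≡ 0ℤ
  ∑ρ≡0 = neg-self (trans (∑-scale m gen≢0 gen-Sub ρ)
    (trans (ℤ∑.∑-cong′ K (λ x → trans (cong R (trans (pow-⊗ gen x (2 * c)) (trans (cong (_⊗ pow x (2 * c)) gen^2c) (sym (⊖≡⊖1⊗ _))))) (R-⊖ _))) (∑-⁻ ρ)))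

  ∑ε≡0 : ∑ᶻ K (λ x → ε (tr m x)) ≡ 0ℤ
  ∑ε≡0 = trans (ℤ∑.∑-cong′ K (λ x → cong (ε ∘ tr m) (sym (*-identityʳ x)))) (∑-ε-tr m r 0<m E-eq (Sub-1 m) 1≢0)

  ∑-𝟙0 : (f : Carrier → ℤ) → ∑ᶻ K (λ x → 𝟙ᶻ (x ≟ 0#) *ᶻ f x) ≡ f 0#
  ∑-𝟙0 f = trans (ℤ∑.∑-single (sub-unique m) (∈sub⁺ {m} (Sub-0 m)) (λ x → 𝟙ᶻ (x ≟ 0#) *ᶻ f x)
      (λ x _ x≢0 → trans (cong (_*ᶻ f x) (ℤ∑.𝟙-no (x ≟ 0#) x≢0)) (ℤₚ.*-zeroˡ (f x))))
    (trans (cong (_*ᶻ f 0#) (ℤ∑.𝟙-yes (0# ≟ 0#) refl)) (ℤₚ.*-identityˡ (f 0#)))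

  nz-pow : ∀ x → nz (pow x c) ≡ nz x
  nz-pow x = cong (1ℤ -ᶻ_) (ℤ∑.𝟙-cong (pow x c ≟ 0#) (x ≟ 0#) (λ e → decidable-stable (x ≟ 0#) (λ ne → pow≢0 c ne e)) (λ { refl → pow-0# c 0<c }))

  ∑nz : ∑ᶻ K nz ≡ pos (p ^ m) -ᶻ 1ℤ
  ∑nz = begin
    ∑ᶻ K (λ z → 1ℤ +ᶻ ⁻ 𝟙ᶻ (z ≟ 0#))                  ≡⟨ ℤ∑.∑-⊕ K (λ _ → 1ℤ) _ ⟩
    ∑ᶻ K (λ _ → 1ℤ) +ᶻ ∑ᶻ K (λ z → ⁻ 𝟙ᶻ (z ≟ 0#))     ≡⟨ cong₂ _+ᶻ_ (trans (U.∑-const-sub 1ℤ) (ℤₚ.*-identityʳ (pos (p ^ m)))) (∑-⁻ (λ z → 𝟙ᶻ (z ≟ 0#))) ⟩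
    pos (p ^ m) +ᶻ ⁻ ∑ᶻ K (λ z → 𝟙ᶻ (z ≟ 0#))         ≡⟨ cong (λ z → pos (p ^ m) +ᶻ ⁻ z) (trans (ℤ∑.∑-cong′ K (λ z → sym (ℤₚ.*-identityʳ _))) (∑-𝟙0 (λ _ → 1ℤ))) ⟩
    pos (p ^ m) -ᶻ 1ℤ                                 ∎
    where open ≡-Reasoning

  p-1 : ℤ
  p-1 = pos p +ᶻ -1ℤ

  pos-p∸1 : pos (p ∸ 1) ≡ p-1
  pos-p∸1 = trans (shift-pos (p ∸ 1)) (cong (λ z → pos z +ᶻ -1ℤ) (ℕₚ.m+[n∸m]≡n (ℕₚ.<⇒≤ (prime>1 pr))))
    where
    shift-pos : ∀ n → pos n ≡ pos (suc n) +ᶻ -1ℤ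
    shift-pos n = refl

  E-nz : E[ m ] nz ≡ ⁻ p-1
  E-nz = begin
    ∑ᶻ K (λ x → (1ℤ -ᶻ 𝟙ᶻ (x ≟ 0#)) *ᶻ ε (tr m x))
      ≡⟨ ℤ∑.∑-cong′ K (λ x → lem (𝟙ᶻ (x ≟ 0#)) (ε (tr m x))) ⟩
    ∑ᶻ K (λ x → ε (tr m x) +ᶻ ⁻ (𝟙ᶻ (x ≟ 0#) *ᶻ ε (tr m x)))
      ≡⟨ ℤ∑.∑-⊕ K _ _ ⟩
    ∑ᶻ K (λ x → ε (tr m x)) +ᶻ ∑ᶻ K (λ x → ⁻ (𝟙ᶻ (x ≟ 0#) *ᶻ ε (tr m x)))
      ≡⟨ cong₂ _+ᶻ_ ∑ε≡0 (trans (∑-⁻ _) (cong ⁻_ (trans (∑-𝟙0 (λ x → ε (tr m x))) (trans (cong ε (tr-0 m)) ε-0)))) ⟩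
    0ℤ +ᶻ ⁻ p-1
      ≡⟨ ℤₚ.+-identityˡ _ ⟩
    ⁻ p-1 ∎
    where
    open ≡-Reasoning
    lem : ∀ a b → (1ℤ -ᶻ a) *ᶻ b ≡ b +ᶻ ⁻ (a *ᶻ b)
    lem = solveℤ

  -- Gauss sums: the norm and the square.

  ER EI Eρ : ℤ
  ER = E[ m ] χR
  EI = E[ m ] χI
  Eρ = E[ m ] ρ

  χR-inv : ∀ {a} x → a ≢ 0# → Sub 1 a → χR (a ⊗ x) ≡ χR x
  χR-inv {a} x a≢0 sa = cong R (trans (pow-⊗ a x c) (trans (cong (_⊗ pow x c) (Fp-pow-c a≢0 sa)) (*-identityˡ _)))

  χI-inv : ∀ {a} x → a ≢ 0# → Sub 1 a → χI (a ⊗ x) ≡ χI x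
  χI-inv {a} x a≢0 sa = cong I (trans (pow-⊗ a x c) (trans (cong (_⊗ pow x c) (Fp-pow-c a≢0 sa)) (*-identityˡ _)))

  χR-⊗ : ∀ {x} → Sub m x → ∀ y → χR (x ⊗ y) ≡ χR x *ᶻ χR y -ᶻ χI x *ᶻ χI y
  χR-⊗ {x} sx y = trans (cong R (pow-⊗ x y c)) (R-⊗ (pow y c) (quart sx))

  χI-⊗ : ∀ {x} → Sub m x → ∀ y → χI (x ⊗ y) ≡ χR x *ᶻ χI y +ᶻ χI x *ᶻ χR y
  χI-⊗ {x} sx y = trans (cong I (pow-⊗ x y c)) (I-⊗ (pow y c) (quart sx))

  pow-⊖c : ∀ x → pow (⊖ x) c ≡ pow x c
  pow-⊖c x = trans (cong (λ z → pow z c) (⊖≡⊖1⊗ x)) (trans (pow-⊗ (⊖ 1#) x c) (trans (cong (_⊗ pow x c) ⊖1^c) (*-identityˡ _)))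

  z-zx : ∀ z x → z ⊕ ⊖ (z ⊗ x) ≡ z ⊗ (1# ⊕ ⊖ x)
  z-zx z x = sym (trans (distribˡ z 1# (⊖ x)) (cong₂ _⊕_ (*-identityʳ z) (sym (-‿distribʳ-* z x))))

  -- Evaluated in two ways: `double-product` separates the variables and finds products of Gauss
  -- sums, `convolution` collects the pairs with x + y = z.
  double : (Carrier → Carrier → ℤ) → ℤ
  double H = ∑ᶻ K (λ x → ∑ᶻ K (λ y → H x y *ᶻ ε (tr m (x ⊕ y))))

  double-linear : ∀ (s : ℤ) (H H′ : Carrier → Carrier → ℤ) →
                  double (λ x y → H x y +ᶻ s *ᶻ H′ x y) ≡ double H +ᶻ s *ᶻ double H′
  double-linear s H H′ = begin
    double (λ x y → H x y +ᶻ s *ᶻ H′ x y)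
      ≡⟨ ℤ∑.∑-cong′ K (λ x → trans (ℤ∑.∑-cong′ K (λ y → lem (H x y) (H′ x y) s _)) (trans (ℤ∑.∑-⊕ K _ _) (cong (∑ᶻ K (λ y → H x y *ᶻ ε (tr m (x ⊕ y))) +ᶻ_) (ℤ∑.∑-⊗ˡ K s _)))) ⟩
    ∑ᶻ K (λ x → ∑ᶻ K (λ y → H x y *ᶻ ε (tr m (x ⊕ y))) +ᶻ s *ᶻ ∑ᶻ K (λ y → H′ x y *ᶻ ε (tr m (x ⊕ y))))
      ≡⟨ ℤ∑.∑-⊕ K _ _ ⟩
    double H +ᶻ ∑ᶻ K (λ x → s *ᶻ ∑ᶻ K (λ y → H′ x y *ᶻ ε (tr m (x ⊕ y))))
      ≡⟨ cong (double H +ᶻ_) (ℤ∑.∑-⊗ˡ K s _) ⟩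
    double H +ᶻ s *ᶻ double H′ ∎
    where
    open ≡-Reasoning
    lem : ∀ a b s e → (a +ᶻ s *ᶻ b) *ᶻ e ≡ a *ᶻ e +ᶻ s *ᶻ (b *ᶻ e)
    lem = solveℤ

  -- The sign `s` lets one statement serve for the norm (s = 1), the real part of the square (s =
  -- -1) and its imaginary part (s = 1 with the parts crossed).
  double-product : ∀ (s : ℤ) (f g h k : Carrier → ℤ) →
    (∀ {a} x → a ≢ 0# → Sub 1 a → g (a ⊗ x) ≡ g x) → (∀ {a} x → a ≢ 0# → Sub 1 a → k (a ⊗ x) ≡ k x) →
    p-1 *ᶻ double (λ x y → f x *ᶻ g y +ᶻ s *ᶻ (h x *ᶻ k y)) ≡ E[ m ] f *ᶻ E[ m ] g +ᶻ s *ᶻ (E[ m ] h *ᶻ E[ m ] k)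
  double-product s f g h k gi ki = begin
    p-1 *ᶻ double (λ x y → f x *ᶻ g y +ᶻ s *ᶻ (h x *ᶻ k y))
      ≡⟨ cong (p-1 *ᶻ_) (double-linear s (λ x y → f x *ᶻ g y) (λ x y → h x *ᶻ k y)) ⟩
    p-1 *ᶻ (double (λ x y → f x *ᶻ g y) +ᶻ s *ᶻ double (λ x y → h x *ᶻ k y))
      ≡⟨ lem p-1 (double (λ x y → f x *ᶻ g y)) s (double (λ x y → h x *ᶻ k y)) ⟩
    p-1 *ᶻ double (λ x y → f x *ᶻ g y) +ᶻ s *ᶻ (p-1 *ᶻ double (λ x y → h x *ᶻ k y))
      ≡⟨ cong₂ (λ a b → a +ᶻ s *ᶻ b) (trans (cong (_*ᶻ double (λ x y → f x *ᶻ g y)) (sym pos-p∸1)) (E-product m f g gi))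
                                     (trans (cong (_*ᶻ double (λ x y → h x *ᶻ k y)) (sym pos-p∸1)) (E-product m h k ki)) ⟩
    E[ m ] f *ᶻ E[ m ] g +ᶻ s *ᶻ (E[ m ] h *ᶻ E[ m ] k) ∎
    where
    open ≡-Reasoning
    lem : ∀ P a s b → P *ᶻ (a +ᶻ s *ᶻ b) ≡ P *ᶻ a +ᶻ s *ᶻ (P *ᶻ b)
    lem = solveℤ

  private
    -- The real part of χ(x) times the conjugate of χ(y). The factor 1 only matches the shape of
    -- `double-product`.
    H : Carrier → Carrier → ℤ
    H x y = χR x *ᶻ χR y +ᶻ 1ℤ *ᶻ (χI x *ᶻ χI y)

    H-scale : ∀ {z} → z ≢ 0# → Sub m z → ∀ x y → H (z ⊗ x) (z ⊗ y) ≡ H x y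
    H-scale {z} z≢0 sz x y = begin
      H (z ⊗ x) (z ⊗ y)
        ≡⟨ cong₂ _+ᶻ_ (cong₂ _*ᶻ_ (χR-⊗ sz x) (χR-⊗ sz y)) (cong (1ℤ *ᶻ_) (cong₂ _*ᶻ_ (χI-⊗ sz x) (χI-⊗ sz y))) ⟩
      _ ≡⟨ lem (χR z) (χI z) (χR x) (χI x) (χR y) (χI y) ⟩
      (χR z *ᶻ χR z +ᶻ χI z *ᶻ χI z) *ᶻ H x y
        ≡⟨ cong (_*ᶻ H x y) (trans (R²+I² (quart sz)) (nz-≢0 (pow≢0 c z≢0))) ⟩
      1ℤ *ᶻ H x y ≡⟨ ℤₚ.*-identityˡ _ ⟩
      H x y ∎
      where
      open ≡-Reasoning
      lem : ∀ a b x x′ y y′ → (a *ᶻ x -ᶻ b *ᶻ x′) *ᶻ (a *ᶻ y -ᶻ b *ᶻ y′) +ᶻ 1ℤ *ᶻ ((a *ᶻ x′ +ᶻ b *ᶻ x) *ᶻ (a *ᶻ y′ +ᶻ b *ᶻ y))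
                            ≡ (a *ᶻ a +ᶻ b *ᶻ b) *ᶻ (x *ᶻ y +ᶻ 1ℤ *ᶻ (x′ *ᶻ y′))
      lem = solveℤ

    conv : Carrier → ℤ
    conv z = ∑ᶻ K (λ x → H x (z ⊕ ⊖ x))

    conv-0 : conv 0# ≡ pos (p ^ m) -ᶻ 1ℤ
    conv-0 = trans (ℤ∑.∑-cong K (λ x x∈ → trans (cong₂ (λ a b → χR x *ᶻ R a +ᶻ 1ℤ *ᶻ (χI x *ᶻ I b)) (step x) (step x)) (trans (lem (χR x) (χI x)) (trans (R²+I² (quart (∈sub⁻ {m} x∈))) (nz-pow x)))))
        ∑nz
      where
      step : ∀ x → pow (0# ⊕ ⊖ x) c ≡ pow x c
      step x = trans (cong (λ z → pow z c) (+-identityˡ _)) (pow-⊖c x)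
      lem : ∀ a b → a *ᶻ a +ᶻ 1ℤ *ᶻ (b *ᶻ b) ≡ a *ᶻ a +ᶻ b *ᶻ b
      lem = solveℤ

    conv-≢0 : ∀ {z} → z ≢ 0# → Sub m z → conv z ≡ conv 1#
    conv-≢0 {z} z≢0 sz = trans (∑-scale m z≢0 sz (λ x → H x (z ⊕ ⊖ x)))
      (ℤ∑.∑-cong′ K (λ x → trans (cong (H (z ⊗ x)) (z-zx z x)) (H-scale z≢0 sz x _)))

    conv≡ : ∀ {z} → Sub m z → conv z ≡ conv 1# *ᶻ nz z +ᶻ (pos (p ^ m) -ᶻ 1ℤ) *ᶻ 𝟙ᶻ (z ≟ 0#)
    conv≡ {z} sz = by-cases (z ≟ 0#)
      where
      k = pos (p ^ m) -ᶻ 1ℤ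
      l1 : ∀ C k → k ≡ C *ᶻ 0ℤ +ᶻ k *ᶻ 1ℤ
      l1 = solveℤ
      l2 : ∀ C k → C ≡ C *ᶻ 1ℤ +ᶻ k *ᶻ 0ℤ
      l2 = solveℤ
      by-cases : Dec (z ≡ 0#) → conv z ≡ conv 1# *ᶻ nz z +ᶻ k *ᶻ 𝟙ᶻ (z ≟ 0#)
      by-cases (yes refl) = trans conv-0 (trans (l1 (conv 1#) k) (cong₂ (λ a b → conv 1# *ᶻ a +ᶻ k *ᶻ b) (sym nz-0) (sym (ℤ∑.𝟙-yes (0# ≟ 0#) refl))))
      by-cases (no ne) = trans (conv-≢0 ne sz) (trans (l2 (conv 1#) k) (cong₂ (λ a b → conv 1# *ᶻ a +ᶻ k *ᶻ b) (sym (nz-≢0 ne)) (sym (ℤ∑.𝟙-no (z ≟ 0#) ne))))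

    ∑conv : ∑ᶻ K conv ≡ 0ℤ
    ∑conv = begin
      ∑ᶻ K (λ z → ∑ᶻ K (λ x → H x (z ⊕ ⊖ x)))  ≡⟨ ℤ∑.∑-swap K K _ ⟩
      ∑ᶻ K (λ x → ∑ᶻ K (λ z → H x (z ⊕ ⊖ x)))  ≡⟨ ℤ∑.∑-cong K (λ x x∈ → ∑-translate m (Sub-⊖ m (∈sub⁻ {m} x∈)) (H x)) ⟨
      ∑ᶻ K (λ x → ∑ᶻ K (λ y → H x y))          ≡⟨ ℤ∑.∑-cong′ K (λ x → trans (ℤ∑.∑-⊕ K _ _) (cong₂ _+ᶻ_ (ℤ∑.∑-⊗ˡ K (χR x) χR) (trans (ℤ∑.∑-⊗ˡ K 1ℤ _) (cong (1ℤ *ᶻ_) (ℤ∑.∑-⊗ˡ K (χI x) χI))))) ⟩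
      ∑ᶻ K (λ x → χR x *ᶻ ∑ᶻ K χR +ᶻ 1ℤ *ᶻ (χI x *ᶻ ∑ᶻ K χI)) ≡⟨ ℤ∑.∑-zero K (λ x _ → trans (cong₂ (λ a b → χR x *ᶻ a +ᶻ 1ℤ *ᶻ (χI x *ᶻ b)) ∑χR≡0 ∑χI≡0) (lem (χR x) (χI x))) ⟩
      0ℤ ∎
      where
      open ≡-Reasoning
      lem : ∀ a b → a *ᶻ 0ℤ +ᶻ 1ℤ *ᶻ (b *ᶻ 0ℤ) ≡ 0ℤ
      lem = solveℤ

    q-1≡N : pos (p ^ m) -ᶻ 1ℤ ≡ pos U.N
    q-1≡N = cong (λ z → pos z -ᶻ 1ℤ) (sym U.suc-N)

    -- `conv` is q - 1 at 0 and constant on 𝔽_q^*, and its total vanishes because the character sums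
    -- to 0. So (q - 1) + (q - 1) conv(1) = 0.
    conv-1 : conv 1# ≡ -1ℤ
    conv-1 = ℤₚ.*-cancelʳ-≡ (conv 1#) -1ℤ (pos U.N) {{>-nonZero U.0<N}} (begin
      conv 1# *ᶻ pos U.N                                       ≡⟨ lem (conv 1#) (pos U.N) ⟩
      (conv 1# *ᶻ pos U.N +ᶻ pos U.N *ᶻ 1ℤ) -ᶻ pos U.N         ≡⟨ cong (_-ᶻ pos U.N) ∑conv≡ ⟨
      ∑ᶻ K conv -ᶻ pos U.N                                     ≡⟨ cong (_-ᶻ pos U.N) ∑conv ⟩
      0ℤ -ᶻ pos U.N                                            ≡⟨ lem′ (pos U.N) ⟩
      -1ℤ *ᶻ pos U.N                                           ∎)
      where
      open ≡-Reasoning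
      lem : ∀ C n → C *ᶻ n ≡ (C *ᶻ n +ᶻ n *ᶻ 1ℤ) -ᶻ n
      lem = solveℤ
      lem′ : ∀ n → 0ℤ -ᶻ n ≡ -1ℤ *ᶻ n
      lem′ = solveℤ
      ∑conv≡ : ∑ᶻ K conv ≡ conv 1# *ᶻ pos U.N +ᶻ pos U.N *ᶻ 1ℤ
      ∑conv≡ = begin
        ∑ᶻ K conv
          ≡⟨ ℤ∑.∑-cong K (λ z z∈ → conv≡ (∈sub⁻ {m} z∈)) ⟩
        ∑ᶻ K (λ z → conv 1# *ᶻ nz z +ᶻ (pos (p ^ m) -ᶻ 1ℤ) *ᶻ 𝟙ᶻ (z ≟ 0#))
          ≡⟨ trans (ℤ∑.∑-⊕ K _ _) (cong₂ _+ᶻ_ (trans (ℤ∑.∑-⊗ˡ K (conv 1#) nz) (cong (conv 1# *ᶻ_) (trans ∑nz q-1≡N)))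
               (trans (ℤ∑.∑-⊗ˡ K (pos (p ^ m) -ᶻ 1ℤ) _) (cong₂ _*ᶻ_ q-1≡N (trans (ℤ∑.∑-cong′ K (λ z → sym (ℤₚ.*-identityʳ _))) (∑-𝟙0 (λ _ → 1ℤ)))))) ⟩
        conv 1# *ᶻ pos U.N +ᶻ pos U.N *ᶻ 1ℤ ∎

  -- On 𝔽_q, `conv` equals q · [z = 0] - 1. The constant is annihilated by ε, and the point 0
  -- contributes q · ε 0 = q (p - 1). The second factor p - 1 is that of `double-product`.
  E-norm : ER *ᶻ ER +ᶻ EI *ᶻ EI ≡ pos (p ^ m) *ᶻ (p-1 *ᶻ p-1)
  E-norm = begin
    ER *ᶻ ER +ᶻ EI *ᶻ EI
      ≡⟨ cong (ER *ᶻ ER +ᶻ_) (ℤₚ.*-identityˡ (EI *ᶻ EI)) ⟨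
    ER *ᶻ ER +ᶻ 1ℤ *ᶻ (EI *ᶻ EI)
      ≡⟨ double-product 1ℤ χR χR χI χI χR-inv χI-inv ⟨
    p-1 *ᶻ double H
      ≡⟨ cong (p-1 *ᶻ_) (convolution m H) ⟩
    p-1 *ᶻ E[ m ] conv
      ≡⟨ cong (p-1 *ᶻ_) (ℤ∑.∑-cong K (λ z z∈ → trans (cong (_*ᶻ ε (tr m z)) (trans (conv≡ (∈sub⁻ {m} z∈)) (cong (λ a → a *ᶻ nz z +ᶻ (pos (p ^ m) -ᶻ 1ℤ) *ᶻ 𝟙ᶻ (z ≟ 0#)) conv-1))) (lem (𝟙ᶻ (z ≟ 0#)) (pos (p ^ m)) (ε (tr m z))))) ⟩
    p-1 *ᶻ ∑ᶻ K (λ z → pos (p ^ m) *ᶻ (𝟙ᶻ (z ≟ 0#) *ᶻ ε (tr m z)) +ᶻ -1ℤ *ᶻ ε (tr m z))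
      ≡⟨ cong (p-1 *ᶻ_) (trans (ℤ∑.∑-⊕ K _ _) (cong₂ _+ᶻ_ (trans (ℤ∑.∑-⊗ˡ K (pos (p ^ m)) _) (cong (pos (p ^ m) *ᶻ_) (trans (∑-𝟙0 (λ x → ε (tr m x))) (trans (cong ε (tr-0 m)) ε-0))))
           (trans (ℤ∑.∑-⊗ˡ K -1ℤ _) (cong (-1ℤ *ᶻ_) ∑ε≡0)))) ⟩
    p-1 *ᶻ (pos (p ^ m) *ᶻ p-1 +ᶻ -1ℤ *ᶻ 0ℤ)
      ≡⟨ lem′ p-1 (pos (p ^ m)) ⟩
    pos (p ^ m) *ᶻ (p-1 *ᶻ p-1) ∎
    where
    open ≡-Reasoning
    lem : ∀ i q e → (-1ℤ *ᶻ (1ℤ -ᶻ i) +ᶻ (q -ᶻ 1ℤ) *ᶻ i) *ᶻ e ≡ q *ᶻ (i *ᶻ e) +ᶻ -1ℤ *ᶻ e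
    lem = solveℤ
    lem′ : ∀ P q → P *ᶻ (q *ᶻ P +ᶻ -1ℤ *ᶻ 0ℤ) ≡ q *ᶻ (P *ᶻ P)
    lem′ = solveℤ

  -- The parts of the Jacobi sum of χ(x) χ(1 - x), with both factors merged into one argument by
  -- multiplicativity.
  JR JI : ℤ
  JR = ∑ᶻ K (λ x → χR (x ⊗ (1# ⊕ ⊖ x)))
  JI = ∑ᶻ K (λ x → χI (x ⊗ (1# ⊕ ⊖ x)))

  ρ-0 : ρ 0# ≡ 0ℤ
  ρ-0 = trans (cong R (pow-0# (2 * c) (0<kc 2 (s≤s z≤n)))) R-0

  private
    zx[z-zx] : ∀ z x → (z ⊗ x) ⊗ (z ⊕ ⊖ (z ⊗ x)) ≡ (z ⊗ z) ⊗ (x ⊗ (1# ⊕ ⊖ x))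
    zx[z-zx] z x = trans (cong ((z ⊗ x) ⊗_) (z-zx z x)) (⊗-interchange z x z _)

    pow-zz : ∀ z → pow (z ⊗ z) c ≡ pow z c ⊗ pow z c
    pow-zz z = pow-⊗ z z c

    ρ≡ : ∀ z → χR (z ⊗ z) ≡ ρ z
    ρ≡ z = cong R (trans (pow-zz z) (sym (pow-2c z)))

    χI-square : ∀ {z} → Sub m z → χI (z ⊗ z) ≡ 0ℤ
    χI-square {z} sz = trans (cong I (pow-zz z)) (I-square (quart sz))

    [x][0-x] : ∀ x → pow (x ⊗ (0# ⊕ ⊖ x)) c ≡ pow (x ⊗ x) c
    [x][0-x] x = trans (pow-⊗ x _ c) (trans (cong (pow x c ⊗_) (trans (cong (λ w → pow w c) (+-identityˡ _)) (pow-⊖c x))) (sym (pow-⊗ x x c)))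

    -- For z ≠ 0 the substitution of z x for x extracts χ(z²) = ρ(z), which is real, so the two
    -- parts of the Jacobi sum do not mix. For z = 0 the sum becomes that of ρ because χ(-1) = 1,
    -- and it vanishes like ρ(0).
    conv-R : ∀ {z} → Sub m z → ∑ᶻ K (λ x → χR (x ⊗ (z ⊕ ⊖ x))) ≡ ρ z *ᶻ JR
    conv-R {z} sz with z ≟ 0#
    ... | yes refl = trans (ℤ∑.∑-cong′ K (λ x → trans (cong R ([x][0-x] x)) (ρ≡ x))) (trans ∑ρ≡0 (trans (sym (ℤₚ.*-zeroˡ JR)) (cong (_*ᶻ JR) (sym ρ-0))))
    ... | no z≢0 = trans (∑-scale m z≢0 sz _) (trans (ℤ∑.∑-cong′ K step) (ℤ∑.∑-⊗ˡ K (ρ z) _))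
      where
      lem : ∀ a b e → a *ᶻ b -ᶻ 0ℤ *ᶻ e ≡ a *ᶻ b
      lem = solveℤ
      step : ∀ x → χR ((z ⊗ x) ⊗ (z ⊕ ⊖ (z ⊗ x))) ≡ ρ z *ᶻ χR (x ⊗ (1# ⊕ ⊖ x))
      step x = trans (cong χR (zx[z-zx] z x)) (trans (χR-⊗ (Sub-⊗ m sz sz) _)
        (trans (cong₂ (λ a b → a *ᶻ χR (x ⊗ (1# ⊕ ⊖ x)) -ᶻ b *ᶻ χI (x ⊗ (1# ⊕ ⊖ x))) (ρ≡ z) (χI-square sz)) (lem (ρ z) (χR (x ⊗ (1# ⊕ ⊖ x))) (χI (x ⊗ (1# ⊕ ⊖ x))))))

    conv-I : ∀ {z} → Sub m z → ∑ᶻ K (λ x → χI (x ⊗ (z ⊕ ⊖ x))) ≡ ρ z *ᶻ JI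
    conv-I {z} sz with z ≟ 0#
    ... | yes refl = trans (ℤ∑.∑-zero K (λ x x∈ → trans (cong I ([x][0-x] x)) (χI-square (∈sub⁻ {m} x∈)))) (trans (sym (ℤₚ.*-zeroˡ JI)) (cong (_*ᶻ JI) (sym ρ-0)))
    ... | no z≢0 = trans (∑-scale m z≢0 sz _) (trans (ℤ∑.∑-cong′ K step) (ℤ∑.∑-⊗ˡ K (ρ z) _))
      where
      lem : ∀ a b e → a *ᶻ b +ᶻ 0ℤ *ᶻ e ≡ a *ᶻ b
      lem = solveℤ
      step : ∀ x → χI ((z ⊗ x) ⊗ (z ⊕ ⊖ (z ⊗ x))) ≡ ρ z *ᶻ χI (x ⊗ (1# ⊕ ⊖ x))
      step x = trans (cong χI (zx[z-zx] z x)) (trans (χI-⊗ (Sub-⊗ m sz sz) _)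
        (trans (cong₂ (λ a b → a *ᶻ χI (x ⊗ (1# ⊕ ⊖ x)) +ᶻ b *ᶻ χR (x ⊗ (1# ⊕ ⊖ x))) (ρ≡ z) (χI-square sz)) (lem (ρ z) (χI (x ⊗ (1# ⊕ ⊖ x))) (χR (x ⊗ (1# ⊕ ⊖ x))))))

    double-conv : ∀ (H : Carrier → Carrier → ℤ) (h : Carrier → ℤ) (J : ℤ) →
      (∀ {x} → Sub m x → ∀ y → H x y ≡ h (x ⊗ y)) →
      (∀ {z} → Sub m z → ∑ᶻ K (λ x → h (x ⊗ (z ⊕ ⊖ x))) ≡ ρ z *ᶻ J) → double H ≡ J *ᶻ Eρ
    double-conv H h J H≡ conv≡ = begin
      double H
        ≡⟨ convolution m H ⟩
      ∑ᶻ K (λ z → ∑ᶻ K (λ x → H x (z ⊕ ⊖ x)) *ᶻ ε (tr m z))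
        ≡⟨ ℤ∑.∑-cong K (λ z z∈ → trans (cong (_*ᶻ ε (tr m z)) (trans (ℤ∑.∑-cong K (λ x x∈ → H≡ (∈sub⁻ {m} x∈) _)) (conv≡ (∈sub⁻ {m} z∈)))) (lem (ρ z) J _)) ⟩
      ∑ᶻ K (λ z → J *ᶻ (ρ z *ᶻ ε (tr m z)))
        ≡⟨ ℤ∑.∑-⊗ˡ K J _ ⟩
      J *ᶻ Eρ ∎
      where
      open ≡-Reasoning
      lem : ∀ a b e → (a *ᶻ b) *ᶻ e ≡ b *ᶻ (a *ᶻ e)
      lem = solveℤ

  -- The real part of the classical relation G(χ)² = J(χ,χ) G(χ²); `E-imag` is its imaginary part.
  E-real : ER *ᶻ ER -ᶻ EI *ᶻ EI ≡ p-1 *ᶻ (JR *ᶻ Eρ)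
  E-real = begin
    ER *ᶻ ER -ᶻ EI *ᶻ EI             ≡⟨ cong (ER *ᶻ ER +ᶻ_) (ℤₚ.-1*i≡-i (EI *ᶻ EI)) ⟨
    ER *ᶻ ER +ᶻ -1ℤ *ᶻ (EI *ᶻ EI)    ≡⟨ double-product -1ℤ χR χR χI χI χR-inv χI-inv ⟨
    p-1 *ᶻ double (λ x y → χR x *ᶻ χR y +ᶻ -1ℤ *ᶻ (χI x *ᶻ χI y))
      ≡⟨ cong (p-1 *ᶻ_) (double-conv _ χR JR (λ {x} sx y → trans (cong (χR x *ᶻ χR y +ᶻ_) (ℤₚ.-1*i≡-i _)) (sym (χR-⊗ sx y))) conv-R) ⟩
    p-1 *ᶻ (JR *ᶻ Eρ)                ∎
    where open ≡-Reasoning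

  E-imag : pos 2 *ᶻ (ER *ᶻ EI) ≡ p-1 *ᶻ (JI *ᶻ Eρ)
  E-imag = begin
    pos 2 *ᶻ (ER *ᶻ EI)              ≡⟨ lem ER EI ⟩
    ER *ᶻ EI +ᶻ 1ℤ *ᶻ (EI *ᶻ ER)     ≡⟨ double-product 1ℤ χR χI χI χR χI-inv χR-inv ⟨
    p-1 *ᶻ double (λ x y → χR x *ᶻ χI y +ᶻ 1ℤ *ᶻ (χI x *ᶻ χR y))
      ≡⟨ cong (p-1 *ᶻ_) (double-conv _ χI JI (λ {x} sx y → trans (cong (χR x *ᶻ χI y +ᶻ_) (ℤₚ.*-identityˡ _)) (sym (χI-⊗ sx y))) conv-I) ⟩
    p-1 *ᶻ (JI *ᶻ Eρ)                ∎
    where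
    open ≡-Reasoning
    lem : ∀ a b → pos 2 *ᶻ (a *ᶻ b) ≡ a *ᶻ b +ᶻ 1ℤ *ᶻ (b *ᶻ a)
    lem = solveℤ

  -- The quadratic Gauss sum, computed through the subfield 𝔽_s.

  e₂ s j h : ℕ
  e₂ = 2 * t
  s = p ^ e₂
  j = proj₁ (^≡1mod4 d p-eq e₂)
  -- h = (s + 1)/2, so that h (s - 1) = (q - 1)/2 = 2c. This makes gen^h a solution of x^s = -x, and
  -- since h is odd, a nonsquare.
  h = 2 * j + 1

  s-eq : 4 * j + 1 ≡ s
  s-eq = proj₂ (^≡1mod4 d p-eq e₂)

  2e₂≡m : 2 * e₂ ≡ m
  2e₂≡m = lem t
    where
    lem : ∀ t → 2 * (2 * t) ≡ 4 * t
    lem = solve-∀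

  s*s≡q : s * s ≡ p ^ m
  s*s≡q = trans (sym (ℕₚ.^-distribˡ-+-* p e₂ e₂)) (cong (p ^_) (trans (cong (e₂ +_) (sym (ℕₚ.+-identityʳ e₂))) 2e₂≡m))

  module U₂ = Units e₂ (r * 2) (ℕₚ.≤-trans 0<t (ℕₚ.m≤m+n t (t + 0))) (trans (ℕₚ.*-assoc r 2 e₂) (trans (cong (r *_) 2e₂≡m) E-eq))

  private
    N₂≡4j : U₂.N ≡ 4 * j
    N₂≡4j = trans (cong (_∸ 1) (sym s-eq)) (ℕₚ.m+n∸n≡m (4 * j) 1)

    h*N₂≡2c : h * U₂.N ≡ 2 * c
    h*N₂≡2c = trans (cong (h *_) N₂≡4j) (ℕₚ.*-cancelˡ-≡ _ (2 * c) 2 (ℕₚ.+-cancelʳ-≡ 1 _ _ (begin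
      2 * ((2 * j + 1) * (4 * j)) + 1   ≡⟨ lem j ⟩
      (4 * j + 1) * (4 * j + 1)         ≡⟨ cong₂ _*_ s-eq s-eq ⟩
      s * s                             ≡⟨ s*s≡q ⟩
      p ^ m                             ≡⟨ c-eq ⟨
      4 * c + 1                         ≡⟨ lem′ c ⟩
      2 * (2 * c) + 1                   ∎)))
      where
      open ≡-Reasoning
      lem : ∀ j → 2 * ((2 * j + 1) * (4 * j)) + 1 ≡ (4 * j + 1) * (4 * j + 1)
      lem = solve-∀
      lem′ : ∀ c → 4 * c + 1 ≡ 2 * (2 * c) + 1
      lem′ = solve-∀

    Sub-e₂⇒m : ∀ {x} → Sub e₂ x → Sub m x
    Sub-e₂⇒m {x} sx = subst (λ n → Sub n x) 2e₂≡m (Sub-mono e₂ 2 sx)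

    pow-2c-one : ∀ {y} → y ≢ 0# → Sub e₂ y → pow y (2 * c) ≡ 1#
    pow-2c-one {y} y≢0 sy = begin
      pow y (2 * c)          ≡⟨ cong (pow y) (trans (sym h*N₂≡2c) (ℕₚ.*-comm h U₂.N)) ⟩
      pow y (U₂.N * h)       ≡⟨ pow-* y U₂.N h ⟩
      pow (pow y U₂.N) h     ≡⟨ cong (λ z → pow z h) (U₂.Sub⇒powN y≢0 sy) ⟩
      pow 1# h               ≡⟨ pow-1# h ⟩
      1#                     ∎
      where open ≡-Reasoning

    u₀ : Carrier
    u₀ = pow gen h

    u₀≢0 : u₀ ≢ 0#
    u₀≢0 = pow≢0 h gen≢0

    u₀^s : pow u₀ s ≡ ⊖ u₀
    u₀^s = begin
      pow u₀ s                     ≡⟨ cong (pow u₀) U₂.suc-N ⟨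
      u₀ ⊗ pow u₀ U₂.N             ≡⟨ cong (u₀ ⊗_) (trans (sym (pow-* gen h U₂.N)) (trans (cong (pow gen) h*N₂≡2c) gen^2c)) ⟩
      u₀ ⊗ ⊖ 1#                    ≡⟨ *-comm u₀ _ ⟩
      ⊖ 1# ⊗ u₀                    ≡⟨ ⊖≡⊖1⊗ u₀ ⟨
      ⊖ u₀                         ∎
      where open ≡-Reasoning

    u₀^2c : pow u₀ (2 * c) ≡ ⊖ 1#
    u₀^2c = begin
      pow (pow gen h) (2 * c)            ≡⟨ pow-comm gen h (2 * c) ⟩
      pow (pow gen (2 * c)) h            ≡⟨ cong (λ z → pow z h) gen^2c ⟩
      pow (⊖ 1#) (2 * j + 1)             ≡⟨ pow-+ (⊖ 1#) (2 * j) 1 ⟩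
      pow (⊖ 1#) (2 * j) ⊗ pow (⊖ 1#) 1  ≡⟨ cong₂ _⊗_ (pow-⊖1-even j) (pow-1 (⊖ 1#)) ⟩
      1# ⊗ ⊖ 1#                          ≡⟨ *-identityˡ _ ⟩
      ⊖ 1#                               ∎
      where open ≡-Reasoning

    -- On 𝔽_q, the relative trace down to 𝔽_s. Its kernel is the line x^s = -x spanned by `u₀`.
    v : Carrier → Carrier
    v x = x ⊕ pow x s

    v-Sub : ∀ {x} → Sub m x → Sub e₂ (v x)
    v-Sub {x} sx = begin
      pow (x ⊕ pow x s) s          ≡⟨ frobenius^-+ e₂ x (pow x s) ⟩
      pow x s ⊕ pow (pow x s) s    ≡⟨ cong (pow x s ⊕_) (trans (sym (pow-* x s s)) (trans (cong (pow x) s*s≡q) sx)) ⟩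
      pow x s ⊕ x                  ≡⟨ +-comm _ _ ⟩
      v x                          ∎
      where open ≡-Reasoning

    tr-v : ∀ {y} → Sub e₂ y → ∀ x → tr m (y ⊗ x) ≡ tr e₂ (y ⊗ v x)
    tr-v {y} sy x = begin
      tr m (y ⊗ x)                          ≡⟨ cong (λ n → tr n (y ⊗ x)) 2e₂≡m ⟨
      tr (2 * e₂) (y ⊗ x)                   ≡⟨ tr-tower 2 e₂ (y ⊗ x) ⟩
      tr e₂ (pow (y ⊗ x) (p ^ (0 * e₂)) ⊕ (pow (y ⊗ x) (p ^ (1 * e₂)) ⊕ 0#))
        ≡⟨ cong (tr e₂) (cong₂ _⊕_ (pow-1 _) (trans (+-identityʳ _) (trans (cong (λ n → pow (y ⊗ x) (p ^ n)) (ℕₚ.*-identityˡ e₂)) (trans (pow-⊗ y x s) (cong (_⊗ pow x s) sy))))) ⟩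
      tr e₂ (y ⊗ x ⊕ y ⊗ pow x s)           ≡⟨ cong (tr e₂) (distribˡ y x (pow x s)) ⟨
      tr e₂ (y ⊗ v x)                       ∎
      where open ≡-Reasoning

    -- Orthogonality over 𝔽_s applied to y ↦ tr(y v(x)): the full sum over 𝔽_s detects the kernel of
    -- `v`, and the term y = 0, worth ε 0 = p - 1, is then removed.
    inner : ∀ {x} → Sub m x → ∑ᶻ U₂.units (λ y → ε (tr m (y ⊗ x))) ≡ (pos s *ᶻ p-1) *ᶻ 𝟙ᶻ (v x ≟ 0#) -ᶻ p-1
    inner {x} sx = begin
      ∑ᶻ U₂.units f                    ≡⟨ lem p-1 (∑ᶻ U₂.units f) ⟩
      (p-1 +ᶻ ∑ᶻ U₂.units f) -ᶻ p-1    ≡⟨ cong (λ a → (a +ᶻ ∑ᶻ U₂.units f) -ᶻ p-1) (trans (cong ε (trans (cong (tr m) (zeroˡ x)) (tr-0 m))) ε-0) ⟨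
      (f 0# +ᶻ ∑ᶻ U₂.units f) -ᶻ p-1   ≡⟨ cong (_-ᶻ p-1) (ℤ∑.∑-↭ U₂.sub-↭ f) ⟨
      ∑ᶻ (sub e₂) f -ᶻ p-1             ≡⟨ cong (_-ᶻ p-1) (trans (ℤ∑.∑-cong (sub e₂) (λ y y∈ → cong ε (tr-v (∈sub⁻ {e₂} y∈) x))) (by-cases (v x ≟ 0#))) ⟩
      (pos s *ᶻ p-1) *ᶻ 𝟙ᶻ (v x ≟ 0#) -ᶻ p-1 ∎
      where
      open ≡-Reasoning
      f : Carrier → ℤ
      f y = ε (tr m (y ⊗ x))
      lem : ∀ P a → a ≡ (P +ᶻ a) -ᶻ P
      lem = solveℤ
      by-cases : (dec : Dec (v x ≡ 0#)) → ∑ᶻ (sub e₂) (λ y → ε (tr e₂ (y ⊗ v x))) ≡ (pos s *ᶻ p-1) *ᶻ 𝟙ᶻ dec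
      by-cases (yes e) = trans (ℤ∑.∑-cong′ (sub e₂) (λ y → trans (cong ε (trans (cong (tr e₂) (trans (cong (y ⊗_) e) (zeroʳ y))) (tr-0 e₂))) ε-0))
        (trans (U₂.∑-const-sub p-1) (sym (ℤₚ.*-identityʳ _)))
      by-cases (no ne) = trans (∑-ε-tr e₂ (r * 2) (ℕₚ.≤-trans 0<t (ℕₚ.m≤m+n t (t + 0))) (trans (ℕₚ.*-assoc r 2 e₂) (trans (cong (r *_) 2e₂≡m) E-eq)) (v-Sub sx) ne) (sym (ℤₚ.*-zeroʳ (pos s *ᶻ p-1)))

    ρ-scale : ∀ {y} → y ≢ 0# → Sub e₂ y → ∀ x → ρ (y ⊗ x) ≡ ρ x
    ρ-scale {y} y≢0 sy x = cong R (trans (pow-⊗ y x (2 * c)) (trans (cong (_⊗ pow x (2 * c)) (pow-2c-one y≢0 sy)) (*-identityˡ _)))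

    V : ℤ
    V = ∑ᶻ K (λ x → ρ x *ᶻ 𝟙ᶻ (v x ≟ 0#))

    -- ρ is invariant under 𝔽_s^*, so the Gauss sum may be averaged over that group; `inner` then
    -- concentrates it on the kernel of `v`, the constant part dropping out with ∑ρ = 0.
    N₂*Eρ : pos U₂.N *ᶻ Eρ ≡ (pos s *ᶻ p-1) *ᶻ V
    N₂*Eρ = begin
      pos U₂.N *ᶻ Eρ
        ≡⟨ U₂.∑-const-units Eρ ⟨
      ∑ᶻ U₂.units (λ _ → Eρ)
        ≡⟨ ℤ∑.∑-cong U₂.units (λ y y∈ → trans (∑-scale m (U₂.units≢0 y∈) (Sub-e₂⇒m (U₂.units-Sub y∈)) (λ x → ρ x *ᶻ ε (tr m x)))
             (ℤ∑.∑-cong′ K (λ x → cong (_*ᶻ ε (tr m (y ⊗ x))) (ρ-scale (U₂.units≢0 y∈) (U₂.units-Sub y∈) x)))) ⟩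
      ∑ᶻ U₂.units (λ y → ∑ᶻ K (λ x → ρ x *ᶻ ε (tr m (y ⊗ x))))
        ≡⟨ ℤ∑.∑-swap U₂.units K _ ⟩
      ∑ᶻ K (λ x → ∑ᶻ U₂.units (λ y → ρ x *ᶻ ε (tr m (y ⊗ x))))
        ≡⟨ ℤ∑.∑-cong K (λ x x∈ → trans (ℤ∑.∑-⊗ˡ U₂.units (ρ x) _) (trans (cong (ρ x *ᶻ_) (inner (∈sub⁻ {m} x∈))) (lem (ρ x) (pos s *ᶻ p-1) (𝟙ᶻ (v x ≟ 0#)) p-1))) ⟩
      ∑ᶻ K (λ x → (pos s *ᶻ p-1) *ᶻ (ρ x *ᶻ 𝟙ᶻ (v x ≟ 0#)) +ᶻ ⁻ p-1 *ᶻ ρ x)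
        ≡⟨ trans (ℤ∑.∑-⊕ K _ _) (cong₂ _+ᶻ_ (ℤ∑.∑-⊗ˡ K (pos s *ᶻ p-1) _) (trans (ℤ∑.∑-⊗ˡ K (⁻ p-1) ρ) (trans (cong (⁻ p-1 *ᶻ_) ∑ρ≡0) (ℤₚ.*-zeroʳ (⁻ p-1))))) ⟩
      (pos s *ᶻ p-1) *ᶻ V +ᶻ 0ℤ
        ≡⟨ ℤₚ.+-identityʳ _ ⟩
      (pos s *ᶻ p-1) *ᶻ V ∎
      where
      open ≡-Reasoning
      lem : ∀ a k i P → a *ᶻ (k *ᶻ i -ᶻ P) ≡ k *ᶻ (a *ᶻ i) +ᶻ ⁻ P *ᶻ a
      lem = solveℤ

    v[u₀x] : ∀ x → v (u₀ ⊗ x) ≡ u₀ ⊗ (x ⊕ ⊖ pow x s)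
    v[u₀x] x = begin
      u₀ ⊗ x ⊕ pow (u₀ ⊗ x) s       ≡⟨ cong (u₀ ⊗ x ⊕_) (trans (pow-⊗ u₀ x s) (cong (_⊗ pow x s) u₀^s)) ⟩
      u₀ ⊗ x ⊕ ⊖ u₀ ⊗ pow x s       ≡⟨ cong (u₀ ⊗ x ⊕_) (trans (sym (-‿distribˡ-* u₀ _)) (-‿distribʳ-* u₀ _)) ⟩
      u₀ ⊗ x ⊕ u₀ ⊗ ⊖ pow x s       ≡⟨ distribˡ u₀ x _ ⟨
      u₀ ⊗ (x ⊕ ⊖ pow x s)          ∎
      where open ≡-Reasoning

    -- Multiplication by `u₀` carries 𝔽_s onto the kernel of `v` and reverses the sign of ρ, which
    -- is 1 on the s - 1 units of 𝔽_s.
    V≡ : V ≡ ⁻ pos U₂.N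
    V≡ = begin
      V
        ≡⟨ ∑-scale m u₀≢0 (Sub-pow m h gen-Sub) (λ x → ρ x *ᶻ 𝟙ᶻ (v x ≟ 0#)) ⟩
      ∑ᶻ K (λ x → ρ (u₀ ⊗ x) *ᶻ 𝟙ᶻ (v (u₀ ⊗ x) ≟ 0#))
        ≡⟨ ℤ∑.∑-cong′ K (λ x → trans (cong₂ _*ᶻ_ (ρ-u₀ x) (dec x)) (lem (ρ x) (𝟙ᶻ (pow x s ≟ x)))) ⟩
      ∑ᶻ K (λ x → ⁻ (𝟙ᶻ (pow x s ≟ x) *ᶻ ρ x))
        ≡⟨ ∑-⁻ _ ⟩
      ⁻ ∑ᶻ K (λ x → 𝟙ᶻ (pow x s ≟ x) *ᶻ ρ x)
        ≡⟨ cong ⁻_ (sym (ℤ∑.∑-filter (λ x → pow x s ≟ x) K ρ)) ⟩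
      ⁻ ∑ᶻ (filter (λ x → pow x s ≟ x) K) ρ
        ≡⟨ cong ⁻_ (ℤ∑.∑-↭ perm ρ) ⟩
      ⁻ ∑ᶻ (sub e₂) ρ
        ≡⟨ cong ⁻_ (ℤ∑.∑-↭ U₂.sub-↭ ρ) ⟩
      ⁻ (ρ 0# +ᶻ ∑ᶻ U₂.units ρ)
        ≡⟨ cong ⁻_ (cong₂ _+ᶻ_ ρ-0 (trans (ℤ∑.∑-cong U₂.units (λ y y∈ → trans (cong R (pow-2c-one (U₂.units≢0 y∈) (U₂.units-Sub y∈))) R-1)) (U₂.∑-const-units 1ℤ))) ⟩
      ⁻ (0ℤ +ᶻ pos U₂.N *ᶻ 1ℤ)
        ≡⟨ lem′ (pos U₂.N) ⟩
      ⁻ pos U₂.N ∎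
      where
      open ≡-Reasoning
      lem : ∀ a i → ⁻ a *ᶻ i ≡ ⁻ (i *ᶻ a)
      lem = solveℤ
      lem′ : ∀ n → ⁻ (0ℤ +ᶻ n *ᶻ 1ℤ) ≡ ⁻ n
      lem′ = solveℤ
      ρ-u₀ : ∀ x → ρ (u₀ ⊗ x) ≡ ⁻ ρ x
      ρ-u₀ x = trans (cong R (trans (pow-⊗ u₀ x (2 * c)) (trans (cong (_⊗ pow x (2 * c)) u₀^2c) (sym (⊖≡⊖1⊗ _))))) (R-⊖ _)
      dec : ∀ x → 𝟙ᶻ (v (u₀ ⊗ x) ≟ 0#) ≡ 𝟙ᶻ (pow x s ≟ x)
      dec x = ℤ∑.𝟙-cong (v (u₀ ⊗ x) ≟ 0#) (pow x s ≟ x) to from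
        where
        to : v (u₀ ⊗ x) ≡ 0# → pow x s ≡ x
        to e = sym (x-y≡0⇒x≡y x (pow x s) (⊗-cancelˡ u₀≢0 (trans (sym (v[u₀x] x)) (trans e (sym (zeroʳ u₀))))))
        from : pow x s ≡ x → v (u₀ ⊗ x) ≡ 0#
        from e = trans (v[u₀x] x) (trans (cong (λ w → u₀ ⊗ (x ⊕ ⊖ w)) e) (trans (cong (u₀ ⊗_) (-‿inverseʳ x)) (zeroʳ u₀)))
      perm : filter (λ x → pow x s ≟ x) K ↭ sub e₂
      perm = unique-set⇒↭ (Uniqueₚ.filter⁺ (λ x → pow x s ≟ x) (sub-unique m)) (sub-unique e₂)
        (λ x∈ → ∈sub⁺ {e₂} (proj₂ (∈-filter⁻ (λ x → pow x s ≟ x) {xs = K} x∈)))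
        (λ x∈ → ∈-filter⁺ (λ x → pow x s ≟ x) (∈sub⁺ {m} (Sub-e₂⇒m (∈sub⁻ {e₂} x∈))) (∈sub⁻ {e₂} x∈))

  -- The quadratic character is trivial on 𝔽_s, so only the line x^s = −x, all of whose
  -- nonzero points are nonsquares, contributes to its Gauss sum over 𝔽_{s²}.
  Eρ≡ : Eρ ≡ ⁻ (pos s *ᶻ p-1)
  Eρ≡ = ℤₚ.*-cancelˡ-≡ (pos U₂.N) _ _ {{>-nonZero U₂.0<N}} (trans N₂*Eρ (trans (cong ((pos s *ᶻ p-1) *ᶻ_) V≡) (lem (pos s *ᶻ p-1) (pos U₂.N))))
    where
    lem : ∀ a n → a *ᶻ ⁻ n ≡ n *ᶻ ⁻ a
    lem = solveℤ

  -- Reduction of the Jacobi sum into 𝔽_q.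

  int : ℤ → Carrier
  int (ℤ.+ n)      = nat n
  int (ℤ.-[1+ n ]) = ⊖ nat (suc n)

  int-⊖ : ∀ a b → int (a ℤ.⊖ b) ≡ nat a ⊕ ⊖ nat b
  int-⊖ zero    zero    = sym (-‿inverseʳ 0#)
  int-⊖ zero    (suc b) = sym (+-identityˡ _)
  int-⊖ (suc a) zero    = sym (trans (cong (nat (suc a) ⊕_) -0#≈0#) (+-identityʳ _))
  int-⊖ (suc a) (suc b) = begin
    int (suc a ℤ.⊖ suc b)                ≡⟨ cong int (ℤₚ.[1+m]⊖[1+n]≡m⊖n a b) ⟩
    int (a ℤ.⊖ b)                        ≡⟨ int-⊖ a b ⟩
    nat a ⊕ ⊖ nat b                      ≡⟨ +-identityˡ _ ⟨
    0# ⊕ (nat a ⊕ ⊖ nat b)               ≡⟨ cong (_⊕ (nat a ⊕ ⊖ nat b)) (-‿inverseʳ 1#) ⟨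
    (1# ⊕ ⊖ 1#) ⊕ (nat a ⊕ ⊖ nat b)      ≡⟨ S.interchange 1# (⊖ 1#) (nat a) (⊖ nat b) ⟩
    (1# ⊕ nat a) ⊕ (⊖ 1# ⊕ ⊖ nat b)      ≡⟨ cong ((1# ⊕ nat a) ⊕_) (-‿+-comm 1# (nat b)) ⟩
    (1# ⊕ nat a) ⊕ ⊖ (1# ⊕ nat b)        ∎
    where open ≡-Reasoning

  int-+ : ∀ a b → int (a +ᶻ b) ≡ int a ⊕ int b
  int-+ (ℤ.+ a)      (ℤ.+ b)      = nat-+ a b
  int-+ (ℤ.+ a)      (ℤ.-[1+ b ]) = int-⊖ a (suc b)
  int-+ (ℤ.-[1+ a ]) (ℤ.+ b)      = trans (int-⊖ b (suc a)) (+-comm _ _)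
  int-+ (ℤ.-[1+ a ]) (ℤ.-[1+ b ]) = trans (cong (⊖_ ∘ nat) (cong suc (sym (ℕₚ.+-suc a b)))) (trans (cong ⊖_ (nat-+ (suc a) (suc b))) (sym (-‿+-comm _ _)))

  int-∑ : ∀ {X : Set} (xs : List X) (f : X → ℤ) → int (∑ᶻ xs f) ≡ ∑ᶠ xs (λ x → int (f x))
  int-∑ []       f = refl
  int-∑ (x ∷ xs) f = trans (int-+ (f x) _) (cong (int (f x) ⊕_) (int-∑ xs f))

  int-∣ : ∀ a → p ∣ ℤ.∣ a ∣ → int a ≡ 0#
  int-∣ (ℤ.+ n)      p∣ = nat-∣ p∣
  int-∣ (ℤ.-[1+ n ]) p∣ = trans (cong ⊖_ (nat-∣ p∣)) -0#≈0#

  -- Cubing inverts a fourth root of unity, so z³ is the image of the complex conjugate R z - I z i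
  -- under i ↦ ι.
  cube-quart : ∀ {z} → Quart z → pow z 3 ≡ int (R z) ⊕ int (I z) ⊗ ⊖ ι
  cube-quart {z} q = trans (cong (λ w → z ⊗ (z ⊗ w)) (*-identityʳ z)) (go q)
    where
    1′ : int 1ℤ ≡ 1#
    1′ = +-identityʳ 1#
    -1′ : int -1ℤ ≡ ⊖ 1#
    -1′ = cong ⊖_ 1′
    val : ∀ {z a b x} → R z ≡ a → I z ≡ b → x ≡ int a ⊕ int b ⊗ ⊖ ι → x ≡ int (R z) ⊕ int (I z) ⊗ ⊖ ι
    val a b e = trans e (cong₂ (λ u w → int u ⊕ int w ⊗ ⊖ ι) (sym a) (sym b))
    real : ∀ x → x ≡ x ⊕ 0# ⊗ ⊖ ι
    real x = sym (trans (cong (x ⊕_) (zeroˡ _)) (+-identityʳ x))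
    go : ∀ {z} → Quart z → z ⊗ (z ⊗ z) ≡ int (R z) ⊕ int (I z) ⊗ ⊖ ι
    go q0 = val R-0 I-0 (trans (zeroˡ _) (real 0#))
    go q1 = val R-1 I-1 (trans (trans (*-identityˡ _) (trans (*-identityˡ _) (sym 1′))) (real _))
    go qι = val R-ι I-ι (trans (cong (ι ⊗_) ι⊗ι) (trans (*-comm ι _) (trans (sym (⊖≡⊖1⊗ ι)) (trans (sym (*-identityˡ _)) (trans (cong (_⊗ ⊖ ι) (sym 1′)) (sym (+-identityˡ _)))))))
    go q-1 = val R-⊖1 I-⊖1 (trans (trans (cong (⊖ 1# ⊗_) ⊖1⊗⊖1) (trans (*-identityʳ _) (sym -1′))) (real _))
    go q-ι = val R-⊖ι I-⊖ι (trans (cong (⊖ ι ⊗_) ⊖ι⊗⊖ι) (trans (*-comm (⊖ ι) _) (trans (cong (_⊗ ⊖ ι) (sym -1′)) (sym (+-identityˡ _)))))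
      where
      ⊖ι⊗⊖ι : ⊖ ι ⊗ ⊖ ι ≡ ⊖ 1#
      ⊖ι⊗⊖ι = trans (sym (-‿distribˡ-* ι (⊖ ι))) (cong ⊖_ ι⊗⊖ι)

  powerSum : ℕ → Carrier
  powerSum k = ∑ᶠ K (λ x → pow x k)

  private
    powerSum≡ : ∀ k → 0 < k → powerSum k ≡ ∑ᶠ (upTo U.N) (pow (pow gen k))
    powerSum≡ k 0<k = begin
      powerSum k                                             ≡⟨ S.∑-↭ U.sub-↭ (λ x → pow x k) ⟩
      pow 0# k ⊕ ∑ᶠ U.units (λ x → pow x k)                  ≡⟨ cong₂ _⊕_ (pow-0# k 0<k) (S.∑-map (pow gen) (upTo U.N) (λ x → pow x k)) ⟩
      0# ⊕ ∑ᶠ (upTo U.N) (λ i → pow (pow gen i) k)           ≡⟨ +-identityˡ _ ⟩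
      ∑ᶠ (upTo U.N) (λ i → pow (pow gen i) k)                ≡⟨ S.∑-cong′ (upTo U.N) (λ i → pow-comm gen i k) ⟩
      ∑ᶠ (upTo U.N) (pow (pow gen k))                        ∎
      where open ≡-Reasoning

  powerSum-0 : ∀ k → 0 < k → ¬ 4 * c ∣ k → powerSum k ≡ 0#
  powerSum-0 k 0<k N∤k = trans (powerSum≡ k 0<k) (geometric-zero (pow gen k) U.N
    (trans (pow-comm gen k U.N) (trans (cong (λ z → pow z k) (proj₁ U.order-gen)) (pow-1# k))) (λ e → N∤k (proj₂ order-gen k e)))

  powerSum-4c : powerSum (4 * c) ≢ 0#
  powerSum-4c e = nat-∤ U.p∤N (trans (sym (geometric-one (pow gen (4 * c)) U.N (proj₁ order-gen))) (trans (sym (powerSum≡ (4 * c) (0<kc 4 (s≤s z≤n)))) e))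

  private
    -- The conjugate character corresponds to the exponent 3c. Its polynomial (x(1 - x))^(3c)
    -- reaches degree 6c, beyond q - 1 = 4c, and so has a power sum that survives.
    n₃ : ℕ
    n₃ = 3 * c

    coeff : ℕ → Carrier
    coeff i = nat (n₃ C i) ⊗ pow (⊖ 1#) i

    expand : ∀ x → pow (x ⊗ (1# ⊕ ⊖ x)) n₃ ≡ ∑ᶠ (upTo (suc n₃)) (λ i → coeff i ⊗ pow x (n₃ + i))
    expand x = begin
      pow (x ⊗ (1# ⊕ ⊖ x)) n₃
        ≡⟨ pow-⊗ x _ n₃ ⟩
      pow x n₃ ⊗ pow (1# ⊕ ⊖ x) n₃
        ≡⟨ cong (λ w → pow x n₃ ⊗ pow w n₃) (+-comm 1# (⊖ x)) ⟩
      pow x n₃ ⊗ pow (⊖ x ⊕ 1#) n₃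
        ≡⟨ cong (pow x n₃ ⊗_) (binomial n₃ (⊖ x) 1#) ⟩
      pow x n₃ ⊗ ∑ᶠ (upTo (suc n₃)) (λ i → nat (n₃ C i) ⊗ (pow (⊖ x) i ⊗ pow 1# (n₃ ∸ i)))
        ≡⟨ S.∑-⊗ˡ (upTo (suc n₃)) (pow x n₃) _ ⟨
      ∑ᶠ (upTo (suc n₃)) (λ i → pow x n₃ ⊗ (nat (n₃ C i) ⊗ (pow (⊖ x) i ⊗ pow 1# (n₃ ∸ i))))
        ≡⟨ S.∑-cong′ (upTo (suc n₃)) step ⟩
      ∑ᶠ (upTo (suc n₃)) (λ i → coeff i ⊗ pow x (n₃ + i)) ∎
      where
      open ≡-Reasoning
      step : ∀ i → pow x n₃ ⊗ (nat (n₃ C i) ⊗ (pow (⊖ x) i ⊗ pow 1# (n₃ ∸ i))) ≡ coeff i ⊗ pow x (n₃ + i)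
      step i = begin
        pow x n₃ ⊗ (nat (n₃ C i) ⊗ (pow (⊖ x) i ⊗ pow 1# (n₃ ∸ i)))
          ≡⟨ cong (λ w → pow x n₃ ⊗ (nat (n₃ C i) ⊗ w)) (trans (cong (pow (⊖ x) i ⊗_) (pow-1# (n₃ ∸ i))) (*-identityʳ _)) ⟩
        pow x n₃ ⊗ (nat (n₃ C i) ⊗ pow (⊖ x) i)
          ≡⟨ cong (λ w → pow x n₃ ⊗ (nat (n₃ C i) ⊗ w)) (trans (cong (λ w → pow w i) (⊖≡⊖1⊗ x)) (pow-⊗ (⊖ 1#) x i)) ⟩
        pow x n₃ ⊗ (nat (n₃ C i) ⊗ (pow (⊖ 1#) i ⊗ pow x i))
          ≡⟨ cong (pow x n₃ ⊗_) (*-assoc _ _ _) ⟨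
        pow x n₃ ⊗ (coeff i ⊗ pow x i)
          ≡⟨ *-assoc _ _ _ ⟨
        pow x n₃ ⊗ coeff i ⊗ pow x i
          ≡⟨ cong (_⊗ pow x i) (*-comm (pow x n₃) (coeff i)) ⟩
        coeff i ⊗ pow x n₃ ⊗ pow x i
          ≡⟨ *-assoc _ _ _ ⟩
        coeff i ⊗ (pow x n₃ ⊗ pow x i)
          ≡⟨ cong (coeff i ⊗_) (pow-+ x n₃ i) ⟨
        coeff i ⊗ pow x (n₃ + i) ∎

    4c∤ : ∀ i → i < suc n₃ → i ≢ c → ¬ 4 * c ∣ n₃ + i
    4c∤ i i≤ i≢c (divides 0 e) = ℕₚ.<⇒≢ (ℕₚ.≤-trans (0<kc 3 (s≤s z≤n)) (ℕₚ.m≤m+n n₃ i)) (sym e)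
    4c∤ i i≤ i≢c (divides 1 e) = i≢c (ℕₚ.+-cancelˡ-≡ n₃ i c (trans e (lem c)))
      where
      lem : ∀ c → 1 * (4 * c) ≡ 3 * c + c
      lem = solve-∀
    4c∤ i (s≤s i≤) i≢c (divides (suc (suc k)) e) = ℕₚ.<⇒≱ (begin-strict
        n₃ + i                 ≤⟨ ℕₚ.+-monoʳ-≤ n₃ i≤ ⟩
        n₃ + n₃                <⟨ ℕₚ.m<m+n (n₃ + n₃) (0<kc 2 (s≤s z≤n)) ⟩
        (n₃ + n₃) + 2 * c      ≡⟨ lem c ⟩
        4 * c + (4 * c + 0)    ≤⟨ ℕₚ.+-monoʳ-≤ (4 * c) (ℕₚ.+-monoʳ-≤ (4 * c) z≤n) ⟩
        4 * c + (4 * c + k * (4 * c)) ∎) (ℕₚ.≤-reflexive (sym e))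
      where
      open ℕₚ.≤-Reasoning
      lem : ∀ c → (3 * c + 3 * c) + 2 * c ≡ 4 * c + (4 * c + 0)
      lem = solve-∀

    -- The exponents 3c, ..., 6c contain a single multiple of q - 1 = 4c, namely 4c itself at i = c;
    -- the power sums at all others vanish.
    ∑expand : ∑ᶠ K (λ x → pow (x ⊗ (1# ⊕ ⊖ x)) n₃) ≡ coeff c ⊗ powerSum (4 * c)
    ∑expand = begin
      ∑ᶠ K (λ x → pow (x ⊗ (1# ⊕ ⊖ x)) n₃)
        ≡⟨ S.∑-cong′ K expand ⟩
      ∑ᶠ K (λ x → ∑ᶠ (upTo (suc n₃)) (λ i → coeff i ⊗ pow x (n₃ + i)))
        ≡⟨ S.∑-swap K (upTo (suc n₃)) _ ⟩
      ∑ᶠ (upTo (suc n₃)) (λ i → ∑ᶠ K (λ x → coeff i ⊗ pow x (n₃ + i)))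
        ≡⟨ S.∑-cong′ (upTo (suc n₃)) (λ i → S.∑-⊗ˡ K (coeff i) _) ⟩
      ∑ᶠ (upTo (suc n₃)) (λ i → coeff i ⊗ powerSum (n₃ + i))
        ≡⟨ S.∑-single (Uniqueₚ.upTo⁺ (suc n₃)) (∈-upTo⁺ (s≤s (ℕₚ.m≤m+n c (2 * c)))) (λ i → coeff i ⊗ powerSum (n₃ + i))
             (λ i i∈ i≢c → trans (cong (coeff i ⊗_) (powerSum-0 (n₃ + i) (ℕₚ.≤-trans (0<kc 3 (s≤s z≤n)) (ℕₚ.m≤m+n n₃ i)) (4c∤ i (∈-upTo⁻ i∈) i≢c))) (zeroʳ _)) ⟩
      coeff c ⊗ powerSum (n₃ + c)
        ≡⟨ cong (λ k → coeff c ⊗ powerSum k) (lem c) ⟩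
      coeff c ⊗ powerSum (4 * c) ∎
      where
      open ≡-Reasoning
      lem : ∀ c → 3 * c + c ≡ 4 * c
      lem = solve-∀

    ∑cubes : ∑ᶠ K (λ x → pow (x ⊗ (1# ⊕ ⊖ x)) n₃) ≡ int JR ⊕ int JI ⊗ ⊖ ι
    ∑cubes = begin
      ∑ᶠ K (λ x → pow (y x) n₃)
        ≡⟨ S.∑-cong K (λ x x∈ → trans (cong (pow (y x)) (ℕₚ.*-comm 3 c)) (trans (pow-* (y x) c 3) (cube-quart (quart (Sub-y (∈sub⁻ {m} x∈)))))) ⟩
      ∑ᶠ K (λ x → int (χR (y x)) ⊕ int (χI (y x)) ⊗ ⊖ ι)
        ≡⟨ S.∑-⊕ K _ _ ⟩
      ∑ᶠ K (λ x → int (χR (y x))) ⊕ ∑ᶠ K (λ x → int (χI (y x)) ⊗ ⊖ ι)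
        ≡⟨ cong₂ _⊕_ (sym (int-∑ K (χR ∘ y))) (trans (S.∑-⊗ʳ K (⊖ ι) _) (cong (_⊗ ⊖ ι) (sym (int-∑ K (χI ∘ y))))) ⟩
      int JR ⊕ int JI ⊗ ⊖ ι ∎
      where
      open ≡-Reasoning
      y : Carrier → Carrier
      y x = x ⊗ (1# ⊕ ⊖ x)
      Sub-y : ∀ {x} → Sub m x → Sub m (y x)
      Sub-y sx = Sub-⊗ m sx (Sub-⊕ m (Sub-1 m) (Sub-⊖ m sx))

  -- The conjugate Jacobi sum reduces to ± C(3c,c) in the residue field.
  J-nondivisible : ¬ (p ∣ ℤ.∣ JR ∣ × p ∣ ℤ.∣ JI ∣)
  J-nondivisible (p∣R , p∣I) = ⊗≢0 (⊗≢0 (nat-∤ (∤C3 pr d p-eq m c c-eq)) (pow≢0 c (⊖≢0 1≢0))) powerSum-4c (begin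
    coeff c ⊗ powerSum (4 * c)  ≡⟨ ∑expand ⟨
    ∑ᶠ K (λ x → pow (x ⊗ (1# ⊕ ⊖ x)) n₃) ≡⟨ ∑cubes ⟩
    int JR ⊕ int JI ⊗ ⊖ ι       ≡⟨ cong₂ (λ a b → a ⊕ b ⊗ ⊖ ι) (int-∣ JR p∣R) (int-∣ JI p∣I) ⟩
    0# ⊕ 0# ⊗ ⊖ ι               ≡⟨ trans (+-identityˡ _) (zeroˡ _) ⟩
    0#                          ∎)
    where open ≡-Reasoning

  -- Quartic classes, their Gaussian periods and their weights.

  β : Carrier
  β = pow gen 4

  order-β : IsOrder β c
  order-β = order-pow 4 c (s≤s z≤n) order-gen

  β≢0 : β ≢ 0#
  β≢0 = pow≢0 4 gen≢0

  β-Sub : Sub m β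
  β-Sub = Sub-pow m 4 gen-Sub

  coset-↭ : ∀ {δ} → δ ≢ 0# → Sub m δ → map (λ i → δ ⊗ pow β i) (upTo c) ↭ filter (λ x → pow x c ≟ pow δ c) K
  coset-↭ {δ} δ≢0 sδ = unique-set⇒↭
      (map-unique (λ i → δ ⊗ pow β i) (λ i∈ j∈ e → order-injective 0<c order-β (∈-upTo⁻ i∈) (∈-upTo⁻ j∈) (⊗-cancelˡ δ≢0 e)) (Uniqueₚ.upTo⁺ c))
      (Uniqueₚ.filter⁺ (λ x → pow x c ≟ pow δ c) (sub-unique m)) to from
    where
    β^ic : ∀ i → pow (pow β i) c ≡ 1#
    β^ic i = trans (pow-comm β i c) (trans (cong (λ z → pow z i) (proj₁ order-β)) (pow-1# i))
    to : ∀ {x} → x ∈ map (λ i → δ ⊗ pow β i) (upTo c) → x ∈ filter (λ x → pow x c ≟ pow δ c) K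
    to x∈ with ∈-map⁻ (λ i → δ ⊗ pow β i) x∈
    ... | i , _ , refl = ∈-filter⁺ (λ x → pow x c ≟ pow δ c) (∈sub⁺ {m} (Sub-⊗ m sδ (Sub-pow m i β-Sub)))
          (trans (pow-⊗ δ (pow β i) c) (trans (cong (pow δ c ⊗_) (β^ic i)) (*-identityʳ _)))
    from : ∀ {x} → x ∈ filter (λ x → pow x c ≟ pow δ c) K → x ∈ map (λ i → δ ⊗ pow β i) (upTo c)
    from {x} x∈ with ∈-map⁻ (pow (pow ω (U.L * 4))) (roots-of-unity (U.L * 4) c 0<c L4c≡M {inv δ ⊗ x} yᶜ≡1)
      where
      L4c≡M : U.L * 4 * c ≡ M
      L4c≡M = trans (ℕₚ.*-assoc U.L 4 c) (trans (cong (U.L *_) (sym 4c≡N)) U.L*N≡M)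
      yᶜ≡1 : pow (inv δ ⊗ x) c ≡ 1#
      yᶜ≡1 = trans (pow-⊗ (inv δ) x c) (trans (cong (pow (inv δ) c ⊗_) (proj₂ (∈-filter⁻ (λ x → pow x c ≟ pow δ c) {xs = K} x∈)))
               (trans (sym (pow-⊗ (inv δ) δ c)) (trans (cong (λ z → pow z c) (inv-l δ≢0)) (pow-1# c))))
    ... | i , i∈ , e = subst (_∈ map (λ i → δ ⊗ pow β i) (upTo c))
          (trans (cong (δ ⊗_) (trans (cong (λ z → pow z i) (sym (pow-* ω U.L 4))) (sym e))) (inv-cancelˡ x δ≢0))
          (∈-map⁺ (λ i → δ ⊗ pow β i) i∈)

  W : Carrier → ℕ
  W δ = ∑ⁿ (upTo c) (λ i → 𝟙ⁿ (¬? (tr m (δ ⊗ pow β i) ≟ 0#)))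

  W-0 : W 0# ≡ 0
  W-0 = ℕ∑.∑-zero (upTo c) (λ i _ → ℕ∑.𝟙-no (¬? (tr m (0# ⊗ pow β i) ≟ 0#)) (λ ne → ne (trans (cong (tr m) (zeroˡ _)) (tr-0 m))))

  -- For z a power of ι, this is p - 1 times the quartic Gaussian period of the class x^c = z, since
  -- 𝔽_p^* preserves the class.
  Ecl : Carrier → ℤ
  Ecl z = E[ m ] (λ x → 𝟙ᶻ (pow x c ≟ z))

  Ecl-coset : ∀ {δ} → δ ≢ 0# → Sub m δ → Ecl (pow δ c) ≡ ∑ᶻ (upTo c) (λ i → ε (tr m (δ ⊗ pow β i)))
  Ecl-coset {δ} δ≢0 sδ = trans (sym (ℤ∑.∑-filter (λ x → pow x c ≟ pow δ c) K (λ x → ε (tr m x))))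
    (trans (sym (ℤ∑.∑-↭ (coset-↭ δ≢0 sδ) (λ x → ε (tr m x)))) (ℤ∑.∑-map (λ i → δ ⊗ pow β i) (upTo c) (λ x → ε (tr m x))))

  pos-∑ : ∀ {X : Set} (xs : List X) (f : X → ℕ) → pos (∑ⁿ xs f) ≡ ∑ᶻ xs (λ x → pos (f x))
  pos-∑ []       f = refl
  pos-∑ (x ∷ xs) f = trans (ℤₚ.pos-+ (f x) (∑ⁿ xs f)) (cong (pos (f x) +ᶻ_) (pos-∑ xs f))

  -- p · [u ≠ 0] = (p - 1) - ε u, summed over the traces u of the c elements in the class of δ.
  p*W : ∀ {δ} → δ ≢ 0# → Sub m δ → pos p *ᶻ pos (W δ) ≡ p-1 *ᶻ pos c -ᶻ Ecl (pow δ c)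
  p*W {δ} δ≢0 sδ = begin
    pos p *ᶻ pos (W δ)
      ≡⟨ cong (pos p *ᶻ_) (pos-∑ (upTo c) _) ⟩
    pos p *ᶻ ∑ᶻ (upTo c) (λ i → pos (𝟙ⁿ (¬? (x i ≟ 0#))))
      ≡⟨ ℤ∑.∑-⊗ˡ (upTo c) (pos p) _ ⟨
    ∑ᶻ (upTo c) (λ i → pos p *ᶻ pos (𝟙ⁿ (¬? (x i ≟ 0#))))
      ≡⟨ ℤ∑.∑-cong′ (upTo c) (λ i → trans (cong (pos p *ᶻ_) (complement (x i ≟ 0#))) (lem (pos p) (𝟙ᶻ (x i ≟ 0#)))) ⟩
    ∑ᶻ (upTo c) (λ i → p-1 +ᶻ -1ℤ *ᶻ ε (x i))
      ≡⟨ trans (ℤ∑.∑-⊕ (upTo c) _ _) (cong₂ _+ᶻ_ (trans (ℤ∑.∑-const (upTo c) p-1) (cong (_*ᶻ p-1) (trans (ℤnat (length (upTo c))) (cong pos (length-upTo c))))) (ℤ∑.∑-⊗ˡ (upTo c) -1ℤ _)) ⟩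
    pos c *ᶻ p-1 +ᶻ -1ℤ *ᶻ ∑ᶻ (upTo c) (λ i → ε (x i))
      ≡⟨ cong (λ z → pos c *ᶻ p-1 +ᶻ -1ℤ *ᶻ z) (Ecl-coset δ≢0 sδ) ⟨
    pos c *ᶻ p-1 +ᶻ -1ℤ *ᶻ Ecl (pow δ c)
      ≡⟨ lem′ (pos c) p-1 (Ecl (pow δ c)) ⟩
    p-1 *ᶻ pos c -ᶻ Ecl (pow δ c) ∎
    where
    open ≡-Reasoning
    x : ℕ → Carrier
    x i = tr m (δ ⊗ pow β i)
    complement : ∀ {P : Set} (D : Dec P) → pos (𝟙ⁿ (¬? D)) ≡ 1ℤ -ᶻ 𝟙ᶻ D
    complement (yes _) = refl
    complement (no _)  = refl
    lem : ∀ p i → p *ᶻ (1ℤ -ᶻ i) ≡ (p +ᶻ -1ℤ) +ᶻ -1ℤ *ᶻ (p *ᶻ i +ᶻ -1ℤ)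
    lem = solveℤ
    lem′ : ∀ c P E → c *ᶻ P +ᶻ -1ℤ *ᶻ E ≡ P *ᶻ c -ᶻ E
    lem′ = solveℤ

  private
    q-⊖ : ∀ {z} → Quart z → Quart (⊖ z)
    q-⊖ q0  = subst Quart (sym -0#≈0#) q0
    q-⊖ q1  = q-1
    q-⊖ qι  = q-ι
    q-⊖ q-1 = subst Quart (sym (-‿involutive 1#)) q1
    q-⊖ q-ι = subst Quart (sym (-‿involutive ι)) qι

    q-ι⊗ : ∀ {z} → Quart z → Quart (ι ⊗ z)
    q-ι⊗ q0  = subst Quart (sym (zeroʳ ι)) q0
    q-ι⊗ q1  = subst Quart (sym (*-identityʳ ι)) qι
    q-ι⊗ qι  = subst Quart (sym ι⊗ι) q-1
    q-ι⊗ q-1 = subst Quart (trans (⊖≡⊖1⊗ ι) (*-comm (⊖ 1#) ι)) q-ι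
    q-ι⊗ q-ι = subst Quart (sym ι⊗⊖ι) q1

    -- Fourier inversion on a group of order 4: the indicator of a class is a quarter of 1 + χ² + (χ
    -- + its conjugate), up to twists, and the last bracket is 2r. Only the class of 1 needs a case
    -- check; the others follow by multiplying with -1 and ι.
    quad : ℤ → ℤ → ℤ → ℤ
    quad n s r = n +ᶻ s +ᶻ pos 2 *ᶻ r

    class-1 : ∀ {z} → Quart z → pos 4 *ᶻ 𝟙ᶻ (z ≟ 1#) ≡ quad (nz z) (R (z ⊗ z)) (R z)
    class-1 q0  = trans (cong (pos 4 *ᶻ_) (ℤ∑.𝟙-no (0# ≟ 1#) 0#≢1#)) (sym (trans (cong₂ (λ s r → quad (nz 0#) s r) (trans (cong R (zeroˡ 0#)) R-0) R-0) (cong (λ n → quad n 0ℤ 0ℤ) nz-0)))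
    class-1 q1  = trans (cong (pos 4 *ᶻ_) (ℤ∑.𝟙-yes (1# ≟ 1#) refl)) (sym (trans (cong₂ (λ s r → quad (nz 1#) s r) (trans (cong R (*-identityˡ 1#)) R-1) R-1) (cong (λ n → quad n 1ℤ 1ℤ) (nz-≢0 1≢0))))
    class-1 qι  = trans (cong (pos 4 *ᶻ_) (ℤ∑.𝟙-no (ι ≟ 1#) ι≢1)) (sym (trans (cong₂ (λ s r → quad (nz ι) s r) (trans (cong R ι⊗ι) R-⊖1) R-ι) (cong (λ n → quad n -1ℤ 0ℤ) (nz-≢0 ι≢0))))
    class-1 q-1 = trans (cong (pos 4 *ᶻ_) (ℤ∑.𝟙-no ((⊖ 1#) ≟ 1#) (1≢⊖1 ∘ sym))) (sym (trans (cong₂ (λ s r → quad (nz (⊖ 1#)) s r) (trans (cong R ⊖1⊗⊖1) R-1) R-⊖1) (cong (λ n → quad n 1ℤ -1ℤ) (nz-≢0 (⊖≢0 1≢0)))))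
    class-1 q-ι = trans (cong (pos 4 *ᶻ_) (ℤ∑.𝟙-no ((⊖ ι) ≟ 1#) (λ e → ι≢⊖1 (trans (sym (-‿involutive ι)) (cong ⊖_ e)))))
      (sym (trans (cong₂ (λ s r → quad (nz (⊖ ι)) s r) (trans (cong R (trans (sym (-‿distribˡ-* ι (⊖ ι))) (cong ⊖_ ι⊗⊖ι))) R-⊖1) R-⊖ι) (cong (λ n → quad n -1ℤ 0ℤ) (nz-≢0 (⊖≢0 ι≢0)))))

    ⊖⊗⊖ : ∀ z → ⊖ z ⊗ ⊖ z ≡ z ⊗ z
    ⊖⊗⊖ z = trans (sym (-‿distribˡ-* z (⊖ z))) (trans (cong ⊖_ (sym (-‿distribʳ-* z z))) (-‿involutive (z ⊗ z)))

    nz-⊖ : ∀ z → nz (⊖ z) ≡ nz z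
    nz-⊖ z = cong (1ℤ -ᶻ_) (ℤ∑.𝟙-cong ((⊖ z) ≟ 0#) (z ≟ 0#) (λ e → decidable-stable (z ≟ 0#) (λ ne → ⊖≢0 ne e)) (λ e → trans (cong ⊖_ e) -0#≈0#))

    nz-ι⊗ : ∀ z → nz (ι ⊗ z) ≡ nz z
    nz-ι⊗ z = cong (1ℤ -ᶻ_) (ℤ∑.𝟙-cong ((ι ⊗ z) ≟ 0#) (z ≟ 0#) (λ e → ⊗-cancelˡ ι≢0 (trans e (sym (zeroʳ ι)))) (λ e → trans (cong (ι ⊗_) e) (zeroʳ ι)))

    R[ιz⊗ιz] : ∀ z → R ((ι ⊗ z) ⊗ (ι ⊗ z)) ≡ ⁻ R (z ⊗ z)
    R[ιz⊗ιz] z = trans (cong R (trans (⊗-interchange ι z ι z) (trans (cong (_⊗ (z ⊗ z)) ι⊗ι) (sym (⊖≡⊖1⊗ (z ⊗ z)))))) (R-⊖ (z ⊗ z))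

    quad-cong : ∀ {n n′ s s′ r r′} → n ≡ n′ → s ≡ s′ → r ≡ r′ → quad n s r ≡ quad n′ s′ r′
    quad-cong refl refl refl = refl

    class-⊖1 : ∀ {z} → Quart z → pos 4 *ᶻ 𝟙ᶻ (z ≟ (⊖ 1#)) ≡ quad (nz z) (R (z ⊗ z)) (⁻ R z)
    class-⊖1 {z} q = trans (cong (pos 4 *ᶻ_) (ℤ∑.𝟙-cong (z ≟ (⊖ 1#)) ((⊖ z) ≟ 1#) (λ e → trans (cong ⊖_ e) (-‿involutive 1#)) (λ e → trans (sym (-‿involutive z)) (cong ⊖_ e))))
      (trans (class-1 (q-⊖ q)) (quad-cong (nz-⊖ z) (cong R (⊖⊗⊖ z)) (R-⊖ z)))

    class-⊖ι : ∀ {z} → Quart z → pos 4 *ᶻ 𝟙ᶻ (z ≟ (⊖ ι)) ≡ quad (nz z) (⁻ R (z ⊗ z)) (⁻ I z)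
    class-⊖ι {z} q = trans (cong (pos 4 *ᶻ_) (ℤ∑.𝟙-cong (z ≟ (⊖ ι)) ((ι ⊗ z) ≟ 1#) (λ e → trans (cong (ι ⊗_) e) ι⊗⊖ι) (λ e → ⊗-cancelˡ ι≢0 (trans e (sym ι⊗⊖ι)))))
      (trans (class-1 (q-ι⊗ q)) (quad-cong (nz-ι⊗ z) (R[ιz⊗ιz] z) (R-ι⊗ z)))

    class-ι : ∀ {z} → Quart z → pos 4 *ᶻ 𝟙ᶻ (z ≟ ι) ≡ quad (nz z) (⁻ R (z ⊗ z)) (I z)
    class-ι {z} q = trans (cong (pos 4 *ᶻ_) (ℤ∑.𝟙-cong (z ≟ ι) ((ι ⊗ z) ≟ (⊖ 1#)) (λ e → trans (cong (ι ⊗_) e) ι⊗ι) (λ e → ⊗-cancelˡ ι≢0 (trans e (sym ι⊗ι)))))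
      (trans (class-⊖1 (q-ι⊗ q)) (quad-cong (nz-ι⊗ z) (R[ιz⊗ιz] z) (trans (cong ⁻_ (R-ι⊗ z)) (ℤₚ.neg-involutive (I z)))))

    E-quad : ∀ z₀ (σ τ : ℤ) (χ : Carrier → ℤ) →
      (∀ {x} → Sub m x → pos 4 *ᶻ 𝟙ᶻ (pow x c ≟ z₀) ≡ quad (nz (pow x c)) (σ *ᶻ R (pow x c ⊗ pow x c)) (τ *ᶻ χ x)) →
      pos 4 *ᶻ Ecl z₀ ≡ ⁻ p-1 +ᶻ σ *ᶻ Eρ +ᶻ pos 2 *ᶻ (τ *ᶻ E[ m ] χ)
    E-quad z₀ σ τ χ pointwise = begin
      pos 4 *ᶻ Ecl z₀
        ≡⟨ ℤ∑.∑-⊗ˡ K (pos 4) _ ⟨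
      ∑ᶻ K (λ x → pos 4 *ᶻ (𝟙ᶻ (pow x c ≟ z₀) *ᶻ ε (tr m x)))
        ≡⟨ ℤ∑.∑-cong K (λ x x∈ → trans (sym (ℤₚ.*-assoc (pos 4) (𝟙ᶻ (pow x c ≟ z₀)) (ε (tr m x)))) (trans (cong (_*ᶻ ε (tr m x)) (trans (pointwise (∈sub⁻ {m} x∈)) (quad-cong (nz-pow x) (cong (σ *ᶻ_) (cong R (sym (pow-2c x)))) refl))) (lem (nz x) σ (ρ x) τ (χ x) (ε (tr m x))))) ⟩
      ∑ᶻ K (λ x → nz x *ᶻ ε (tr m x) +ᶻ (σ *ᶻ (ρ x *ᶻ ε (tr m x)) +ᶻ (pos 2 *ᶻ τ) *ᶻ (χ x *ᶻ ε (tr m x))))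
        ≡⟨ trans (ℤ∑.∑-⊕ K _ _) (cong (E[ m ] nz +ᶻ_) (trans (ℤ∑.∑-⊕ K _ _) (cong₂ _+ᶻ_ (ℤ∑.∑-⊗ˡ K σ _) (ℤ∑.∑-⊗ˡ K (pos 2 *ᶻ τ) _)))) ⟩
      E[ m ] nz +ᶻ (σ *ᶻ Eρ +ᶻ (pos 2 *ᶻ τ) *ᶻ E[ m ] χ)
        ≡⟨ cong (λ z → z +ᶻ (σ *ᶻ Eρ +ᶻ (pos 2 *ᶻ τ) *ᶻ E[ m ] χ)) E-nz ⟩
      ⁻ p-1 +ᶻ (σ *ᶻ Eρ +ᶻ (pos 2 *ᶻ τ) *ᶻ E[ m ] χ)
        ≡⟨ lem′ (⁻ p-1) (σ *ᶻ Eρ) τ (E[ m ] χ) ⟩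
      ⁻ p-1 +ᶻ σ *ᶻ Eρ +ᶻ pos 2 *ᶻ (τ *ᶻ E[ m ] χ) ∎
      where
      open ≡-Reasoning
      lem : ∀ n σ r τ x e → (n +ᶻ σ *ᶻ r +ᶻ pos 2 *ᶻ (τ *ᶻ x)) *ᶻ e ≡ n *ᶻ e +ᶻ (σ *ᶻ (r *ᶻ e) +ᶻ (pos 2 *ᶻ τ) *ᶻ (x *ᶻ e))
      lem = solveℤ
      lem′ : ∀ a b t x → a +ᶻ (b +ᶻ (pos 2 *ᶻ t) *ᶻ x) ≡ a +ᶻ b +ᶻ pos 2 *ᶻ (t *ᶻ x)
      lem′ = solveℤ

    1* : ∀ x → x ≡ 1ℤ *ᶻ x
    1* x = sym (ℤₚ.*-identityˡ x)
    -1* : ∀ x → ⁻ x ≡ -1ℤ *ᶻ x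
    -1* x = sym (ℤₚ.-1*i≡-i x)

  Ecl-1 : pos 4 *ᶻ Ecl 1# ≡ ⁻ p-1 +ᶻ 1ℤ *ᶻ Eρ +ᶻ pos 2 *ᶻ (1ℤ *ᶻ ER)
  Ecl-1 = E-quad 1# 1ℤ 1ℤ χR (λ {x} sx → trans (class-1 (quart sx)) (cong₂ (quad (nz (pow x c))) (1* (R (pow x c ⊗ pow x c))) (1* (χR x))))

  Ecl-⊖1 : pos 4 *ᶻ Ecl (⊖ 1#) ≡ ⁻ p-1 +ᶻ 1ℤ *ᶻ Eρ +ᶻ pos 2 *ᶻ (-1ℤ *ᶻ ER)
  Ecl-⊖1 = E-quad (⊖ 1#) 1ℤ -1ℤ χR (λ {x} sx → trans (class-⊖1 (quart sx)) (cong₂ (quad (nz (pow x c))) (1* (R (pow x c ⊗ pow x c))) (-1* (χR x))))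

  Ecl-ι : pos 4 *ᶻ Ecl ι ≡ ⁻ p-1 +ᶻ -1ℤ *ᶻ Eρ +ᶻ pos 2 *ᶻ (1ℤ *ᶻ EI)
  Ecl-ι = E-quad ι -1ℤ 1ℤ χI (λ {x} sx → trans (class-ι (quart sx)) (cong₂ (quad (nz (pow x c))) (-1* (R (pow x c ⊗ pow x c))) (1* (χI x))))

  Ecl-⊖ι : pos 4 *ᶻ Ecl (⊖ ι) ≡ ⁻ p-1 +ᶻ -1ℤ *ᶻ Eρ +ᶻ pos 2 *ᶻ (-1ℤ *ᶻ EI)
  Ecl-⊖ι = E-quad (⊖ ι) -1ℤ -1ℤ χI (λ {x} sx → trans (class-⊖ι (quart sx)) (cong₂ (quad (nz (pow x c))) (-1* (R (pow x c ⊗ pow x c))) (-1* (χI x))))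

  -- i ↦ tr(β^i) vanishes with period c′, because β^c′ generates 𝔽_p^*.
  Ecl-divisible : ∃ λ η → Ecl 1# ≡ p-1 *ᶻ η
  Ecl-divisible = ∑ᶻ (upTo c′) f , (begin
    Ecl 1#                                                      ≡⟨ cong Ecl (pow-1# c) ⟨
    Ecl (pow 1# c)                                              ≡⟨ Ecl-coset 1≢0 (Sub-1 m) ⟩
    ∑ᶻ (upTo c) f                                               ≡⟨ cong (λ n → ∑ᶻ (upTo n) f) (trans c≡c′[p∸1] (ℕₚ.*-comm c′ (p ∸ 1))) ⟩
    ∑ᶻ (upTo ((p ∸ 1) * c′)) f                                  ≡⟨ ℤ∑.∑-upTo-* (p ∸ 1) c′ f ⟩
    ∑ᶻ (upTo (p ∸ 1)) (λ i → ∑ᶻ (upTo c′) (λ j → f (i * c′ + j))) ≡⟨ ℤ∑.∑-cong′ (upTo (p ∸ 1)) (λ i → ℤ∑.∑-cong′ (upTo c′) (periodic i)) ⟩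
    ∑ᶻ (upTo (p ∸ 1)) (λ _ → ∑ᶻ (upTo c′) f)                    ≡⟨ ℤ∑.∑-const (upTo (p ∸ 1)) _ ⟩
    ℤ∑.nat (length (upTo (p ∸ 1))) *ᶻ ∑ᶻ (upTo c′) f            ≡⟨ cong (_*ᶻ ∑ᶻ (upTo c′) f) (trans (ℤnat (length (upTo (p ∸ 1)))) (trans (cong pos (length-upTo (p ∸ 1))) pos-p∸1)) ⟩
    p-1 *ᶻ ∑ᶻ (upTo c′) f                                       ∎)
    where
    open ≡-Reasoning
    f : ℕ → ℤ
    f i = ε (tr m (1# ⊗ pow β i))
    b = pow β c′
    module Fp = Units 1 E (s≤s z≤n) (ℕₚ.*-identityʳ E)
    b-Sub : Sub 1 b
    b-Sub = Fp.powN⇒Sub (trans (cong (λ k → pow b (k ∸ 1)) (ℕₚ.*-identityʳ p)) (trans (sym (pow-* β c′ (p ∸ 1))) (trans (cong (pow β) (sym c≡c′[p∸1])) (proj₁ order-β))))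
    ε-unit : ∀ {a} → a ≢ 0# → ∀ u → ε (a ⊗ u) ≡ ε u
    ε-unit {a} a≢0 u = cong (λ z → pos p *ᶻ z +ᶻ -1ℤ) (ℤ∑.𝟙-cong ((a ⊗ u) ≟ 0#) (u ≟ 0#) (λ e → ⊗-cancelˡ a≢0 (trans e (sym (zeroʳ a)))) (λ e → trans (cong (a ⊗_) e) (zeroʳ a)))
    periodic : ∀ i j → f (i * c′ + j) ≡ f j
    periodic i j = begin
      ε (tr m (1# ⊗ pow β (i * c′ + j)))          ≡⟨ cong (λ z → ε (tr m z)) (trans (*-identityˡ _) (trans (pow-+ β (i * c′) j) (cong₂ _⊗_ (trans (cong (pow β) (ℕₚ.*-comm i c′)) (pow-* β c′ i)) (sym (*-identityˡ _))))) ⟩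
      ε (tr m (pow b i ⊗ (1# ⊗ pow β j)))         ≡⟨ cong ε (tr-scale m (1# ⊗ pow β j) (Sub-pow 1 i b-Sub)) ⟩
      ε (pow b i ⊗ tr m (1# ⊗ pow β j))           ≡⟨ ε-unit (pow≢0 i (pow≢0 c′ β≢0)) _ ⟩
      f j                                         ∎

  -- β already has m distinct conjugates over 𝔽_p: as p ≥ 5, 4(p^j - 1) + 1 < 5 p^j ≤ p^m = 4c + 1
  -- for j < m, so for 0 < j < m the order c of β exceeds p^j - 1 and cannot divide it.
  tr-β-injective : ∀ δ → (∀ i → i < c → tr m (δ ⊗ pow β i) ≡ 0#) → δ ≡ 0#
  tr-β-injective = tr-nondegenerate m 0<m c β≢0 (proj₁ order-β) p∤c distinct
    where
    p∤c : ¬ p ∣ c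
    p∤c p∣c = U.p∤N (subst (p ∣_) (sym 4c≡N) (∣n⇒∣m*n 4 p∣c))
    0<d : 0 < d
    0<d = ℕₚ.n≢0⇒n>0 (λ { refl → ℕₚ.<⇒≢ (prime>1 pr) (sym p-eq) })
    small : ∀ j → j < m → p ^ j ∸ 1 < c
    small j j<m = ℕₚ.*-cancelˡ-< 4 _ c (ℕₚ.+-cancelʳ-< 1 _ _ (begin-strict
      4 * x + 1               <⟨ ℕₚ.+-monoʳ-< (4 * x) (s≤s (s≤s z≤n)) ⟩
      4 * x + 5               ≤⟨ ℕₚ.+-monoˡ-≤ 5 (ℕₚ.*-monoˡ-≤ x {4} {5} (s≤s (s≤s (s≤s (s≤s z≤n))))) ⟩
      5 * x + 5               ≡⟨ lem x ⟩
      5 * (1 + x)             ≡⟨ cong (5 *_) (ℕₚ.m+[n∸m]≡n (0<p^ j)) ⟩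
      5 * p ^ j               ≤⟨ ℕₚ.*-monoˡ-≤ (p ^ j) 5≤p ⟩
      p * p ^ j               ≤⟨ ℕₚ.^-monoʳ-≤ p {{prime⇒nonZero pr}} j<m ⟩
      p ^ m                   ≡⟨ c-eq ⟨
      4 * c + 1               ∎))
      where
      open ℕₚ.≤-Reasoning
      x = p ^ j ∸ 1
      lem : ∀ x → 5 * x + 5 ≡ 5 * (1 + x)
      lem = solve-∀
      5≤p : 5 ≤ p
      5≤p = subst (5 ≤_) (sym p-eq) (ℕₚ.+-monoˡ-≤ 1 (ℕₚ.*-monoʳ-≤ 4 0<d))
    distinct : ∀ j → 0 < j → j < m → pow β (p ^ j ∸ 1) ≢ 1#
    distinct j 0<j j<m q = not-divisible (p ^ j ∸ 1) (small j j<m) positive (proj₂ order-β (p ^ j ∸ 1) q)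
      where
      positive : 0 < p ^ j ∸ 1
      positive = ℕₚ.m<n⇒0<n∸m (ℕₚ.^-monoʳ-< p (prime>1 pr) 0<j)
      not-divisible : ∀ k → k < c → 0 < k → ¬ c ∣ k
      not-divisible (suc k) lt _ c∣ = ℕₚ.<⇒≱ lt (∣⇒≤ c∣)

  -- The shape of the quartic Gauss sum and the weights of the classes.

  T : ℤ
  T = pos (p ^ t)

  T*T≡s : T *ᶻ T ≡ pos s
  T*T≡s = trans (sym (ℤₚ.pos-* (p ^ t) (p ^ t))) (cong pos (trans (sym (ℕₚ.^-distribˡ-+-* p t t)) (cong (λ k → p ^ (t + k)) (sym (ℕₚ.+-identityʳ t)))))

  q≡ : pos (p ^ m) ≡ (T *ᶻ T) *ᶻ (T *ᶻ T)
  q≡ = trans (cong pos (sym s*s≡q)) (trans (ℤₚ.pos-* s s) (sym (cong₂ _*ᶻ_ T*T≡s T*T≡s)))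

  q≡4c+1 : pos (p ^ m) ≡ pos 4 *ᶻ pos c +ᶻ 1ℤ
  q≡4c+1 = trans (cong pos (sym c-eq)) (trans (ℤₚ.pos-+ (4 * c) 1) (cong (_+ᶻ 1ℤ) (ℤₚ.pos-* 4 c)))

  s≡4j+1 : pos s ≡ pos 4 *ᶻ pos j +ᶻ 1ℤ
  s≡4j+1 = trans (cong pos (sym s-eq)) (trans (ℤₚ.pos-+ (4 * j) 1) (cong (_+ᶻ 1ℤ) (ℤₚ.pos-* 4 j)))

  -- G = p^t (a + 2 b i) with ER + EI i = (p - 1) G. The signs of a and b depend on ω; here a is
  -- merely odd, and its residue modulo 4 is fixed later.
  record QuarticSum : Set where
    field
      a b      : ℤ
      norm     : a *ᶻ a +ᶻ (pos 2 *ᶻ b) *ᶻ (pos 2 *ᶻ b) ≡ pos s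
      p∤a      : ¬ pos p ∣ᶻ a
      a-odd    : ∃ λ k → a ≡ pos 2 *ᶻ k +ᶻ 1ℤ
      ER≡      : ER ≡ a *ᶻ (p-1 *ᶻ T)
      EI≡      : EI ≡ (pos 2 *ᶻ b) *ᶻ (p-1 *ᶻ T)

  private
    instance
      p-1≢0 : ℤ.NonZero p-1
      p-1≢0 = subst ℤ.NonZero pos-p∸1 (>-nonZero (ℕₚ.m<n⇒0<n∸m (prime>1 pr)))
      T≢0 : ℤ.NonZero T
      T≢0 = ℕₚ.m^n≢0 p t {{prime⇒nonZero pr}}

    p∣T : pos p ∣ᶻ T
    p∣T = ∣ᵤ⇒∣ (subst (λ z → p ∣ p ^ z) (ℕₚ.suc-pred t {{>-nonZero 0<t}}) (m∣m*n (p ^ pred t)))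

    extracted : ∃₂ λ a b → ER ≡ a *ᶻ (p-1 *ᶻ T) × EI ≡ b *ᶻ (p-1 *ᶻ T) × a *ᶻ a +ᶻ b *ᶻ b ≡ T *ᶻ T × ¬ pos p ∣ᶻ a
    extracted = gauss-extract pr T p-1 ER EI JR JI p∣T
      (trans E-norm (cong (_*ᶻ (p-1 *ᶻ p-1)) q≡))
      (trans E-real (trans (cong (λ z → p-1 *ᶻ (JR *ᶻ z)) Eρ≡) (trans (lem p-1 JR (pos s)) (cong (λ z → ⁻ (z *ᶻ (p-1 *ᶻ p-1) *ᶻ JR)) (sym T*T≡s)))))
      (trans E-imag (trans (cong (λ z → p-1 *ᶻ (JI *ᶻ z)) Eρ≡) (trans (lem p-1 JI (pos s)) (cong (λ z → ⁻ (z *ᶻ (p-1 *ᶻ p-1) *ᶻ JI)) (sym T*T≡s)))))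
      J-nondivisible
      where
      lem : ∀ P J s → P *ᶻ (J *ᶻ ⁻ (s *ᶻ P)) ≡ ⁻ (s *ᶻ (P *ᶻ P) *ᶻ J)
      lem = solveℤ

    -- The period η of the fourth powers is an integer with 4η = -1 - s + 2aT. Substituting s = 4j +
    -- 1 and halving leaves an odd value for aT. This decides which of the two squares in s is the
    -- odd one.
    aT-odd : ∀ a → ER ≡ a *ᶻ (p-1 *ᶻ T) → ∀ η → Ecl 1# ≡ p-1 *ᶻ η → pos 2 *ᶻ (η +ᶻ pos j) +ᶻ 1ℤ ≡ a *ᶻ T
    aT-odd a ER≡ η e = cancel-2 (trans (l₁ η (pos j)) (trans (cong (λ z → pos 4 *ᶻ η +ᶻ z +ᶻ 1ℤ) (sym s≡4j+1)) (trans (cong (λ z → z +ᶻ pos s +ᶻ 1ℤ) 4η≡) (l₂ (pos s) (a *ᶻ T)))))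
      where
      open ≡-Reasoning
      l₁ : ∀ η j → pos 2 *ᶻ (pos 2 *ᶻ (η +ᶻ j) +ᶻ 1ℤ) ≡ pos 4 *ᶻ η +ᶻ (pos 4 *ᶻ j +ᶻ 1ℤ) +ᶻ 1ℤ
      l₁ = solveℤ
      l₂ : ∀ s x → (-1ℤ -ᶻ s +ᶻ pos 2 *ᶻ x) +ᶻ s +ᶻ 1ℤ ≡ pos 2 *ᶻ x
      l₂ = solveℤ
      l₃ : ∀ P η → P *ᶻ (pos 4 *ᶻ η) ≡ pos 4 *ᶻ (P *ᶻ η)
      l₃ = solveℤ
      l₄ : ∀ P s a T → ⁻ P +ᶻ 1ℤ *ᶻ ⁻ (s *ᶻ P) +ᶻ pos 2 *ᶻ (1ℤ *ᶻ (a *ᶻ (P *ᶻ T))) ≡ P *ᶻ (-1ℤ -ᶻ s +ᶻ pos 2 *ᶻ (a *ᶻ T))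
      l₄ = solveℤ
      4η≡ : pos 4 *ᶻ η ≡ -1ℤ -ᶻ pos s +ᶻ pos 2 *ᶻ (a *ᶻ T)
      4η≡ = ℤₚ.*-cancelˡ-≡ p-1 (pos 4 *ᶻ η) (-1ℤ -ᶻ pos s +ᶻ pos 2 *ᶻ (a *ᶻ T)) (begin
        p-1 *ᶻ (pos 4 *ᶻ η)                                       ≡⟨ l₃ p-1 η ⟩
        pos 4 *ᶻ (p-1 *ᶻ η)                                       ≡⟨ cong (pos 4 *ᶻ_) e ⟨
        pos 4 *ᶻ Ecl 1#                                           ≡⟨ Ecl-1 ⟩
        ⁻ p-1 +ᶻ 1ℤ *ᶻ Eρ +ᶻ pos 2 *ᶻ (1ℤ *ᶻ ER)                  ≡⟨ cong₂ (λ x y → ⁻ p-1 +ᶻ 1ℤ *ᶻ x +ᶻ pos 2 *ᶻ (1ℤ *ᶻ y)) Eρ≡ ER≡ ⟩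
        ⁻ p-1 +ᶻ 1ℤ *ᶻ ⁻ (pos s *ᶻ p-1) +ᶻ pos 2 *ᶻ (1ℤ *ᶻ (a *ᶻ (p-1 *ᶻ T))) ≡⟨ l₄ p-1 (pos s) a T ⟩
        p-1 *ᶻ (-1ℤ -ᶻ pos s +ᶻ pos 2 *ᶻ (a *ᶻ T))                ∎)

    odd-a : ∀ a → ER ≡ a *ᶻ (p-1 *ᶻ T) → ∃ λ k → a ≡ pos 2 *ᶻ k +ᶻ 1ℤ
    odd-a a ER≡ = by-parity (parity a) Ecl-divisible
      where
      by-parity : (∃ λ l → a ≡ pos 2 *ᶻ l) ⊎ (∃ λ l → a ≡ pos 2 *ᶻ l +ᶻ 1ℤ) → (∃ λ η → Ecl 1# ≡ p-1 *ᶻ η) → ∃ λ k → a ≡ pos 2 *ᶻ k +ᶻ 1ℤ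
      by-parity (inj₂ odd) _ = odd
      by-parity (inj₁ (l , e)) (η , eη) = ⊥-elim (odd≢even {η +ᶻ pos j} {l *ᶻ T} (trans (aT-odd a ER≡ η eη) (trans (cong (_*ᶻ T) e) (ℤₚ.*-assoc (pos 2) l T))))

    even-b : ∀ a b → a *ᶻ a +ᶻ b *ᶻ b ≡ pos s → (∃ λ k → a ≡ pos 2 *ᶻ k +ᶻ 1ℤ) → ∃ λ l → b ≡ pos 2 *ᶻ l
    even-b a b e (k , ak) = by-parity (parity b)
      where
      lem : ∀ k l → pos 2 *ᶻ (pos 2 *ᶻ (k *ᶻ k +ᶻ k) +ᶻ pos 2 *ᶻ (l *ᶻ l +ᶻ l) +ᶻ 1ℤ) ≡ (pos 2 *ᶻ k +ᶻ 1ℤ) *ᶻ (pos 2 *ᶻ k +ᶻ 1ℤ) +ᶻ (pos 2 *ᶻ l +ᶻ 1ℤ) *ᶻ (pos 2 *ᶻ l +ᶻ 1ℤ)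
      lem = solveℤ
      lem′ : ∀ j → pos 4 *ᶻ j +ᶻ 1ℤ ≡ pos 2 *ᶻ (pos 2 *ᶻ j) +ᶻ 1ℤ
      lem′ = solveℤ
      by-parity : (∃ λ l → b ≡ pos 2 *ᶻ l) ⊎ (∃ λ l → b ≡ pos 2 *ᶻ l +ᶻ 1ℤ) → ∃ λ l → b ≡ pos 2 *ᶻ l
      by-parity (inj₁ even) = even
      by-parity (inj₂ (l , bl)) = ⊥-elim (odd≢even {pos 2 *ᶻ pos j} (sym (trans (lem k l) (trans (cong₂ (λ x y → x *ᶻ x +ᶻ y *ᶻ y) (sym ak) (sym bl)) (trans e (trans s≡4j+1 (lem′ (pos j))))))))

  quarticSum : QuarticSum
  quarticSum = build extracted
    where
    finish : ∀ a b → ER ≡ a *ᶻ (p-1 *ᶻ T) → EI ≡ b *ᶻ (p-1 *ᶻ T) → a *ᶻ a +ᶻ b *ᶻ b ≡ pos s → ¬ pos p ∣ᶻ a → (∃ λ k → a ≡ pos 2 *ᶻ k +ᶻ 1ℤ) → (∃ λ l → b ≡ pos 2 *ᶻ l) → QuarticSum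
    finish a _ eR eI n p∤a odd (l , refl) = record { a = a ; b = l ; norm = n ; p∤a = p∤a ; a-odd = odd ; ER≡ = eR ; EI≡ = eI }
    build : (∃₂ λ a b → ER ≡ a *ᶻ (p-1 *ᶻ T) × EI ≡ b *ᶻ (p-1 *ᶻ T) × a *ᶻ a +ᶻ b *ᶻ b ≡ T *ᶻ T × ¬ pos p ∣ᶻ a) → QuarticSum
    build (a , b , eR , eI , n , p∤a) = finish a b eR eI n′ p∤a (odd-a a eR) (even-b a b n′ (odd-a a eR))
      where
      n′ : a *ᶻ a +ᶻ b *ᶻ b ≡ pos s
      n′ = trans n T*T≡s

  -- 4p times the weight of a class: σ is 1 on squares and -1 on nonsquares, and x is ±a or ±2b
  -- accordingly.
  numerator : ℤ → ℤ → ℤ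
  numerator σ x = p-1 *ᶻ (pos (p ^ m) +ᶻ σ *ᶻ pos s +ᶻ pos 2 *ᶻ (x *ᶻ T))

  private
    -- Weights count nonzero traces, so the period enters negatively and τ becomes -τ. The quadratic
    -- term keeps the sign σ, because the quadratic Gauss sum is itself negative. The trivial
    -- character supplies the 1 in 4c + 1 = q.
    weight-formula : ∀ {δ z₀} → δ ≢ 0# → Sub m δ → pow δ c ≡ z₀ → ∀ σ τ x G →
      pos 4 *ᶻ Ecl z₀ ≡ ⁻ p-1 +ᶻ σ *ᶻ Eρ +ᶻ pos 2 *ᶻ (τ *ᶻ G) → G ≡ x *ᶻ (p-1 *ᶻ T) →
      pos (4 * p * W δ) ≡ numerator σ (⁻ τ *ᶻ x)
    weight-formula {δ} {z₀} δ≢0 sδ refl σ τ x G eE eG = begin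
      pos (4 * p * W δ)                                    ≡⟨ trans (ℤₚ.pos-* (4 * p) (W δ)) (cong (_*ᶻ pos (W δ)) (ℤₚ.pos-* 4 p)) ⟩
      pos 4 *ᶻ pos p *ᶻ pos (W δ)                          ≡⟨ ℤₚ.*-assoc (pos 4) (pos p) (pos (W δ)) ⟩
      pos 4 *ᶻ (pos p *ᶻ pos (W δ))                        ≡⟨ cong (pos 4 *ᶻ_) (p*W δ≢0 sδ) ⟩
      pos 4 *ᶻ (p-1 *ᶻ pos c -ᶻ Ecl z₀)                    ≡⟨ l₁ p-1 (pos c) (Ecl z₀) ⟩
      p-1 *ᶻ (pos 4 *ᶻ pos c) -ᶻ pos 4 *ᶻ Ecl z₀           ≡⟨ cong (λ z → p-1 *ᶻ (pos 4 *ᶻ pos c) -ᶻ z) (trans eE (cong₂ (λ u v → ⁻ p-1 +ᶻ σ *ᶻ u +ᶻ pos 2 *ᶻ (τ *ᶻ v)) Eρ≡ eG)) ⟩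
      p-1 *ᶻ (pos 4 *ᶻ pos c) -ᶻ (⁻ p-1 +ᶻ σ *ᶻ ⁻ (pos s *ᶻ p-1) +ᶻ pos 2 *ᶻ (τ *ᶻ (x *ᶻ (p-1 *ᶻ T)))) ≡⟨ l₂ p-1 (pos 4 *ᶻ pos c) σ (pos s) τ x T ⟩
      p-1 *ᶻ ((pos 4 *ᶻ pos c +ᶻ 1ℤ) +ᶻ σ *ᶻ pos s +ᶻ pos 2 *ᶻ (⁻ τ *ᶻ x *ᶻ T)) ≡⟨ cong (λ z → p-1 *ᶻ (z +ᶻ σ *ᶻ pos s +ᶻ pos 2 *ᶻ (⁻ τ *ᶻ x *ᶻ T))) q≡4c+1 ⟨
      numerator σ (⁻ τ *ᶻ x)                               ∎
      where
      open ≡-Reasoning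
      l₁ : ∀ P c E → pos 4 *ᶻ (P *ᶻ c -ᶻ E) ≡ P *ᶻ (pos 4 *ᶻ c) -ᶻ pos 4 *ᶻ E
      l₁ = solveℤ
      l₂ : ∀ P c σ s τ x T → P *ᶻ c -ᶻ (⁻ P +ᶻ σ *ᶻ ⁻ (s *ᶻ P) +ᶻ pos 2 *ᶻ (τ *ᶻ (x *ᶻ (P *ᶻ T)))) ≡ P *ᶻ ((c +ᶻ 1ℤ) +ᶻ σ *ᶻ s +ᶻ pos 2 *ᶻ (⁻ τ *ᶻ x *ᶻ T))
      l₂ = solveℤ

  module Weights (Q : QuarticSum) where
    open QuarticSum Q

    W-1 : ∀ {δ} → δ ≢ 0# → Sub m δ → pow δ c ≡ 1# → pos (4 * p * W δ) ≡ numerator 1ℤ (⁻ 1ℤ *ᶻ a)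
    W-1 δ≢0 sδ e = weight-formula δ≢0 sδ e 1ℤ 1ℤ a ER Ecl-1 ER≡

    W-⊖1 : ∀ {δ} → δ ≢ 0# → Sub m δ → pow δ c ≡ ⊖ 1# → pos (4 * p * W δ) ≡ numerator 1ℤ (⁻ -1ℤ *ᶻ a)
    W-⊖1 δ≢0 sδ e = weight-formula δ≢0 sδ e 1ℤ -1ℤ a ER Ecl-⊖1 ER≡

    W-ι : ∀ {δ} → δ ≢ 0# → Sub m δ → pow δ c ≡ ι → pos (4 * p * W δ) ≡ numerator -1ℤ (⁻ 1ℤ *ᶻ (pos 2 *ᶻ b))
    W-ι δ≢0 sδ e = weight-formula δ≢0 sδ e -1ℤ 1ℤ (pos 2 *ᶻ b) EI Ecl-ι EI≡

    W-⊖ι : ∀ {δ} → δ ≢ 0# → Sub m δ → pow δ c ≡ ⊖ ι → pos (4 * p * W δ) ≡ numerator -1ℤ (⁻ -1ℤ *ᶻ (pos 2 *ᶻ b))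
    W-⊖ι δ≢0 sδ e = weight-formula δ≢0 sδ e -1ℤ -1ℤ (pos 2 *ᶻ b) EI Ecl-⊖ι EI≡

-- Counting words by their class profile.

words : {X : Set} → List X → ℕ → List (List X)
words K zero    = [] ∷ []
words K (suc r) = concatMap (λ x → map (x ∷_) (words K r)) K

inc₁ inc₂ inc₃ inc₄ : Tuple → Tuple
inc₁ (a , b , c , d) = (suc a , b , c , d)
inc₂ (a , b , c , d) = (a , suc b , c , d)
inc₃ (a , b , c , d) = (a , b , suc c , d)
inc₄ (a , b , c , d) = (a , b , c , suc d)

-- count c r Φ is the sum of Φ over the profiles of the words of length r in an alphabet with
-- one neutral letter and four classes of c letters each.
count : ℕ → ℕ → (Tuple → ℕ) → ℕ
count c zero    Φ = Φ (0 , 0 , 0 , 0)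
count c (suc r) Φ = count c r Φ + c * (count c r (Φ ∘ inc₁) + count c r (Φ ∘ inc₂) + count c r (Φ ∘ inc₃) + count c r (Φ ∘ inc₄))

private
  total-inc₂ : ∀ a b c d → a + suc b + c + d ≡ suc (a + b + c + d)
  total-inc₂ = solve-∀
  total-inc₃ : ∀ a b c d → a + b + suc c + d ≡ suc (a + b + c + d)
  total-inc₃ = solve-∀
  total-inc₄ : ∀ a b c d → a + b + c + suc d ≡ suc (a + b + c + d)
  total-inc₄ = solve-∀

  combine₅ : ∀ c {x x′ y y′ z z′ u u′ v v′} → x ≡ x′ → y ≡ y′ → z ≡ z′ → u ≡ u′ → v ≡ v′ →
             x + c * (y + z + u + v) ≡ x′ + c * (y′ + z′ + u′ + v′)
  combine₅ c refl refl refl refl refl = refl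

count-cong : ∀ c r {Φ Φ′ : Tuple → ℕ} → (∀ l → total l ≤ r → Φ l ≡ Φ′ l) → count c r Φ ≡ count c r Φ′
count-cong c zero    h = h _ z≤n
count-cong c (suc r) h = combine₅ c
  (count-cong c r (λ l le → h l (ℕₚ.m≤n⇒m≤1+n le)))
  (count-cong c r (λ l le → h (inc₁ l) (s≤s le)))
  (count-cong c r (λ { l@(x , y , z , w) le → h (inc₂ l) (subst (_≤ suc r) (sym (total-inc₂ x y z w)) (s≤s le)) }))
  (count-cong c r (λ { l@(x , y , z , w) le → h (inc₃ l) (subst (_≤ suc r) (sym (total-inc₃ x y z w)) (s≤s le)) }))
  (count-cong c r (λ { l@(x , y , z , w) le → h (inc₄ l) (subst (_≤ suc r) (sym (total-inc₄ x y z w)) (s≤s le)) }))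

count-0 : ∀ c r {Φ : Tuple → ℕ} → (∀ l → total l ≤ r → Φ l ≡ 0) → count c r Φ ≡ 0
count-0 c r h = trans (count-cong c r h) (zero-functional c r)
  where
  zero-functional : ∀ c r → count c r (λ _ → 0) ≡ 0
  zero-functional c zero = refl
  zero-functional c (suc r) = trans (combine₅ c z z z z z) (ℕₚ.*-zeroʳ c)
    where z = zero-functional c r

count-+ : ∀ c r (Φ Φ′ : Tuple → ℕ) → count c r (λ l → Φ l + Φ′ l) ≡ count c r Φ + count c r Φ′
count-+ c zero    Φ Φ′ = refl
count-+ c (suc r) Φ Φ′ = trans (combine₅ c (count-+ c r Φ Φ′) (count-+ c r (Φ ∘ inc₁) (Φ′ ∘ inc₁)) (count-+ c r (Φ ∘ inc₂) (Φ′ ∘ inc₂)) (count-+ c r (Φ ∘ inc₃) (Φ′ ∘ inc₃)) (count-+ c r (Φ ∘ inc₄) (Φ′ ∘ inc₄)))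
  (lem c (count c r Φ) (count c r Φ′) (count c r (Φ ∘ inc₁)) (count c r (Φ′ ∘ inc₁)) (count c r (Φ ∘ inc₂)) (count c r (Φ′ ∘ inc₂)) (count c r (Φ ∘ inc₃)) (count c r (Φ′ ∘ inc₃)) (count c r (Φ ∘ inc₄)) (count c r (Φ′ ∘ inc₄)))
  where
  lem : ∀ c x x′ y y′ z z′ u u′ v v′ → (x + x′) + c * ((y + y′) + (z + z′) + (u + u′) + (v + v′)) ≡ (x + c * (y + z + u + v)) + (x′ + c * (y′ + z′ + u′ + v′))
  lem = solve-∀

count-*ʳ : ∀ c r (Φ : Tuple → ℕ) k → count c r (λ l → Φ l * k) ≡ count c r Φ * k
count-*ʳ c zero    Φ k = refl
count-*ʳ c (suc r) Φ k = trans (combine₅ c (count-*ʳ c r Φ k) (count-*ʳ c r (Φ ∘ inc₁) k) (count-*ʳ c r (Φ ∘ inc₂) k) (count-*ʳ c r (Φ ∘ inc₃) k) (count-*ʳ c r (Φ ∘ inc₄) k))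
  (lem c k (count c r Φ) (count c r (Φ ∘ inc₁)) (count c r (Φ ∘ inc₂)) (count c r (Φ ∘ inc₃)) (count c r (Φ ∘ inc₄)))
  where
  lem : ∀ c k x y z u v → x * k + c * (y * k + z * k + u * k + v * k) ≡ (x + c * (y + z + u + v)) * k
  lem = solve-∀

count-∑ : ∀ c r {X : Set} (xs : List X) (Φ : X → Tuple → ℕ) → count c r (λ l → ∑ⁿ xs (λ x → Φ x l)) ≡ ∑ⁿ xs (λ x → count c r (Φ x))
count-∑ c r []       Φ = count-0 c r (λ _ _ → refl)
count-∑ c r (x ∷ xs) Φ = trans (count-+ c r (Φ x) (λ l → ∑ⁿ xs (λ y → Φ y l))) (cong (count c r (Φ x) +_) (count-∑ c r xs Φ))

δ : Tuple → Tuple → ℕ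
δ (a , b , c , d) (a′ , b′ , c′ , d′) = 𝟙ⁿ (a′ ℕₚ.≟ a) * (𝟙ⁿ (b′ ℕₚ.≟ b) * (𝟙ⁿ (c′ ℕₚ.≟ c) * 𝟙ⁿ (d′ ℕₚ.≟ d)))

private
  δ-≢₁ : ∀ a b c d a′ b′ c′ d′ → a′ ≢ a → δ (a , b , c , d) (a′ , b′ , c′ , d′) ≡ 0
  δ-≢₁ a b c d a′ b′ c′ d′ ne = cong (_* (𝟙ⁿ (b′ ℕₚ.≟ b) * (𝟙ⁿ (c′ ℕₚ.≟ c) * 𝟙ⁿ (d′ ℕₚ.≟ d)))) (ℕ∑.𝟙-no (a′ ℕₚ.≟ a) ne)
  δ-≢₂ : ∀ a b c d a′ b′ c′ d′ → b′ ≢ b → δ (a , b , c , d) (a′ , b′ , c′ , d′) ≡ 0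
  δ-≢₂ a b c d a′ b′ c′ d′ ne = trans (cong (λ z → 𝟙ⁿ (a′ ℕₚ.≟ a) * (z * (𝟙ⁿ (c′ ℕₚ.≟ c) * 𝟙ⁿ (d′ ℕₚ.≟ d)))) (ℕ∑.𝟙-no (b′ ℕₚ.≟ b) ne)) (ℕₚ.*-zeroʳ (𝟙ⁿ (a′ ℕₚ.≟ a)))
  δ-≢₃ : ∀ a b c d a′ b′ c′ d′ → c′ ≢ c → δ (a , b , c , d) (a′ , b′ , c′ , d′) ≡ 0
  δ-≢₃ a b c d a′ b′ c′ d′ ne = trans (cong (λ z → 𝟙ⁿ (a′ ℕₚ.≟ a) * (𝟙ⁿ (b′ ℕₚ.≟ b) * (z * 𝟙ⁿ (d′ ℕₚ.≟ d)))) (ℕ∑.𝟙-no (c′ ℕₚ.≟ c) ne))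
    (trans (cong (𝟙ⁿ (a′ ℕₚ.≟ a) *_) (ℕₚ.*-zeroʳ (𝟙ⁿ (b′ ℕₚ.≟ b)))) (ℕₚ.*-zeroʳ (𝟙ⁿ (a′ ℕₚ.≟ a))))
  δ-≢₄ : ∀ a b c d a′ b′ c′ d′ → d′ ≢ d → δ (a , b , c , d) (a′ , b′ , c′ , d′) ≡ 0
  δ-≢₄ a b c d a′ b′ c′ d′ ne = trans (cong (λ z → 𝟙ⁿ (a′ ℕₚ.≟ a) * (𝟙ⁿ (b′ ℕₚ.≟ b) * (𝟙ⁿ (c′ ℕₚ.≟ c) * z))) (ℕ∑.𝟙-no (d′ ℕₚ.≟ d) ne))
    (trans (cong (λ z → 𝟙ⁿ (a′ ℕₚ.≟ a) * (𝟙ⁿ (b′ ℕₚ.≟ b) * z)) (ℕₚ.*-zeroʳ (𝟙ⁿ (c′ ℕₚ.≟ c)))) (trans (cong (𝟙ⁿ (a′ ℕₚ.≟ a) *_) (ℕₚ.*-zeroʳ (𝟙ⁿ (b′ ℕₚ.≟ b)))) (ℕₚ.*-zeroʳ (𝟙ⁿ (a′ ℕₚ.≟ a)))))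

δ-refl : ∀ l → δ l l ≡ 1
δ-refl (a , b , c , d) = cong₂ _*_ (y a) (cong₂ _*_ (y b) (cong₂ _*_ (y c) (y d)))
  where
  y : ∀ n → 𝟙ⁿ (n ℕₚ.≟ n) ≡ 1
  y n = ℕ∑.𝟙-yes (n ℕₚ.≟ n) refl

δ-≢ : ∀ l l′ → l′ ≢ l → δ l l′ ≡ 0
δ-≢ (a , b , c , d) (a′ , b′ , c′ , d′) ne with a′ ℕₚ.≟ a | b′ ℕₚ.≟ b | c′ ℕₚ.≟ c | d′ ℕₚ.≟ d
... | yes refl | yes refl | yes refl | yes refl = ⊥-elim (ne refl)
... | no _ | _ | _ | _ = refl
... | yes _ | no _ | _ | _ = refl
... | yes _ | yes _ | no _ | _ = refl
... | yes _ | yes _ | yes _ | no _ = refl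

private
  box : List ℕ → List Tuple
  box up = concatMap (λ a → concatMap (λ b → concatMap (λ c → map (λ d → (a , b , c , d)) up) up) up) up

  ∑-box : ∀ up (f : Tuple → ℕ) → ∑ⁿ (box up) f ≡ ∑ⁿ up (λ a → ∑ⁿ up (λ b → ∑ⁿ up (λ c → ∑ⁿ up (λ d → f (a , b , c , d)))))
  ∑-box up f =
    trans (ℕ∑.∑-concatMap (λ a → concatMap (λ b → concatMap (λ c → map (λ d → (a , b , c , d)) up) up) up) up f) (ℕ∑.∑-cong′ up λ a →
    trans (ℕ∑.∑-concatMap (λ b → concatMap (λ c → map (λ d → (a , b , c , d)) up) up) up f) (ℕ∑.∑-cong′ up λ b →
    trans (ℕ∑.∑-concatMap (λ c → map (λ d → (a , b , c , d)) up) up f) (ℕ∑.∑-cong′ up λ c →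
    ℕ∑.∑-map (λ d → (a , b , c , d)) up f)))

∑-tuples : ∀ r (f : Tuple → ℕ) → ∑ⁿ (tuples r) f ≡
  ∑ⁿ (upTo (suc r)) (λ a → ∑ⁿ (upTo (suc r)) (λ b → ∑ⁿ (upTo (suc r)) (λ c → ∑ⁿ (upTo (suc r)) (λ d →
    𝟙ⁿ ((a + b + c + d) ≤? r) * f (a , b , c , d)))))
∑-tuples r f = begin
  ∑ⁿ (tuples r) f                                          ≡⟨⟩
  ∑ⁿ (filter (λ l → total l ≤? r) (box (upTo (suc r)))) f  ≡⟨ ℕ∑.∑-filter (λ l → total l ≤? r) (box (upTo (suc r))) f ⟩
  ∑ⁿ (box (upTo (suc r))) (λ l → 𝟙ⁿ (total l ≤? r) * f l)  ≡⟨ ∑-box (upTo (suc r)) (λ l → 𝟙ⁿ (total l ≤? r) * f l) ⟩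
  _                                                        ∎
  where open ≡-Reasoning

∑-tuples-δ : ∀ r l′ → total l′ ≤ r → (Φ : Tuple → ℕ) → ∑ⁿ (tuples r) (λ l → δ l l′ * Φ l) ≡ Φ l′
∑-tuples-δ r (a′ , b′ , c′ , d′) le Φ = begin
  ∑ⁿ (tuples r) (λ l → δ l l′ * Φ l)
    ≡⟨ ∑-tuples r _ ⟩
  ∑ⁿ up (λ a → ∑ⁿ up (λ b → ∑ⁿ up (λ c → ∑ⁿ up (λ d → g a b c d))))
    ≡⟨ ℕ∑.∑-single (Uniqueₚ.upTo⁺ (suc r)) (∈-upTo⁺ (s≤s a≤)) _ (λ a _ ne → ℕ∑.∑-zero up (λ b _ → ℕ∑.∑-zero up (λ c _ → ℕ∑.∑-zero up (λ d _ → vanish a b c d (δ-≢₁ a b c d a′ b′ c′ d′ (ne ∘ sym)))))) ⟩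
  ∑ⁿ up (λ b → ∑ⁿ up (λ c → ∑ⁿ up (λ d → g a′ b c d)))
    ≡⟨ ℕ∑.∑-single (Uniqueₚ.upTo⁺ (suc r)) (∈-upTo⁺ (s≤s b≤)) _ (λ b _ ne → ℕ∑.∑-zero up (λ c _ → ℕ∑.∑-zero up (λ d _ → vanish a′ b c d (δ-≢₂ a′ b c d a′ b′ c′ d′ (ne ∘ sym))))) ⟩
  ∑ⁿ up (λ c → ∑ⁿ up (λ d → g a′ b′ c d))
    ≡⟨ ℕ∑.∑-single (Uniqueₚ.upTo⁺ (suc r)) (∈-upTo⁺ (s≤s c≤)) _ (λ c _ ne → ℕ∑.∑-zero up (λ d _ → vanish a′ b′ c d (δ-≢₃ a′ b′ c d a′ b′ c′ d′ (ne ∘ sym)))) ⟩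
  ∑ⁿ up (λ d → g a′ b′ c′ d)
    ≡⟨ ℕ∑.∑-single (Uniqueₚ.upTo⁺ (suc r)) (∈-upTo⁺ (s≤s d≤)) _ (λ d _ ne → vanish a′ b′ c′ d (δ-≢₄ a′ b′ c′ d a′ b′ c′ d′ (ne ∘ sym))) ⟩
  g a′ b′ c′ d′
    ≡⟨ cong₂ _*_ (ℕ∑.𝟙-yes ((a′ + b′ + c′ + d′) ≤? r) le) (trans (cong (_* Φ l′) (δ-refl l′)) (ℕₚ.*-identityˡ (Φ l′))) ⟩
  1 * Φ l′
    ≡⟨ ℕₚ.*-identityˡ (Φ l′) ⟩
  Φ l′ ∎
  where
  open ≡-Reasoning
  l′ : Tuple
  l′ = (a′ , b′ , c′ , d′)
  up = upTo (suc r)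
  g : ℕ → ℕ → ℕ → ℕ → ℕ
  g a b c d = 𝟙ⁿ ((a + b + c + d) ≤? r) * (δ (a , b , c , d) l′ * Φ (a , b , c , d))
  vanish : ∀ a b c d → δ (a , b , c , d) l′ ≡ 0 → g a b c d ≡ 0
  vanish a b c d e = trans (cong (λ z → 𝟙ⁿ ((a + b + c + d) ≤? r) * (z * Φ (a , b , c , d))) e) (ℕₚ.*-zeroʳ (𝟙ⁿ ((a + b + c + d) ≤? r)))
  abc≤ = ℕₚ.≤-trans (ℕₚ.m≤m+n (a′ + b′ + c′) d′) le
  ab≤ = ℕₚ.≤-trans (ℕₚ.m≤m+n (a′ + b′) c′) abc≤
  a≤ : a′ ≤ r
  a≤ = ℕₚ.≤-trans (ℕₚ.m≤m+n a′ b′) ab≤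
  b≤ : b′ ≤ r
  b≤ = ℕₚ.≤-trans (ℕₚ.m≤n+m b′ a′) ab≤
  c≤ : c′ ≤ r
  c≤ = ℕₚ.≤-trans (ℕₚ.m≤n+m c′ (a′ + b′)) abc≤
  d≤ : d′ ≤ r
  d≤ = ℕₚ.≤-trans (ℕₚ.m≤n+m d′ (a′ + b′ + c′)) le

-- `count` is additive in Φ, and a word of length r only meets profiles of total at most r, so Φ may
-- be expanded in the point masses `δ l` over `tuples r`.
count-decompose : ∀ c r (Φ : Tuple → ℕ) → count c r Φ ≡ ∑ⁿ (tuples r) (λ l → count c r (δ l) * Φ l)
count-decompose c r Φ = begin
  count c r Φ                                           ≡⟨ count-cong c r (λ l′ le → ∑-tuples-δ r l′ le Φ) ⟨
  count c r (λ l′ → ∑ⁿ (tuples r) (λ l → δ l l′ * Φ l)) ≡⟨ count-∑ c r (tuples r) (λ l l′ → δ l l′ * Φ l) ⟩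
  ∑ⁿ (tuples r) (λ l → count c r (λ l′ → δ l l′ * Φ l)) ≡⟨ ℕ∑.∑-cong′ (tuples r) (λ l → count-*ʳ c r (δ l) (Φ l)) ⟩
  ∑ⁿ (tuples r) (λ l → count c r (δ l) * Φ l)           ∎
  where open ≡-Reasoning

private
  𝟙-suc : ∀ a a′ → 𝟙ⁿ (suc a′ ℕₚ.≟ suc a) ≡ 𝟙ⁿ (a′ ℕₚ.≟ a)
  𝟙-suc a a′ = ℕ∑.𝟙-cong (suc a′ ℕₚ.≟ suc a) (a′ ℕₚ.≟ a) ℕₚ.suc-injective (cong suc)

  -- One summand of the recursion for `count-δ`, where the first letter is taken from the kind
  -- counted by a. If a = 0 there are no such words; otherwise the induction hypothesis concerns a -
  -- 1, and a! = a (a - 1)! supplies the factor a.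
  coordinate : ∀ κ X a F r! Ch → (a ≡ 0 → X ≡ 0) → (∀ a₀ → a ≡ suc a₀ → κ * (X * (a₀ ! * F)) ≡ r! * Ch) → κ * (X * (a ! * F)) ≡ a * (r! * Ch)
  coordinate κ X zero F r! Ch z _ = trans (cong (λ x → κ * (x * (1 * F))) (z refl)) (ℕₚ.*-zeroʳ κ)
  coordinate κ X (suc a) F r! Ch _ s = trans (lem κ X (suc a) (a !) F) (cong (suc a *_) (s a refl))
    where
    lem : ∀ κ X a f F → κ * (X * ((a * f) * F)) ≡ a * (κ * (X * (f * F)))
    lem = solve-∀

factorials : Tuple → ℕ
factorials (a , b , c , d) = a ! * b ! * c ! * d !

-- The multinomial count r! κ^h / (a! b! c! d! z!) without division, z being the number of neutral
-- letters. In the induction on the first letter the five kinds contribute z, a, b, c and d times r!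
-- κ^h, and these multiplicities add up to the new length.
count-δ : ∀ κ r a b c d z → a + b + c + d + z ≡ r →
          count κ r (δ (a , b , c , d)) * (factorials (a , b , c , d) * z !) ≡ r ! * κ ^ (a + b + c + d)
count-δ κ zero a b c d z e = base a b c d z e
  where
  base : ∀ a b c d z → a + b + c + d + z ≡ 0 → count κ 0 (δ (a , b , c , d)) * (factorials (a , b , c , d) * z !) ≡ 1 * κ ^ (a + b + c + d)
  base zero zero zero zero zero refl = refl
count-δ κ (suc r) a b c d z e = begin
  (x₀ + κ * (x₁ + x₂ + x₃ + x₄)) * (fa * fb * fc * fd * fz)
    ≡⟨ l₀ κ x₀ x₁ x₂ x₃ x₄ fa fb fc fd fz ⟩
  1 * (x₀ * (fz * (fa * fb * fc * fd))) + κ * (x₁ * (fa * (fb * fc * fd * fz))) + κ * (x₂ * (fb * (fa * fc * fd * fz))) + κ * (x₃ * (fc * (fa * fb * fd * fz))) + κ * (x₄ * (fd * (fa * fb * fc * fz)))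
    ≡⟨ sum₅ z-term a-term b-term c-term d-term ⟩
  z * (r ! * Ch) + a * (r ! * Ch) + b * (r ! * Ch) + c * (r ! * Ch) + d * (r ! * Ch)
    ≡⟨ l₁ (r !) Ch a b c d z ⟩
  (a + b + c + d + z) * r ! * Ch
    ≡⟨ cong (λ k → k * r ! * Ch) e ⟩
  suc r * r ! * Ch ∎
  where
  open ≡-Reasoning
  h = a + b + c + d
  Ch = κ ^ h
  fa = a !
  fb = b !
  fc = c !
  fd = d !
  fz = z !
  l = (a , b , c , d)
  x₀ = count κ r (δ l)
  x₁ = count κ r (δ l ∘ inc₁)
  x₂ = count κ r (δ l ∘ inc₂)
  x₃ = count κ r (δ l ∘ inc₃)
  x₄ = count κ r (δ l ∘ inc₄)
  l₀ : ∀ κ x₀ x₁ x₂ x₃ x₄ fa fb fc fd fz → (x₀ + κ * (x₁ + x₂ + x₃ + x₄)) * (fa * fb * fc * fd * fz) ≡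
       1 * (x₀ * (fz * (fa * fb * fc * fd))) + κ * (x₁ * (fa * (fb * fc * fd * fz))) + κ * (x₂ * (fb * (fa * fc * fd * fz))) + κ * (x₃ * (fc * (fa * fb * fd * fz))) + κ * (x₄ * (fd * (fa * fb * fc * fz)))
  l₀ = solve-∀
  l₁ : ∀ R Ch a b c d z → z * (R * Ch) + a * (R * Ch) + b * (R * Ch) + c * (R * Ch) + d * (R * Ch) ≡ (a + b + c + d + z) * R * Ch
  l₁ = solve-∀
  sum₅ : ∀ {x x′ y y′ z z′ u u′ v v′ : ℕ} → x ≡ x′ → y ≡ y′ → z ≡ z′ → u ≡ u′ → v ≡ v′ → x + y + z + u + v ≡ x′ + y′ + z′ + u′ + v′
  sum₅ refl refl refl refl refl = refl
  z-term : 1 * (x₀ * (fz * (fa * fb * fc * fd))) ≡ z * (r ! * Ch)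
  z-term = coordinate 1 x₀ z (fa * fb * fc * fd) (r !) Ch
    -- Without neutral letters the profile has total r + 1, more than the r remaining letters can
    -- provide.
    (λ { refl → count-0 κ r (λ l′ le → δ-≢ l l′ (λ { refl → ℕₚ.<⇒≱ (ℕₚ.n<1+n r) (subst (_≤ r) (trans (sym (ℕₚ.+-identityʳ h)) e) le) })) })
    (λ { z₀ refl → trans (ℕₚ.*-identityˡ _) (trans (cong (x₀ *_) (ℕₚ.*-comm (z₀ !) (fa * fb * fc * fd))) (count-δ κ r a b c d z₀ (ℕₚ.suc-injective (trans (sym (ℕₚ.+-suc h z₀)) e)))) })
  a-term : κ * (x₁ * (fa * (fb * fc * fd * fz))) ≡ a * (r ! * Ch)
  a-term = coordinate κ x₁ a (fb * fc * fd * fz) (r !) Ch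
    (λ { refl → count-0 κ r (λ { (a′ , b′ , c′ , d′) _ → δ-≢₁ 0 b c d (suc a′) b′ c′ d′ (λ ()) }) })
    (λ { a₀ refl → trans (cong (κ *_) (trans (cong₂ _*_ (count-cong κ r (λ { (a′ , b′ , c′ , d′) _ → cong (_* (𝟙ⁿ (b′ ℕₚ.≟ b) * (𝟙ⁿ (c′ ℕₚ.≟ c) * 𝟙ⁿ (d′ ℕₚ.≟ d)))) (𝟙-suc a₀ a′) })) (s₁ (a₀ !) fb fc fd fz)) (count-δ κ r a₀ b c d z (ℕₚ.suc-injective e))))
                          (t₁ κ (r !) (κ ^ (a₀ + b + c + d))) })
    where
    s₁ : ∀ x b c d z → x * (b * c * d * z) ≡ x * b * c * d * z
    s₁ = solve-∀
    t₁ : ∀ κ R k → κ * (R * k) ≡ R * (κ * k)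
    t₁ = solve-∀
  b-term : κ * (x₂ * (fb * (fa * fc * fd * fz))) ≡ b * (r ! * Ch)
  b-term = coordinate κ x₂ b (fa * fc * fd * fz) (r !) Ch
    (λ { refl → count-0 κ r (λ { (a′ , b′ , c′ , d′) _ → δ-≢₂ a 0 c d a′ (suc b′) c′ d′ (λ ()) }) })
    (λ { b₀ refl → trans (cong (κ *_) (trans (cong₂ _*_ (count-cong κ r (λ { (a′ , b′ , c′ , d′) _ → cong (λ w → 𝟙ⁿ (a′ ℕₚ.≟ a) * (w * (𝟙ⁿ (c′ ℕₚ.≟ c) * 𝟙ⁿ (d′ ℕₚ.≟ d)))) (𝟙-suc b₀ b′) })) (s₁ (b₀ !) fa fc fd fz)) (count-δ κ r a b₀ c d z (ℕₚ.suc-injective (trans (cong (_+ z) (sym (total-inc₂ a b₀ c d))) e)))))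
                          (trans (t₁ κ (r !) (κ ^ (a + b₀ + c + d))) (cong (λ k → r ! * κ ^ k) (sym (total-inc₂ a b₀ c d)))) })
    where
    s₁ : ∀ x a c d z → x * (a * c * d * z) ≡ a * x * c * d * z
    s₁ = solve-∀
    t₁ : ∀ κ R k → κ * (R * k) ≡ R * (κ * k)
    t₁ = solve-∀
  c-term : κ * (x₃ * (fc * (fa * fb * fd * fz))) ≡ c * (r ! * Ch)
  c-term = coordinate κ x₃ c (fa * fb * fd * fz) (r !) Ch
    (λ { refl → count-0 κ r (λ { (a′ , b′ , c′ , d′) _ → δ-≢₃ a b 0 d a′ b′ (suc c′) d′ (λ ()) }) })
    (λ { c₀ refl → trans (cong (κ *_) (trans (cong₂ _*_ (count-cong κ r (λ { (a′ , b′ , c′ , d′) _ → cong (λ w → 𝟙ⁿ (a′ ℕₚ.≟ a) * (𝟙ⁿ (b′ ℕₚ.≟ b) * (w * 𝟙ⁿ (d′ ℕₚ.≟ d)))) (𝟙-suc c₀ c′) })) (s₁ (c₀ !) fa fb fd fz)) (count-δ κ r a b c₀ d z (ℕₚ.suc-injective (trans (cong (_+ z) (sym (total-inc₃ a b c₀ d))) e)))))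
                          (trans (t₁ κ (r !) (κ ^ (a + b + c₀ + d))) (cong (λ k → r ! * κ ^ k) (sym (total-inc₃ a b c₀ d)))) })
    where
    s₁ : ∀ x a b d z → x * (a * b * d * z) ≡ a * b * x * d * z
    s₁ = solve-∀
    t₁ : ∀ κ R k → κ * (R * k) ≡ R * (κ * k)
    t₁ = solve-∀
  d-term : κ * (x₄ * (fd * (fa * fb * fc * fz))) ≡ d * (r ! * Ch)
  d-term = coordinate κ x₄ d (fa * fb * fc * fz) (r !) Ch
    (λ { refl → count-0 κ r (λ { (a′ , b′ , c′ , d′) _ → δ-≢₄ a b c 0 a′ b′ c′ (suc d′) (λ ()) }) })
    (λ { d₀ refl → trans (cong (κ *_) (trans (cong₂ _*_ (count-cong κ r (λ { (a′ , b′ , c′ , d′) _ → cong (λ w → 𝟙ⁿ (a′ ℕₚ.≟ a) * (𝟙ⁿ (b′ ℕₚ.≟ b) * (𝟙ⁿ (c′ ℕₚ.≟ c) * w))) (𝟙-suc d₀ d′) })) (s₁ (d₀ !) fa fb fc fz)) (count-δ κ r a b c d₀ z (ℕₚ.suc-injective (trans (cong (_+ z) (sym (total-inc₄ a b c d₀))) e)))))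
                          (trans (t₁ κ (r !) (κ ^ (a + b + c + d₀))) (cong (λ k → r ! * κ ^ k) (sym (total-inc₄ a b c d₀)))) })
    where
    s₁ : ∀ x a b c z → x * (a * b * c * z) ≡ a * b * c * x * z
    s₁ = solve-∀
    t₁ : ∀ κ R k → κ * (R * k) ≡ R * (κ * k)
    t₁ = solve-∀

private
  factorials≢0 : ∀ l → NonZero (factorials l)
  factorials≢0 (a , b , c , d) = ℕₚ.m*n≢0 (a ! * b ! * c !) (d !) {{ℕₚ.m*n≢0 (a ! * b !) (c !) {{ℕₚ.m*n≢0 (a !) (b !) {{a !≢0}} {{b !≢0}}}} {{c !≢0}}}} {{d !≢0}}

-- The quotient is the number of words with this profile over one letter per class and no neutral
-- letter; this count proves the division in `multinomial` exact.
multinomial-factorials : ∀ a b c d → multinomial (a + b + c + d) a b c d * factorials (a , b , c , d) ≡ (a + b + c + d) !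
multinomial-factorials a b c d = m/n*n≡m {{factorials≢0 (a , b , c , d)}} (divides (count 1 h (δ (a , b , c , d))) (sym (begin
  count 1 h (δ (a , b , c , d)) * factorials (a , b , c , d)        ≡⟨ cong (count 1 h (δ (a , b , c , d)) *_) (ℕₚ.*-identityʳ _) ⟨
  count 1 h (δ (a , b , c , d)) * (factorials (a , b , c , d) * 1)  ≡⟨ count-δ 1 h a b c d 0 (ℕₚ.+-identityʳ h) ⟩
  h ! * 1 ^ h                                                       ≡⟨ trans (cong (h ! *_) (ℕₚ.^-zeroˡ h)) (ℕₚ.*-identityʳ (h !)) ⟩
  h !                                                               ∎)))
  where
  open ≡-Reasoning
  h = a + b + c + d

A≡count-δ : ∀ r κ l → total l ≤ r → A r κ l ≡ count κ r (δ l)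
A≡count-δ r κ l@(a , b , c , d) h≤r = ℕₚ.*-cancelʳ-≡ (A r κ l) (count κ r (δ l)) (factorials l * (r ∸ h) !) {{ℕₚ.m*n≢0 (factorials l) ((r ∸ h) !) {{factorials≢0 l}} {{(r ∸ h) !≢0}}}} (begin
  (r C h) * multinomial h a b c d * κ ^ h * (factorials l * (r ∸ h) !)    ≡⟨ lem (r C h) (multinomial h a b c d) (κ ^ h) (factorials l) ((r ∸ h) !) ⟩
  (r C h) * ((multinomial h a b c d * factorials l) * (r ∸ h) !) * κ ^ h  ≡⟨ cong (λ z → (r C h) * (z * (r ∸ h) !) * κ ^ h) (multinomial-factorials a b c d) ⟩
  (r C h) * (h ! * (r ∸ h) !) * κ ^ h                                     ≡⟨ cong (_* κ ^ h) (nCk*k![n∸k]!≡n! h≤r) ⟩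
  r ! * κ ^ h                                                             ≡⟨ count-δ κ r a b c d (r ∸ h) (ℕₚ.m+[n∸m]≡n h≤r) ⟨
  count κ r (δ l) * (factorials l * (r ∸ h) !)                            ∎)
  where
  open ≡-Reasoning
  h = a + b + c + d
  lem : ∀ x y z u v → x * y * z * (u * v) ≡ x * ((y * u) * v) * z
  lem = solve-∀

∑-tuples-cong : ∀ r {f g : Tuple → ℕ} → (∀ l → total l ≤ r → f l ≡ g l) → ∑ⁿ (tuples r) f ≡ ∑ⁿ (tuples r) g
∑-tuples-cong r {f} {g} h = trans (∑-tuples r f) (trans (ℕ∑.∑-cong′ up λ a → ℕ∑.∑-cong′ up λ b → ℕ∑.∑-cong′ up λ c → ℕ∑.∑-cong′ up λ d → step a b c d ((a + b + c + d) ≤? r)) (sym (∑-tuples r g)))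
  where
  up = upTo (suc r)
  step : ∀ a b c d (D : Dec (a + b + c + d ≤ r)) → 𝟙ⁿ D * f (a , b , c , d) ≡ 𝟙ⁿ D * g (a , b , c , d)
  step a b c d (yes le) = cong (1 *_) (h _ le)
  step a b c d (no _) = refl

count-A : ∀ c r (Φ : Tuple → ℕ) → count c r Φ ≡ ∑ⁿ (tuples r) (λ l → A r c l * Φ l)
count-A c r Φ = trans (count-decompose c r Φ) (∑-tuples-cong r (λ l le → cong (_* Φ l) (sym (A≡count-δ r c l le))))

module _ {X : Set} (K : List X) (W : X → ℕ) (c w₁ w₂ w₃ w₄ : ℕ)
         (class-sum : ∀ (f : ℕ → ℕ) → ∑ⁿ K (f ∘ W) ≡ f 0 + c * (f w₁ + f w₂ + f w₃ + f w₄)) where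

  dot : Tuple → ℕ
  dot (a , b , c , d) = a * w₁ + b * w₂ + c * w₃ + d * w₄

  -- Splitting off the first letter, `class-sum` groups its values by class, which is the recursion
  -- of `count`; each class adds its weight to `dot` through the matching increment.
  ∑-words : ∀ r (φ : ℕ → ℕ) → ∑ⁿ (words K r) (λ v → φ (∑ⁿ v W)) ≡ count c r (φ ∘ dot)
  ∑-words zero    φ = ℕₚ.+-identityʳ (φ 0)
  ∑-words (suc r) φ = begin
    ∑ⁿ (words K (suc r)) (λ v → φ (∑ⁿ v W))
      ≡⟨ ℕ∑.∑-concatMap (λ x → map (x ∷_) (words K r)) K _ ⟩
    ∑ⁿ K (λ x → ∑ⁿ (map (x ∷_) (words K r)) (λ v → φ (∑ⁿ v W)))
      ≡⟨ ℕ∑.∑-cong′ K (λ x → trans (ℕ∑.∑-map (x ∷_) (words K r) _) (∑-words r (λ n → φ (W x + n)))) ⟩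
    ∑ⁿ K (λ x → g (W x))
      ≡⟨ class-sum g ⟩
    g 0 + c * (g w₁ + g w₂ + g w₃ + g w₄)
      ≡⟨ combine₅ c refl
           (count-cong c r (λ { (a , b , c , d) _ → cong φ (p₁ w₁ (a * w₁) (b * w₂) (c * w₃) (d * w₄)) }))
           (count-cong c r (λ { (a , b , c , d) _ → cong φ (p₂ w₂ (a * w₁) (b * w₂) (c * w₃) (d * w₄)) }))
           (count-cong c r (λ { (a , b , c , d) _ → cong φ (p₃ w₃ (a * w₁) (b * w₂) (c * w₃) (d * w₄)) }))
           (count-cong c r (λ { (a , b , c , d) _ → cong φ (p₄ w₄ (a * w₁) (b * w₂) (c * w₃) (d * w₄)) })) ⟩
    count c (suc r) (φ ∘ dot) ∎
    where
    open ≡-Reasoning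
    g : ℕ → ℕ
    g u = count c r (λ l → φ (u + dot l))
    p₁ : ∀ w a b c d → w + (a + b + c + d) ≡ w + a + b + c + d
    p₁ = solve-∀
    p₂ : ∀ w a b c d → w + (a + b + c + d) ≡ a + (w + b) + c + d
    p₂ = solve-∀
    p₃ : ∀ w a b c d → w + (a + b + c + d) ≡ a + b + (w + c) + d
    p₃ = solve-∀
    p₄ : ∀ w a b c d → w + (a + b + c + d) ≡ a + b + c + (w + d)
    p₄ = solve-∀

-- Every power of 1 + y is 1 modulo y. With y = q - 1 divisible by r this gives Ψ_i(q) ≡ i modulo r.
Ψ≡i+y*w : ∀ i y → ∃ λ w → Ψ i (suc y) ≡ i + y * w
Ψ≡i+y*w zero    y = 0 , sym (ℕₚ.*-zeroʳ y)
Ψ≡i+y*w (suc i) y with Ψ≡i+y*w i y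
... | w , e = w + (i + y * w) , trans (Ψ-suc i (suc y)) (trans (cong (λ z → 1 + suc y * z) e) (lem i y w))
  where
  lem : ∀ i y w → 1 + (1 + y) * (i + y * w) ≡ (1 + i) + y * (w + (i + y * w))
  lem = solve-∀

length≡∑ : {X : Set} (xs : List X) → length xs ≡ ∑ⁿ xs (λ _ → 1)
length≡∑ []       = refl
length≡∑ (x ∷ xs) = cong suc (length≡∑ xs)

length-filter≡∑ : {X : Set} {P : X → Set} (P? : ∀ x → Dec (P x)) (xs : List X) → length (filter P? xs) ≡ ∑ⁿ xs (λ x → 𝟙ⁿ (P? x))
length-filter≡∑ P? xs = trans (length≡∑ (filter P? xs)) (trans (ℕ∑.∑-filter P? xs (λ _ → 1)) (ℕ∑.∑-cong′ xs (λ x → ℕₚ.*-identityʳ (𝟙ⁿ (P? x)))))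

length-words : {X : Set} (K : List X) → ∀ r → length (words K r) ≡ length K ^ r
length-words K zero    = refl
length-words K (suc r) = begin
  length (words K (suc r))                                   ≡⟨ length≡∑ (words K (suc r)) ⟩
  ∑ⁿ (words K (suc r)) (λ _ → 1)                             ≡⟨ ℕ∑.∑-concatMap (λ x → map (x ∷_) (words K r)) K (λ _ → 1) ⟩
  ∑ⁿ K (λ x → ∑ⁿ (map (x ∷_) (words K r)) (λ _ → 1))         ≡⟨ ℕ∑.∑-cong′ K (λ x → trans (ℕ∑.∑-map (x ∷_) (words K r) (λ _ → 1)) (trans (sym (length≡∑ (words K r))) (length-words K r))) ⟩
  ∑ⁿ K (λ _ → length K ^ r)                                  ≡⟨ ℕ∑.∑-const K (length K ^ r) ⟩
  ℕ∑.nat (length K) * length K ^ r                           ≡⟨ cong (_* length K ^ r) (ℕnat (length K)) ⟩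
  length K ^ suc r                                           ∎
  where open ≡-Reasoning

applyUpTo∈words : {X : Set} {K : List X} → ∀ r (f : ℕ → X) → (∀ i → f i ∈ K) → applyUpTo f r ∈ words K r
applyUpTo∈words zero    f f∈ = here refl
applyUpTo∈words {K = K} (suc r) f f∈ = ∈-concatMap⁺ (λ x → map (x ∷_) (words K r)) (lose (f∈ 0) (∈-map⁺ (f 0 ∷_) (applyUpTo∈words r (f ∘ suc) (f∈ ∘ suc))))

map-≡⁻ : {X Y : Set} (f g : X → Y) (xs : List X) → map f xs ≡ map g xs → ∀ {x} → x ∈ xs → f x ≡ g x
map-≡⁻ f g (x ∷ xs) e (here refl) = proj₁ (∷-injective e)
map-≡⁻ f g (x ∷ xs) e (there x∈)  = map-≡⁻ f g xs (proj₂ (∷-injective e)) x∈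

-- The code as words of length r over 𝔽_q.

module Code (F : FiniteField) {p E : ℕ} (pr : Prime p) (card≡ : FiniteField.card F ≡ p ^ E)
            (ω : FiniteField.Carrier F) (ω-prim : FiniteField.IsPrimitive F ω)
            (t c d r : ℕ) (0<t : 0 < t) (p-eq : p ≡ 4 * d + 1)
            (c-eq : 4 * c + 1 ≡ p ^ (4 * t)) (E-eq : r * (4 * t) ≡ E)
            (k n : ℕ) (prime-r : Prime r) (p≢r : p ≢ r) (coprime-4-r : Coprime 4 r)
            (rk≡4Ψ : r * k ≡ 4 * Ψ r (p ^ (4 * t))) (r∣N : r ∣ p ^ (4 * t) ∸ 1)
            (nk≡M : n * k ≡ FiniteField.card F ∸ 1) where

  open Quartic F {p} {E} pr card≡ ω ω-prim t c d r 0<t p-eq c-eq E-eq public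
  open U using (gen; gen≢0; gen-Sub)

  private
    Ψr = U.L

    α : Carrier
    α = pow ω k

    0<k : 0 < k
    0<k = ℕₚ.n≢0⇒n>0 (λ { refl → ℕₚ.<⇒≢ 0<M (trans (sym (ℕₚ.*-zeroʳ n)) nk≡M) })

    n≡c*r : n ≡ c * r
    n≡c*r = ℕₚ.*-cancelʳ-≡ n (c * r) (4 * Ψr) {{>-nonZero (ℕₚ.*-mono-≤ {1} {4} (s≤s z≤n) U.0<L)}} (begin
      n * (4 * Ψr)         ≡⟨ cong (n *_) rk≡4Ψ ⟨
      n * (r * k)          ≡⟨ l₁ n r k ⟩
      r * (n * k)          ≡⟨ cong (r *_) (trans nk≡M (trans (sym U.L*N≡M) (cong (Ψr *_) 4c≡N))) ⟩
      r * (Ψr * (4 * c))   ≡⟨ l₂ r Ψr c ⟩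
      c * r * (4 * Ψr)     ∎)
      where
      open ≡-Reasoning
      l₁ : ∀ n r k → n * (r * k) ≡ r * (n * k)
      l₁ = solve-∀
      l₂ : ∀ r L c → r * (L * (4 * c)) ≡ c * r * (4 * L)
      l₂ = solve-∀

    0<r : 0 < r
    0<r = ℕₚ.<⇒≤ (prime>1 prime-r)

    order-α : IsOrder α (r * c)
    order-α = order-pow k (r * c) 0<k (subst (IsOrder ω) (sym (trans (cong (k *_) (trans (ℕₚ.*-comm r c) (sym n≡c*r))) (trans (ℕₚ.*-comm k n) nk≡M))) order-ω)

    α≢0 : α ≢ 0#
    α≢0 = pow≢0 k ω≢0

    α^r≡β : pow α r ≡ β
    α^r≡β = begin
      pow (pow ω k) r      ≡⟨ pow-* ω k r ⟨
      pow ω (k * r)        ≡⟨ cong (pow ω) (trans (ℕₚ.*-comm k r) (trans rk≡4Ψ (ℕₚ.*-comm 4 Ψr))) ⟩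
      pow ω (Ψr * 4)       ≡⟨ pow-* ω Ψr 4 ⟩
      β                    ∎
      where open ≡-Reasoning

    p^im∸1 : ∀ i → p ^ (i * m) ∸ 1 ≡ 4 * Ψ i (p ^ m) * c
    p^im∸1 i = begin
      p ^ (i * m) ∸ 1              ≡⟨ cong (λ z → p ^ z ∸ 1) (ℕₚ.*-comm i m) ⟩
      p ^ (m * i) ∸ 1              ≡⟨ cong (_∸ 1) (ℕₚ.^-*-assoc p m i) ⟨
      (p ^ m) ^ i ∸ 1              ≡⟨ Ψ-geometric-∸ i (p ^ m) (0<p^ m) ⟨
      Ψ i (p ^ m) * (p ^ m ∸ 1)    ≡⟨ cong (Ψ i (p ^ m) *_) 4c≡N ⟩
      Ψ i (p ^ m) * (4 * c)        ≡⟨ lem (Ψ i (p ^ m)) c ⟩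
      4 * Ψ i (p ^ m) * c          ∎
      where
      open ≡-Reasoning
      lem : ∀ L c → L * (4 * c) ≡ 4 * L * c
      lem = solve-∀

    r∣Ψ⇒r∣i : ∀ i → r ∣ Ψ i (p ^ m) → r ∣ i
    r∣Ψ⇒r∣i i r∣Ψ with Ψ≡i+y*w i U.N
    ... | w , e = ∣m+n∣m⇒∣n (subst (r ∣_) (trans (cong (Ψ i) (sym U.suc-N)) (trans e (ℕₚ.+-comm i (U.N * w)))) r∣Ψ) (∣m⇒∣m*n w r∣N)

    -- α has order r c and q^i - 1 = 4 Ψ_i(q) c, so a trivial power would give r ∣ 4 Ψ_i(q).
    -- Coprimality of 4 and r together with Ψ_i(q) ≡ i modulo r then yields r ∣ i, against 0 < i <
    -- r.
    α-distinct : ∀ i → 0 < i → i < r → pow α (p ^ (i * m) ∸ 1) ≢ 1#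
    α-distinct i 0<i i<r e = ∤-< prime-r 0<i i<r (r∣Ψ⇒r∣i i (coprime-divisor (coprime-sym coprime-4-r)
      (*-cancelʳ-∣ c {{>-nonZero 0<c}} (proj₂ order-α (4 * Ψ i (p ^ m) * c) (trans (cong (pow α) (sym (p^im∸1 i))) e)))))

    α-roots : ∀ i → pow (pow α (p ^ (i * m) ∸ 1)) r ≡ 1#
    α-roots i = begin
      pow (pow α (p ^ (i * m) ∸ 1)) r   ≡⟨ pow-* α (p ^ (i * m) ∸ 1) r ⟨
      pow α ((p ^ (i * m) ∸ 1) * r)     ≡⟨ cong (pow α) (trans (cong (_* r) (p^im∸1 i)) (lem (4 * Ψ i (p ^ m)) c r)) ⟩
      pow α (r * c * (4 * Ψ i (p ^ m))) ≡⟨ pow-* α (r * c) (4 * Ψ i (p ^ m)) ⟩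
      pow (pow α (r * c)) (4 * Ψ i (p ^ m)) ≡⟨ cong (λ z → pow z (4 * Ψ i (p ^ m))) (proj₁ order-α) ⟩
      pow 1# (4 * Ψ i (p ^ m))          ≡⟨ pow-1# (4 * Ψ i (p ^ m)) ⟩
      1#                                ∎
      where
      open ≡-Reasoning
      lem : ∀ L c r → L * c * r ≡ r * c * L
      lem = solve-∀

    p∤r : ¬ p ∣ r
    p∤r p∣r with prime⇒irreducible prime-r p∣r
    ... | inj₁ p≡1 = ℕₚ.<⇒≢ (prime>1 pr) (sym p≡1)
    ... | inj₂ p≡r = p≢r p≡r

    Sub-all : ∀ x → Sub (r * m) x
    Sub-all x with x ≟ 0#
    ... | yes refl = Sub-0 (r * m)
    ... | no x≢0 with log x≢0
    ...   | i , refl = begin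
        pow (pow ω i) (p ^ (r * m))               ≡⟨ cong (λ z → pow (pow ω i) z) (trans (cong (p ^_) E-eq) (trans (sym card≡) (sym (ℕₚ.m+[n∸m]≡n (ℕₚ.<⇒≤ 1<card))))) ⟩
        pow ω i ⊗ pow (pow ω i) M                 ≡⟨ cong (pow ω i ⊗_) (trans (pow-comm ω i M) (trans (cong (λ z → pow z i) (proj₁ order-ω)) (pow-1# i))) ⟩
        pow ω i ⊗ 1#                              ≡⟨ *-identityʳ _ ⟩
        pow ω i                                   ∎
      where open ≡-Reasoning

    coord : Carrier → ℕ → Carrier
    coord γ j = relTr r m (γ ⊗ pow α j)

    coord-Sub : ∀ γ j → Sub m (coord γ j)
    coord-Sub γ j = relTr-Sub r m (Sub-all _)

    coords : Carrier → List Carrier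
    coords γ = map (coord γ) (upTo r)

    relTr-⊖ : ∀ x y → relTr r m x ≡ relTr r m y → relTr r m (x ⊕ ⊖ y) ≡ 0#
    relTr-⊖ x y e = +-cancelʳ (relTr r m y) _ _ (begin
      relTr r m (x ⊕ ⊖ y) ⊕ relTr r m y  ≡⟨ relTr-⊕ r m (x ⊕ ⊖ y) y ⟨
      relTr r m ((x ⊕ ⊖ y) ⊕ y)          ≡⟨ cong (relTr r m) (trans (+-assoc x (⊖ y) y) (trans (cong (x ⊕_) (-‿inverseˡ y)) (+-identityʳ x))) ⟩
      relTr r m x                        ≡⟨ e ⟩
      relTr r m y                        ≡⟨ +-identityˡ _ ⟨
      0# ⊕ relTr r m y                   ∎)
      where open ≡-Reasoning

    tr-⊖ : ∀ x y → tr m x ≡ tr m y → tr m (x ⊕ ⊖ y) ≡ 0#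
    tr-⊖ x y e = +-cancelʳ (tr m y) _ _ (begin
      tr m (x ⊕ ⊖ y) ⊕ tr m y  ≡⟨ tr-⊕ m (x ⊕ ⊖ y) y ⟨
      tr m ((x ⊕ ⊖ y) ⊕ y)     ≡⟨ cong (tr m) (trans (+-assoc x (⊖ y) y) (trans (cong (x ⊕_) (-‿inverseˡ y)) (+-identityʳ x))) ⟩
      tr m x                   ≡⟨ e ⟩
      tr m y                   ≡⟨ +-identityˡ _ ⟨
      0# ⊕ tr m y              ∎)
      where open ≡-Reasoning

    [x-y]z : ∀ x y z → (x ⊕ ⊖ y) ⊗ z ≡ x ⊗ z ⊕ ⊖ (y ⊗ z)
    [x-y]z x y z = trans (distribʳ z x (⊖ y)) (cong (x ⊗ z ⊕_) (sym (-‿distribˡ-* y z)))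

    coord-injective : ∀ γ γ′ → (∀ j → j < r → coord γ j ≡ coord γ′ j) → γ ≡ γ′
    coord-injective γ γ′ h = x-y≡0⇒x≡y γ γ′ (relTr-nondegenerate r m 0<r r α≢0 p∤r α-roots α-distinct (γ ⊕ ⊖ γ′)
      (λ j j<r → trans (cong (relTr r m) ([x-y]z γ γ′ (pow α j))) (relTr-⊖ _ _ (h j j<r))))

    coords-injective : ∀ {γ γ′} → coords γ ≡ coords γ′ → γ ≡ γ′
    coords-injective {γ} {γ′} e = coord-injective γ γ′ (λ j j<r → map-≡⁻ (coord γ) (coord γ′) (upTo r) e (∈-upTo⁺ j<r))

    -- Injectivity is enough, since there are q^r words and equally many field elements.
    coords-↭ : map coords elements ↭ words K r
    coords-↭ = unique-⊆⇒↭ (Uniqueₚ.map⁺ coords-injective unique) in-words (ℕₚ.≤-reflexive (begin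
      length (words K r)            ≡⟨ length-words K r ⟩
      length K ^ r                  ≡⟨ cong (_^ r) U.length-sub ⟩
      (p ^ m) ^ r                   ≡⟨ ℕₚ.^-*-assoc p m r ⟩
      p ^ (m * r)                   ≡⟨ cong (p ^_) (trans (ℕₚ.*-comm m r) E-eq) ⟩
      p ^ E                         ≡⟨ card≡ ⟨
      card                          ≡⟨ length-map coords elements ⟨
      length (map coords elements)  ∎))
      where
      open ≡-Reasoning
      in-words : ∀ {v} → v ∈ map coords elements → v ∈ words K r
      in-words v∈ with ∈-map⁻ coords v∈
      ... | γ , _ , refl = subst (_∈ words K r) (sym (map-upTo (coord γ) r)) (applyUpTo∈words r (coord γ) (λ j → ∈sub⁺ {m} (coord-Sub γ j)))

    entry : Carrier → ℕ → Carrier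
    entry γ i = trace p E (γ ⊗ pow ω (k * i))

    trace≡tr : ∀ e x → trace p e x ≡ tr e x
    trace≡tr e x = go (upTo e)
      where
      go : ∀ js → foldr _⊕_ 0# (map (λ j → pow x (p ^ j)) js) ≡ ∑ᶠ js (λ j → pow x (p ^ j))
      go []       = refl
      go (j ∷ js) = cong (pow x (p ^ j) ⊕_) (go js)

    -- α^(i r + j) = β^i α^j, and β^i ∈ 𝔽_q leaves the relative trace. The positions congruent to j
    -- modulo r thus depend on γ only through the coordinate `coord γ j`.
    entry≡ : ∀ γ i j → entry γ (i * r + j) ≡ tr m (coord γ j ⊗ pow β i)
    entry≡ γ i j = begin
      trace p E (γ ⊗ pow ω (k * (i * r + j)))        ≡⟨ trace≡tr E _ ⟩
      tr E (γ ⊗ pow ω (k * (i * r + j)))             ≡⟨ cong₂ tr (sym E-eq) (trans (cong (γ ⊗_) split) (trans (sym (*-assoc γ _ _)) (trans (cong (_⊗ pow α j) (*-comm γ _)) (*-assoc _ γ _)))) ⟩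
      tr (r * m) (pow β i ⊗ (γ ⊗ pow α j))           ≡⟨ tr-tower r m _ ⟩
      tr m (relTr r m (pow β i ⊗ (γ ⊗ pow α j)))     ≡⟨ cong (tr m) (trans (relTr-scale r m (γ ⊗ pow α j) (Sub-pow m i β-Sub)) (*-comm _ _)) ⟩
      tr m (coord γ j ⊗ pow β i)                     ∎
      where
      open ≡-Reasoning
      split : pow ω (k * (i * r + j)) ≡ pow β i ⊗ pow α j
      split = trans (pow-* ω k (i * r + j)) (trans (pow-+ α (i * r) j) (cong (_⊗ pow α j) (trans (cong (pow α) (ℕₚ.*-comm i r)) (trans (pow-* α r i) (cong (λ z → pow z i) α^r≡β)))))

    cw : Carrier → List Carrier
    cw = codeword p E k n ω

    -- The positions in one residue class modulo r determine a coordinate by `tr-β-injective`, and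
    -- the coordinates determine γ. Hence deduplication removes nothing and codewords may be counted
    -- by field elements.
    cw-injective : ∀ {γ γ′} → cw γ ≡ cw γ′ → γ ≡ γ′
    cw-injective {γ} {γ′} e = coord-injective γ γ′ (λ j j<r → x-y≡0⇒x≡y _ _ (tr-β-injective _ (λ i i<c →
      trans (cong (tr m) ([x-y]z (coord γ j) (coord γ′ j) (pow β i))) (tr-⊖ _ _ (begin
        tr m (coord γ j ⊗ pow β i)   ≡⟨ entry≡ γ i j ⟨
        entry γ (i * r + j)          ≡⟨ map-≡⁻ (entry γ) (entry γ′) (upTo n) e (∈-upTo⁺ (index i j i<c j<r)) ⟩
        entry γ′ (i * r + j)         ≡⟨ entry≡ γ′ i j ⟩
        tr m (coord γ′ j ⊗ pow β i)  ∎)))))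
      where
      open ≡-Reasoning
      index : ∀ i j → i < c → j < r → i * r + j < n
      index i j i<c j<r = subst (i * r + j <_) (sym n≡c*r) (ℕₚ.<-≤-trans (ℕₚ.+-monoʳ-< (i * r) j<r) (subst (_≤ c * r) (ℕₚ.+-comm r (i * r)) (ℕₚ.*-monoˡ-≤ r i<c)))

    weight-cw : ∀ γ → weight (cw γ) ≡ ∑ⁿ (coords γ) W
    weight-cw γ = begin
      weight (cw γ)
        ≡⟨ length-filter≡∑ (λ x → ¬? (x ≟ 0#)) (cw γ) ⟩
      ∑ⁿ (cw γ) (λ x → 𝟙ⁿ (¬? (x ≟ 0#)))
        ≡⟨ ℕ∑.∑-map (entry γ) (upTo n) _ ⟩
      ∑ⁿ (upTo n) (λ i → 𝟙ⁿ (¬? (entry γ i ≟ 0#)))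
        ≡⟨ cong (λ N → ∑ⁿ (upTo N) (λ i → 𝟙ⁿ (¬? (entry γ i ≟ 0#)))) n≡c*r ⟩
      ∑ⁿ (upTo (c * r)) (λ i → 𝟙ⁿ (¬? (entry γ i ≟ 0#)))
        ≡⟨ ℕ∑.∑-upTo-* c r _ ⟩
      ∑ⁿ (upTo c) (λ i → ∑ⁿ (upTo r) (λ j → 𝟙ⁿ (¬? (entry γ (i * r + j) ≟ 0#))))
        ≡⟨ ℕ∑.∑-cong′ (upTo c) (λ i → ℕ∑.∑-cong′ (upTo r) (λ j → cong (λ z → 𝟙ⁿ (¬? (z ≟ 0#))) (entry≡ γ i j))) ⟩
      ∑ⁿ (upTo c) (λ i → ∑ⁿ (upTo r) (λ j → 𝟙ⁿ (¬? (tr m (coord γ j ⊗ pow β i) ≟ 0#))))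
        ≡⟨ ℕ∑.∑-swap (upTo c) (upTo r) _ ⟩
      ∑ⁿ (upTo r) (λ j → W (coord γ j))
        ≡⟨ ℕ∑.∑-map (coord γ) (upTo r) W ⟨
      ∑ⁿ (coords γ) W ∎
      where open ≡-Reasoning

  frequency≡ : ∀ w → frequency p E k n ω w ≡ ∑ⁿ (words K r) (λ v → 𝟙ⁿ (∑ⁿ v W ℕₚ.≟ w))
  frequency≡ w = begin
    frequency p E k n ω w
      ≡⟨ cong (λ vs → length (filter (λ v → weight v ℕₚ.≟ w) vs)) (deduplicate-unique (≡-dec _≟_) (Uniqueₚ.map⁺ cw-injective unique)) ⟩
    length (filter (λ v → weight v ℕₚ.≟ w) (map cw elements))
      ≡⟨ length-filter≡∑ (λ v → weight v ℕₚ.≟ w) (map cw elements) ⟩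
    ∑ⁿ (map cw elements) (λ v → 𝟙ⁿ (weight v ℕₚ.≟ w))
      ≡⟨ ℕ∑.∑-map cw elements _ ⟩
    ∑ⁿ elements (λ γ → 𝟙ⁿ (weight (cw γ) ℕₚ.≟ w))
      ≡⟨ ℕ∑.∑-cong′ elements (λ γ → cong (λ z → 𝟙ⁿ (z ℕₚ.≟ w)) (weight-cw γ)) ⟩
    ∑ⁿ elements (λ γ → 𝟙ⁿ (∑ⁿ (coords γ) W ℕₚ.≟ w))
      ≡⟨ ℕ∑.∑-map coords elements _ ⟨
    ∑ⁿ (map coords elements) (λ v → 𝟙ⁿ (∑ⁿ v W ℕₚ.≟ w))
      ≡⟨ ℕ∑.∑-↭ coords-↭ _ ⟩
    ∑ⁿ (words K r) (λ v → 𝟙ⁿ (∑ⁿ v W ℕₚ.≟ w)) ∎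
    where open ≡-Reasoning

  -- The distribution of the four class weights on 𝔽_q.

  private
    δ₁ δι δ₋₁ δ₋ι : Carrier
    δ₁  = 1#
    δι  = gen
    δ₋₁ = pow gen 2
    δ₋ι = pow gen 3

    δ₋₁^c : pow δ₋₁ c ≡ ⊖ 1#
    δ₋₁^c = trans (sym (pow-* gen 2 c)) gen^2c

    δ₋ι^c : pow δ₋ι c ≡ ⊖ ι
    δ₋ι^c = trans (pow-⊗ gen (pow gen 2) c) (trans (cong (ι ⊗_) δ₋₁^c) (trans (*-comm ι (⊖ 1#)) (sym (⊖≡⊖1⊗ ι))))

    yes! : ∀ {x y} → x ≡ y → 𝟙ⁿ (x ≟ y) ≡ 1
    yes! {x} {y} = ℕ∑.𝟙-yes (x ≟ y)
    no! : ∀ {x y} → x ≢ y → 𝟙ⁿ (x ≟ y) ≡ 0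
    no! {x} {y} = ℕ∑.𝟙-no (x ≟ y)
    no˘ : ∀ {x y} → y ≢ x → 𝟙ⁿ (x ≟ y) ≡ 0
    no˘ h = no! (h ∘ sym)

    five : ∀ {a b c d e a′ b′ c′ d′ e′ : ℕ} → a ≡ a′ → b ≡ b′ → c ≡ c′ → d ≡ d′ → e ≡ e′ → a + (b + c + d + e) ≡ a′ + (b′ + c′ + d′ + e′)
    five refl refl refl refl refl = refl

    -- The order -1, 1, -ι, ι is that of the tuple ℓ₁, ℓ₂, ℓ₃, ℓ₄. As periods enter weights
    -- negatively, it is the class -1 that carries +a, and the class -ι that carries +2b.
    partition : ∀ {z} → Quart z → 𝟙ⁿ (z ≟ 0#) + (𝟙ⁿ (z ≟ (⊖ 1#)) + 𝟙ⁿ (z ≟ 1#) + 𝟙ⁿ (z ≟ (⊖ ι)) + 𝟙ⁿ (z ≟ ι)) ≡ 1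
    partition q0  = five (yes! refl) (no˘ (⊖≢0 1≢0)) (no˘ 1≢0) (no˘ (⊖≢0 ι≢0)) (no˘ ι≢0)
    partition q1  = five (no! 1≢0) (no! 1≢⊖1) (yes! refl) (no! (λ e → ι≢⊖1 (trans (sym (-‿involutive ι)) (cong ⊖_ (sym e))))) (no˘ ι≢1)
    partition qι  = five (no! ι≢0) (no! ι≢⊖1) (no! ι≢1) (no! ι≢⊖ι) (yes! refl)
    partition q-1 = five (no! (⊖≢0 1≢0)) (yes! refl) (no˘ 1≢⊖1) (no! (λ e → ι≢1 (sym (⊖-injective e)))) (no˘ ι≢⊖1)
    partition q-ι = five (no! (⊖≢0 ι≢0)) (no! (λ e → ι≢1 (⊖-injective e))) (no! (λ e → ι≢⊖1 (trans (sym (-‿involutive ι)) (cong ⊖_ e)))) (yes! refl) (no˘ ι≢⊖ι)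

    gen^≢0 : ∀ i → pow gen i ≢ 0#
    gen^≢0 i = pow≢0 i gen≢0

  module Classes (Q : QuarticSum) where
    open QuarticSum Q
    open Weights Q

    private
      cancel-4p : ∀ {x y} {z : ℤ} → pos (4 * p * x) ≡ z → pos (4 * p * y) ≡ z → x ≡ y
      cancel-4p {x} {y} e e′ = ℕₚ.*-cancelˡ-≡ x y (4 * p) {{ℕₚ.m*n≢0 4 p {{_}} {{prime⇒nonZero pr}}}} (ℤₚ.+-injective (trans e (sym e′)))

      -- W is constant on the class because the formula gives 4p W the same value N at each of its
      -- members; the class has c members by `coset-↭`.
      class-part : ∀ {δ z₀ N} → δ ≢ 0# → Sub m δ → pow δ c ≡ z₀ →
        (∀ {x} → x ≢ 0# → Sub m x → pow x c ≡ z₀ → pos (4 * p * W x) ≡ N) →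
        ∀ (f : ℕ → ℕ) → ∑ⁿ K (λ x → 𝟙ⁿ (pow x c ≟ z₀) * f (W x)) ≡ c * f (W δ)
      class-part {δ} δ≢0 sδ refl formula f = begin
        ∑ⁿ K (λ x → 𝟙ⁿ (pow x c ≟ pow δ c) * f (W x))      ≡⟨ ℕ∑.∑-filter (λ x → pow x c ≟ pow δ c) K (f ∘ W) ⟨
        ∑ⁿ (filter (λ x → pow x c ≟ pow δ c) K) (f ∘ W)    ≡⟨ ℕ∑.∑-cong _ (λ x x∈ → cong f (same x x∈)) ⟩
        ∑ⁿ (filter (λ x → pow x c ≟ pow δ c) K) (λ _ → f (W δ)) ≡⟨ ℕ∑.∑-↭ (coset-↭ δ≢0 sδ) (λ _ → f (W δ)) ⟨
        ∑ⁿ (map (λ i → δ ⊗ pow β i) (upTo c)) (λ _ → f (W δ)) ≡⟨ ℕ∑.∑-const (map (λ i → δ ⊗ pow β i) (upTo c)) (f (W δ)) ⟩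
        ℕ∑.nat (length (map (λ i → δ ⊗ pow β i) (upTo c))) * f (W δ) ≡⟨ cong (_* f (W δ)) (trans (ℕnat (length (map (λ i → δ ⊗ pow β i) (upTo c)))) (trans (length-map (λ i → δ ⊗ pow β i) (upTo c)) (length-upTo c))) ⟩
        c * f (W δ)                                        ∎
        where
        open ≡-Reasoning
        same : ∀ x → x ∈ filter (λ x → pow x c ≟ pow δ c) K → W x ≡ W δ
        same x x∈ = cancel-4p (formula x≢0 (∈sub⁻ {m} (proj₁ x∈′)) (proj₂ x∈′)) (formula δ≢0 sδ refl)
          where
          x∈′ = ∈-filter⁻ (λ x → pow x c ≟ pow δ c) {xs = K} x∈
          x≢0 : x ≢ 0#
          x≢0 x≡0 = pow≢0 c δ≢0 (trans (sym (proj₂ x∈′)) (trans (cong (λ z → pow z c) x≡0) (pow-0# c 0<c)))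

      zero-part : ∀ (f : ℕ → ℕ) → ∑ⁿ K (λ x → 𝟙ⁿ (pow x c ≟ 0#) * f (W x)) ≡ f 0
      zero-part f = trans (ℕ∑.∑-single (sub-unique m) (∈sub⁺ {m} (Sub-0 m)) (λ x → 𝟙ⁿ (pow x c ≟ 0#) * f (W x)) (λ x _ x≢0 → cong (_* f (W x)) (no! (pow≢0 c x≢0))))
        (trans (cong₂ _*_ (yes! (pow-0# c 0<c)) (cong f W-0)) (ℕₚ.*-identityˡ (f 0)))

    w₋₁ w₁ w₋ι wι : ℕ
    w₋₁ = W δ₋₁
    w₁  = W δ₁
    w₋ι = W δ₋ι
    wι  = W δι

    w₋₁-formula : pos (4 * p * w₋₁) ≡ numerator 1ℤ (⁻ -1ℤ *ᶻ a)
    w₋₁-formula = W-⊖1 (gen^≢0 2) (Sub-pow m 2 gen-Sub) δ₋₁^c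
    w₁-formula : pos (4 * p * w₁) ≡ numerator 1ℤ (⁻ 1ℤ *ᶻ a)
    w₁-formula = W-1 1≢0 (Sub-1 m) (pow-1# c)
    w₋ι-formula : pos (4 * p * w₋ι) ≡ numerator -1ℤ (⁻ -1ℤ *ᶻ (pos 2 *ᶻ b))
    w₋ι-formula = W-⊖ι (gen^≢0 3) (Sub-pow m 3 gen-Sub) δ₋ι^c
    wι-formula : pos (4 * p * wι) ≡ numerator -1ℤ (⁻ 1ℤ *ᶻ (pos 2 *ᶻ b))
    wι-formula = W-ι gen≢0 gen-Sub refl

    class-sum : ∀ (f : ℕ → ℕ) → ∑ⁿ K (f ∘ W) ≡ f 0 + c * (f w₋₁ + f w₁ + f w₋ι + f wι)
    class-sum f = begin
      ∑ⁿ K (f ∘ W)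
        ≡⟨ ℕ∑.∑-cong K (λ x x∈ → trans (sym (ℕₚ.*-identityˡ (f (W x)))) (trans (cong (_* f (W x)) (sym (partition (quart (∈sub⁻ {m} x∈)))))
             (l₁ (𝟙ⁿ (pow x c ≟ 0#)) (𝟙ⁿ (pow x c ≟ (⊖ 1#))) (𝟙ⁿ (pow x c ≟ 1#)) (𝟙ⁿ (pow x c ≟ (⊖ ι))) (𝟙ⁿ (pow x c ≟ ι)) (f (W x))))) ⟩
      ∑ⁿ K (λ x → part 0# x + (part (⊖ 1#) x + (part 1# x + (part (⊖ ι) x + part ι x))))
        ≡⟨ trans (ℕ∑.∑-⊕ K (part 0#) _) (cong (∑ⁿ K (part 0#) +_) (trans (ℕ∑.∑-⊕ K (part (⊖ 1#)) _) (cong (∑ⁿ K (part (⊖ 1#)) +_) (trans (ℕ∑.∑-⊕ K (part 1#) _) (cong (∑ⁿ K (part 1#) +_) (ℕ∑.∑-⊕ K (part (⊖ ι)) (part ι))))))) ⟩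
      ∑ⁿ K (part 0#) + (∑ⁿ K (part (⊖ 1#)) + (∑ⁿ K (part 1#) + (∑ⁿ K (part (⊖ ι)) + ∑ⁿ K (part ι))))
        ≡⟨ cong₂ _+_ (zero-part f) (cong₂ _+_ (class-part (gen^≢0 2) (Sub-pow m 2 gen-Sub) δ₋₁^c W-⊖1 f) (cong₂ _+_ (class-part 1≢0 (Sub-1 m) (pow-1# c) W-1 f)
             (cong₂ _+_ (class-part (gen^≢0 3) (Sub-pow m 3 gen-Sub) δ₋ι^c W-⊖ι f) (class-part gen≢0 gen-Sub refl W-ι f)))) ⟩
      f 0 + (c * f w₋₁ + (c * f w₁ + (c * f w₋ι + c * f wι)))
        ≡⟨ l₂ (f 0) c (f w₋₁) (f w₁) (f w₋ι) (f wι) ⟩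
      f 0 + c * (f w₋₁ + f w₁ + f w₋ι + f wι) ∎
      where
      open ≡-Reasoning
      part : Carrier → Carrier → ℕ
      part z x = 𝟙ⁿ (pow x c ≟ z) * f (W x)
      l₁ : ∀ i j k l n y → (i + (j + k + l + n)) * y ≡ i * y + (j * y + (k * y + (l * y + n * y)))
      l₁ = solve-∀
      l₂ : ∀ z c x y u v → z + (c * x + (c * y + (c * u + c * v))) ≡ z + c * (x + y + u + v)
      l₂ = solve-∀

  private
    pos-dot : ∀ P w₁ w₂ w₃ w₄ l₁ l₂ l₃ l₄ → pos (P * (l₁ * w₁ + l₂ * w₂ + l₃ * w₃ + l₄ * w₄)) ≡
              pos l₁ *ᶻ pos (P * w₁) +ᶻ pos l₂ *ᶻ pos (P * w₂) +ᶻ pos l₃ *ᶻ pos (P * w₃) +ᶻ pos l₄ *ᶻ pos (P * w₄)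
    pos-dot P w₁ w₂ w₃ w₄ l₁ l₂ l₃ l₄ = trans (cong pos (lem P w₁ w₂ w₃ w₄ l₁ l₂ l₃ l₄))
      (trans (ℤₚ.pos-+ _ (l₄ * (P * w₄))) (cong₂ _+ᶻ_ (trans (ℤₚ.pos-+ _ (l₃ * (P * w₃))) (cong₂ _+ᶻ_ (trans (ℤₚ.pos-+ _ (l₂ * (P * w₂))) (cong₂ _+ᶻ_ (ℤₚ.pos-* l₁ (P * w₁)) (ℤₚ.pos-* l₂ (P * w₂)))) (ℤₚ.pos-* l₃ (P * w₃)))) (ℤₚ.pos-* l₄ (P * w₄))))
      where
      lem : ∀ P w₁ w₂ w₃ w₄ l₁ l₂ l₃ l₄ → P * (l₁ * w₁ + l₂ * w₂ + l₃ * w₃ + l₄ * w₄) ≡ l₁ * (P * w₁) + l₂ * (P * w₂) + l₃ * (P * w₃) + l₄ * (P * w₄)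
      lem = solve-∀

  -- The four weights are parameters tied to a and b only by their formulas, so a change of sign of
  -- a or b can later be absorbed by exchanging two of them. Distinct profiles may share a weight;
  -- both sides then add their counts.
  frequency≡predicted : ∀ (a b : ℤ) (w₁ w₂ w₃ w₄ : ℕ) →
    (∀ (f : ℕ → ℕ) → ∑ⁿ K (f ∘ W) ≡ f 0 + c * (f w₁ + f w₂ + f w₃ + f w₄)) →
    pos (4 * p * w₁) ≡ numerator 1ℤ a → pos (4 * p * w₂) ≡ numerator 1ℤ (⁻ a) →
    pos (4 * p * w₃) ≡ numerator -1ℤ (pos 2 *ᶻ b) → pos (4 * p * w₄) ≡ numerator -1ℤ (⁻ (pos 2 *ᶻ b)) →
    ∀ w → frequency p E k n ω w ≡ predictedFrequency p t (p ^ m) r c a b w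
  frequency≡predicted a b w₁ w₂ w₃ w₄ class-sum f₁ f₂ f₃ f₄ w = begin
    frequency p E k n ω w
      ≡⟨ frequency≡ w ⟩
    ∑ⁿ (words K r) (λ v → 𝟙ⁿ (∑ⁿ v W ℕₚ.≟ w))
      ≡⟨ ∑-words K W c w₁ w₂ w₃ w₄ class-sum r (λ x → 𝟙ⁿ (x ℕₚ.≟ w)) ⟩
    count c r (λ l → 𝟙ⁿ (wt l ℕₚ.≟ w))
      ≡⟨ count-A c r _ ⟩
    ∑ⁿ (tuples r) (λ l → A r c l * 𝟙ⁿ (wt l ℕₚ.≟ w))
      ≡⟨ ℕ∑.∑-cong′ (tuples r) (λ l → trans (ℕₚ.*-comm (A r c l) _) (cong (_* A r c l) (ℕ∑.𝟙-cong (wt l ℕₚ.≟ w) (P? l) (to l) (from l)))) ⟩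
    ∑ⁿ (tuples r) (λ l → 𝟙ⁿ (P? l) * A r c l)
      ≡⟨ ℕ∑.∑-filter P? (tuples r) (A r c) ⟨
    ∑ⁿ (filter P? (tuples r)) (A r c)
      ≡⟨ sum-map≡∑ (A r c) (filter P? (tuples r)) ⟨
    predictedFrequency p t (p ^ m) r c a b w ∎
    where
    open ≡-Reasoning
    wt : Tuple → ℕ
    wt = dot K W c w₁ w₂ w₃ w₄ class-sum
    P? : ∀ l → Dec (pos (4 * p * w) ≡ pos (p ∸ 1) *ᶻ weightNumerator p t (p ^ m) a b l)
    P? l = pos (4 * p * w) ℤ.≟ pos (p ∸ 1) *ᶻ weightNumerator p t (p ^ m) a b l
    wt-formula : ∀ l → pos (4 * p * wt l) ≡ pos (p ∸ 1) *ᶻ weightNumerator p t (p ^ m) a b l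
    wt-formula (l₁ , l₂ , l₃ , l₄) = begin
      pos (4 * p * (l₁ * w₁ + l₂ * w₂ + l₃ * w₃ + l₄ * w₄))
        ≡⟨ pos-dot (4 * p) w₁ w₂ w₃ w₄ l₁ l₂ l₃ l₄ ⟩
      pos l₁ *ᶻ pos (4 * p * w₁) +ᶻ pos l₂ *ᶻ pos (4 * p * w₂) +ᶻ pos l₃ *ᶻ pos (4 * p * w₃) +ᶻ pos l₄ *ᶻ pos (4 * p * w₄)
        ≡⟨ cong₂ _+ᶻ_ (cong₂ _+ᶻ_ (cong₂ (λ x y → pos l₁ *ᶻ x +ᶻ pos l₂ *ᶻ y) f₁ f₂) (cong (pos l₃ *ᶻ_) f₃)) (cong (pos l₄ *ᶻ_) f₄) ⟩
      pos l₁ *ᶻ numerator 1ℤ a +ᶻ pos l₂ *ᶻ numerator 1ℤ (⁻ a) +ᶻ pos l₃ *ᶻ numerator -1ℤ (pos 2 *ᶻ b) +ᶻ pos l₄ *ᶻ numerator -1ℤ (⁻ (pos 2 *ᶻ b))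
        ≡⟨ collect p-1 (pos (p ^ m)) (pos s) T a b (pos l₁) (pos l₂) (pos l₃) (pos l₄) ⟩
      p-1 *ᶻ ((pos l₁ +ᶻ pos l₂ +ᶻ pos l₃ +ᶻ pos l₄) *ᶻ pos (p ^ m) +ᶻ (pos l₁ +ᶻ pos l₂ -ᶻ pos l₃ -ᶻ pos l₄) *ᶻ pos s +ᶻ (pos 2 *ᶻ a *ᶻ (pos l₁ -ᶻ pos l₂) +ᶻ pos 4 *ᶻ b *ᶻ (pos l₃ -ᶻ pos l₄)) *ᶻ T)
        ≡⟨ cong₂ (λ x y → x *ᶻ (y +ᶻ (pos l₁ +ᶻ pos l₂ -ᶻ pos l₃ -ᶻ pos l₄) *ᶻ pos s +ᶻ (pos 2 *ᶻ a *ᶻ (pos l₁ -ᶻ pos l₂) +ᶻ pos 4 *ᶻ b *ᶻ (pos l₃ -ᶻ pos l₄)) *ᶻ T)) (sym pos-p∸1)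
             (sym (trans (ℤₚ.pos-* (l₁ + l₂ + l₃ + l₄) (p ^ m)) (cong (_*ᶻ pos (p ^ m)) (trans (ℤₚ.pos-+ (l₁ + l₂ + l₃) l₄) (cong (_+ᶻ pos l₄) (trans (ℤₚ.pos-+ (l₁ + l₂) l₃) (cong (_+ᶻ pos l₃) (ℤₚ.pos-+ l₁ l₂)))))))) ⟩
      pos (p ∸ 1) *ᶻ weightNumerator p t (p ^ m) a b (l₁ , l₂ , l₃ , l₄) ∎
      where
      collect : ∀ P q s T a b x y z u →
        x *ᶻ (P *ᶻ (q +ᶻ 1ℤ *ᶻ s +ᶻ pos 2 *ᶻ (a *ᶻ T))) +ᶻ y *ᶻ (P *ᶻ (q +ᶻ 1ℤ *ᶻ s +ᶻ pos 2 *ᶻ (⁻ a *ᶻ T))) +ᶻ z *ᶻ (P *ᶻ (q +ᶻ -1ℤ *ᶻ s +ᶻ pos 2 *ᶻ (pos 2 *ᶻ b *ᶻ T))) +ᶻ u *ᶻ (P *ᶻ (q +ᶻ -1ℤ *ᶻ s +ᶻ pos 2 *ᶻ (⁻ (pos 2 *ᶻ b) *ᶻ T)))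
        ≡ P *ᶻ ((x +ᶻ y +ᶻ z +ᶻ u) *ᶻ q +ᶻ (x +ᶻ y -ᶻ z -ᶻ u) *ᶻ s +ᶻ (pos 2 *ᶻ a *ᶻ (x -ᶻ y) +ᶻ pos 4 *ᶻ b *ᶻ (z -ᶻ u)) *ᶻ T)
      collect = solveℤ
    to : ∀ l → wt l ≡ w → pos (4 * p * w) ≡ pos (p ∸ 1) *ᶻ weightNumerator p t (p ^ m) a b l
    to l e = trans (cong (λ x → pos (4 * p * x)) (sym e)) (wt-formula l)
    from : ∀ l → pos (4 * p * w) ≡ pos (p ∸ 1) *ᶻ weightNumerator p t (p ^ m) a b l → wt l ≡ w
    from l e = ℕₚ.*-cancelˡ-≡ (wt l) w (4 * p) {{ℕₚ.m*n≢0 4 p {{_}} {{prime⇒nonZero pr}}}} (ℤₚ.+-injective (trans (wt-formula l) (sym e)))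

  -- Normalised a and b, and independence of the choice of signs.

  private
    p∤⇒gcd≡1 : ∀ a → ¬ pos p ∣ᶻ a → gcd ℤ.∣ a ∣ p ≡ 1
    p∤⇒gcd≡1 a p∤a = by-cases (prime⇒irreducible pr (gcd[m,n]∣n ℤ.∣ a ∣ p))
      where
      by-cases : gcd ℤ.∣ a ∣ p ≡ 1 ⊎ gcd ℤ.∣ a ∣ p ≡ p → gcd ℤ.∣ a ∣ p ≡ 1
      by-cases (inj₁ e) = e
      by-cases (inj₂ e) = ⊥-elim (p∤a (∣ᵤ⇒∣ (subst (_∣ ℤ.∣ a ∣) e (gcd[m,n]∣m ℤ.∣ a ∣ p))))

    gcd≡1⇒p∤ : ∀ a → gcd ℤ.∣ a ∣ p ≡ 1 → ¬ pos p ∣ᶻ a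
    gcd≡1⇒p∤ a e p∣a = ∤-< pr (s≤s z≤n) (prime>1 pr) (subst (p ∣_) e (gcd-greatest (∣⇒∣ᵤ p∣a) ∣-refl))

    p∤2 : ¬ p ∣ 2
    p∤2 = ∤-< pr (s≤s z≤n) (ℕₚ.≤-trans (s≤s (s≤s (s≤s z≤n))) (subst (5 ≤_) (sym p-eq) (ℕₚ.+-monoˡ-≤ 1 (ℕₚ.*-monoʳ-≤ 4 0<d))))
      where
      0<d : 0 < d
      0<d = ℕₚ.n≢0⇒n>0 (λ { refl → ℕₚ.<⇒≢ (prime>1 pr) (sym p-eq) })

    4bb : ∀ b → pos 4 *ᶻ b *ᶻ b ≡ (pos 2 *ᶻ b) *ᶻ (pos 2 *ᶻ b)
    4bb = solveℤ

    ⁻aa : ∀ a → ⁻ a *ᶻ ⁻ a ≡ a *ᶻ a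
    ⁻aa = solveℤ

    ⁻⁻1* : ∀ x → ⁻ -1ℤ *ᶻ x ≡ x
    ⁻⁻1* = solveℤ

    ⁻1* : ∀ x → ⁻ 1ℤ *ᶻ x ≡ ⁻ x
    ⁻1* = solveℤ

    0<e₂ : 0 < e₂
    0<e₂ = ℕₚ.≤-trans 0<t (ℕₚ.m≤m+n t (t + 0))

  -- The a of the Gauss sum is odd, so exactly one of a and -a is 1 modulo 4.
  abCond-exists : QuarticSum → ∃₂ λ a b → ABCond p t a b
  abCond-exists Q = from-parity (proj₁ a-odd) (proj₂ a-odd) (parity (proj₁ a-odd))
    where
    open QuarticSum Q
    from-parity : ∀ k → a ≡ pos 2 *ᶻ k +ᶻ 1ℤ → (∃ λ l → k ≡ pos 2 *ᶻ l) ⊎ (∃ λ l → k ≡ pos 2 *ᶻ l +ᶻ 1ℤ) → ∃₂ λ a b → ABCond p t a b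
    from-parity k a≡ (inj₁ (l , k≡)) = a , b , trans (sym norm) (cong (a *ᶻ a +ᶻ_) (sym (4bb b))) ,
        ∣⇒∣ᵤ {pos 4} {a -ᶻ pos 1} (dividesᶻ l (trans (cong (_-ᶻ pos 1) (trans a≡ (cong (λ z → pos 2 *ᶻ z +ᶻ 1ℤ) k≡))) (lem l))) , p∤⇒gcd≡1 a p∤a
      where
      lem : ∀ l → pos 2 *ᶻ (pos 2 *ᶻ l) +ᶻ 1ℤ -ᶻ 1ℤ ≡ l *ᶻ pos 4
      lem = solveℤ
    -- Here a = 4l + 3, whence -a - 1 = -4(l + 1).
    from-parity k a≡ (inj₂ (l , k≡)) = ⁻ a , b , trans (sym norm) (cong₂ _+ᶻ_ (sym (⁻aa a)) (sym (4bb b))) ,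
        ∣⇒∣ᵤ {pos 4} {⁻ a -ᶻ pos 1} (dividesᶻ (⁻ (l +ᶻ 1ℤ)) (trans (cong (λ z → ⁻ z -ᶻ pos 1) (trans a≡ (cong (λ z → pos 2 *ᶻ z +ᶻ 1ℤ) k≡))) (lem l))) ,
        trans (cong (λ z → gcd z p) (ℤₚ.∣-i∣≡∣i∣ a)) (p∤⇒gcd≡1 a p∤a)
      where
      lem : ∀ l → ⁻ (pos 2 *ᶻ (pos 2 *ᶻ l +ᶻ 1ℤ) +ᶻ 1ℤ) -ᶻ 1ℤ ≡ ⁻ (l +ᶻ 1ℤ) *ᶻ pos 4
      lem = solveℤ

  module _ (Q₀ : QuarticSum) (a b : ℤ) (ab : ABCond p t a b) where

    private
      module Q = QuarticSum Q₀
      open Classes Q₀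

      ab-norm : a *ᶻ a +ᶻ (pos 2 *ᶻ b) *ᶻ (pos 2 *ᶻ b) ≡ pos s
      ab-norm = trans (cong (a *ᶻ a +ᶻ_) (sym (4bb b))) (sym (proj₁ ab))

      odd : ∃ λ k → a ≡ pos 2 *ᶻ k +ᶻ 1ℤ
      odd = go (∣ᵤ⇒∣ (proj₁ (proj₂ ab)))
        where
        lem₁ : ∀ a → a ≡ (a -ᶻ 1ℤ) +ᶻ 1ℤ
        lem₁ = solveℤ
        lem₂ : ∀ k → k *ᶻ pos 4 +ᶻ 1ℤ ≡ pos 2 *ᶻ (pos 2 *ᶻ k) +ᶻ 1ℤ
        lem₂ = solveℤ
        go : pos 4 ∣ᶻ a -ᶻ pos 1 → ∃ λ k → a ≡ pos 2 *ᶻ k +ᶻ 1ℤ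
        go (dividesᶻ k e) = pos 2 *ᶻ k , trans (lem₁ a) (trans (cong (_+ᶻ 1ℤ) e) (lem₂ k))

      aa≡ : a *ᶻ a ≡ Q.a *ᶻ Q.a
      aa≡ = representation-unique pr p∤2 e₂ 0<e₂ a b Q.a Q.b ab-norm Q.norm (gcd≡1⇒p∤ a (proj₂ (proj₂ ab))) Q.p∤a odd Q.a-odd

      b-roots : b ≡ Q.b ⊎ b ≡ ⁻ Q.b
      b-roots = map⊎ cancel-2 (λ e → cancel-2 (trans e (lem Q.b))) (square-roots (pos 2 *ᶻ b) (pos 2 *ᶻ Q.b) (begin
        (pos 2 *ᶻ b) *ᶻ (pos 2 *ᶻ b)                                   ≡⟨ lem′ (a *ᶻ a) _ ⟩
        (a *ᶻ a +ᶻ (pos 2 *ᶻ b) *ᶻ (pos 2 *ᶻ b)) -ᶻ a *ᶻ a             ≡⟨ cong₂ _-ᶻ_ (trans ab-norm (sym Q.norm)) aa≡ ⟩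
        (Q.a *ᶻ Q.a +ᶻ (pos 2 *ᶻ Q.b) *ᶻ (pos 2 *ᶻ Q.b)) -ᶻ Q.a *ᶻ Q.a ≡⟨ lem′ (Q.a *ᶻ Q.a) _ ⟨
        (pos 2 *ᶻ Q.b) *ᶻ (pos 2 *ᶻ Q.b)                               ∎))
        where
        open ≡-Reasoning
        lem : ∀ b → ⁻ (pos 2 *ᶻ b) ≡ pos 2 *ᶻ ⁻ b
        lem = solveℤ
        lem′ : ∀ x y → y ≡ (x +ᶻ y) -ᶻ x
        lem′ = solveℤ

      -- The weights u, v of two opposite classes, listed again as w, w′ in the order that fits the
      -- sign of x. The last component says that this order does not affect class sums.
      Pair : ℤ → ℤ → ℕ → ℕ → Set
      Pair σ x u v = ∃₂ λ w w′ → pos (4 * p * w) ≡ numerator σ x × pos (4 * p * w′) ≡ numerator σ (⁻ x) × (∀ (f : ℕ → ℕ) → f u + f v ≡ f w + f w′)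

      choose : ∀ σ x y u v → x ≡ y ⊎ x ≡ ⁻ y → pos (4 * p * u) ≡ numerator σ (⁻ -1ℤ *ᶻ y) → pos (4 * p * v) ≡ numerator σ (⁻ 1ℤ *ᶻ y) → Pair σ x u v
      choose σ x y u v (inj₁ x≡y) eu ev = u , v ,
        trans eu (cong (numerator σ) (trans (⁻⁻1* y) (sym x≡y))) , trans ev (cong (numerator σ) (trans (⁻1* y) (cong ⁻_ (sym x≡y)))) , (λ _ → refl)
      choose σ x y u v (inj₂ x≡⁻y) eu ev = v , u ,
        trans ev (cong (numerator σ) (trans (⁻1* y) (sym x≡⁻y))) , trans eu (cong (numerator σ) (trans (⁻⁻1* y) (trans (sym (ℤₚ.neg-involutive y)) (cong ⁻_ (sym x≡⁻y))))) , (λ f → ℕₚ.+-comm (f u) (f v))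

      2b-roots : pos 2 *ᶻ b ≡ pos 2 *ᶻ Q.b ⊎ pos 2 *ᶻ b ≡ ⁻ (pos 2 *ᶻ Q.b)
      2b-roots = map⊎ (cong (pos 2 *ᶻ_)) (λ e → trans (cong (pos 2 *ᶻ_) e) (lem Q.b)) b-roots
        where
        lem : ∀ b → pos 2 *ᶻ ⁻ b ≡ ⁻ (pos 2 *ᶻ b)
        lem = solveℤ

      combine : Pair 1ℤ a w₋₁ w₁ → Pair -1ℤ (pos 2 *ᶻ b) w₋ι wι → ∀ w → frequency p E k n ω w ≡ predictedFrequency p t (p ^ m) r c a b w
      combine (x₁ , x₂ , f₁ , f₂ , sum₁₂) (x₃ , x₄ , f₃ , f₄ , sum₃₄) = frequency≡predicted a b x₁ x₂ x₃ x₄ sums f₁ f₂ f₃ f₄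
        where
        open ≡-Reasoning
        sums : ∀ (f : ℕ → ℕ) → ∑ⁿ K (f ∘ W) ≡ f 0 + c * (f x₁ + f x₂ + f x₃ + f x₄)
        sums f = begin
          ∑ⁿ K (f ∘ W)                                     ≡⟨ class-sum f ⟩
          f 0 + c * (f w₋₁ + f w₁ + f w₋ι + f wι)          ≡⟨ cong (λ z → f 0 + c * z) (ℕₚ.+-assoc (f w₋₁ + f w₁) (f w₋ι) (f wι)) ⟩
          f 0 + c * ((f w₋₁ + f w₁) + (f w₋ι + f wι))      ≡⟨ cong₂ (λ y z → f 0 + c * (y + z)) (sum₁₂ f) (sum₃₄ f) ⟩
          f 0 + c * ((f x₁ + f x₂) + (f x₃ + f x₄))        ≡⟨ cong (λ z → f 0 + c * z) (ℕₚ.+-assoc (f x₁ + f x₂) (f x₃) (f x₄)) ⟨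
          f 0 + c * (f x₁ + f x₂ + f x₃ + f x₄)            ∎

    weightDistribution : ∀ w → frequency p E k n ω w ≡ predictedFrequency p t (p ^ m) r c a b w
    weightDistribution = combine (choose 1ℤ a Q.a w₋₁ w₁ (square-roots a Q.a aa≡) w₋₁-formula w₁-formula)
                                 (choose -1ℤ (pos 2 *ᶻ b) (pos 2 *ᶻ Q.b) w₋ι wι 2b-roots w₋ι-formula wι-formula)

theorem5p3 : (p r : ℕ) → Prime p → Prime r → p ≢ r → p % 4 ≡ 1 →
    (c k m q t : ℕ) → m ≡ 4 * t → q ≡ p ^ m → 4 * c ≡ q ∸ 1 →
    r * k ≡ 4 * Ψ r q →
    r ∣ q ∸ 1 → gcd 4 r ≡ 1 →
    (F : FiniteField) → FiniteField.card F ≡ q ^ r →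
    (n : ℕ) → n * k ≡ q ^ r ∸ 1 →
    (ω : FiniteField.Carrier F) → FiniteField.IsPrimitive F ω →
    Σ ℤ (λ a → Σ ℤ (λ b → ABCond p t a b))
    × ((a b : ℤ) → ABCond p t a b → (w : ℕ) →
    FiniteField.frequency F p (m * r) k n ω w
    ≡ predictedFrequency p t q r c a b w)
theorem5p3 p r pr prime-r p≢r p%4≡1 c k _ _ t refl refl 4c≡q∸1 rk≡4Ψ r∣q∸1 gcd≡1 F card≡q^r n nk≡ ω ω-prim =
  abCond-exists quarticSum , weightDistribution quarticSum
  where
  instance p≢0 = prime⇒nonZero pr
  0<t : 0 < t
  -- t = 0 would make q^r = 1, while a field has at least the two elements 0 and 1.
  0<t = ℕₚ.n≢0⇒n>0 (λ { refl → ℕₚ.<⇒≢ (Cyclic.1<card F ω ω-prim) (sym (trans card≡q^r (ℕₚ.^-zeroˡ r))) })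
  c-eq : 4 * c + 1 ≡ p ^ (4 * t)
  c-eq = trans (cong (_+ 1) 4c≡q∸1) (ℕₚ.m∸n+n≡m (ℕₚ.m^n>0 p (4 * t)))
  p-eq : p ≡ 4 * (p / 4) + 1
  p-eq = trans (m≡m%n+[m/n]*n p 4) (trans (cong (_+ p / 4 * 4) p%4≡1) (trans (ℕₚ.+-comm 1 (p / 4 * 4)) (cong (_+ 1) (ℕₚ.*-comm (p / 4) 4))))
  open Code F {p} {4 * t * r} pr (trans card≡q^r (ℕₚ.^-*-assoc p (4 * t) r)) ω ω-prim t c (p / 4) r 0<t p-eq c-eq (ℕₚ.*-comm r (4 * t))
    k n prime-r p≢r (gcd≡1⇒coprime gcd≡1) rk≡4Ψ r∣q∸1 (trans nk≡ (cong (_∸ 1) (sym card≡q^r)))
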